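{- The number of fixed-III-planes in $\mathrm{PG}(8,q)$ is $$\frac{q^3(q^2-1)(q-1)(q^2+q+1)}{q^2+q+1-\mathrm g(q-\mathrm n+1)}.$$ Each fixed-III-plane contains exactly $\mathrm g$ fixed points, $\mathrm g(q-\mathrm n)$ II$_{\vdots}$-points and $q^2+q+1-\mathrm g(q-\mathrm n+1)$ III$_{.:}$-points, and contains exactly $\mathrm g$ fixed-II-lines.
   Context: Let $q>2$ be a prime power, $\mathrm n\in\{ -1,0,1\}$ with $q\equiv\mathrm n\pmod 3$, $\mathrm g=\gcd(3,q-1)$. Let $\phi$ be a collineation of $\mathrm{PG}(2,q^3)$ of order 3 fixing pointwise an $\mathbb F_q$-subplane $\mathcal P_{2,q}$. A point $\bar P$ of $\mathrm{PG}(2,q^3)$ has Type I if in $\mathcal P_{2,q}$, Type II if $\bar P,\bar P^\phi,\bar P^{\phi^2}$ are distinct and collinear, Type III if non-collinear. Bose representation: identifying $\mathbb F_{q^3}^3$ with $\mathbb F_q^9$, each point $\bar P$ corresponds to a plane $[\![P]\!]$ of $\mathrm{PG}(8,q)$; a point is an X-point if it lies in $[\![P]\!]$ with $\bar P$ of Type X. $\phi$ induces a projectivity $\sigma$ of $\mathrm{PG}(8,q)$ of order 3 with $[\![P]\!]^\sigma=[\![P^\phi]\!]$. A fixed point is a point fixed by $\sigma$. A II-point $B$ is a II$_{\vdots}$-point if $B,B^\sigma,B^{\sigma^2}$ are collinear; every III-point is called a III$_{.:}$-point. A fixed-II-line is a $\sigma$-fixed line containing a II$_{\vdots}$-point. A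 fixed-III-plane is a $\sigma$-fixed plane containing at least one III-point. -}

module Defs where

open import Level using (0ℓ)
open import Data.Nat as ℕ using (ℕ; suc; _∸_; _%_)
open import Data.Nat.GCD using (gcd)
open import Data.Integer as ℤ using (ℤ; +_)
open import Data.Product using (Σ; ∃; _×_; _,_)
open import Data.Sum using (_⊎_)
open import Data.List using (List; length)
open import Data.List.Membership.Propositional using (_∈_)
open import Data.List.Relation.Unary.All using (All)
open import Data.List.Relation.Unary.Any using (Any)
open import Data.List.Relation.Unary.AllPairs using (AllPairs)
open import Data.List.Relation.Unary.Unique.Propositional using (Unique)
open import Relation.Binary.PropositionalEquality using (_≡_)
open import Relation.Nullary using (¬_)
open import Algebra.Structures using (IsCommutativeRing)

record FiniteField : Set₁ where
  field
    Carrier : Set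
    _+_ _*_ : Carrier → Carrier → Carrier
    -_      : Carrier → Carrier
    0# 1#   : Carrier
    isCommutativeRing : IsCommutativeRing _≡_ _+_ _*_ -_ 0# 1#
    0≢1     : ¬ (0# ≡ 1#)
    inverse : ∀ x → ¬ (x ≡ 0#) → Σ Carrier (λ y → (x * y) ≡ 1#)
    elements : List Carrier
    unique   : Unique elements
    complete : ∀ x → x ∈ elements

  order : ℕ
  order = length elements

  infixl 6 _+_
  infixl 7 _*_

record Extension (F E : FiniteField) : Set where
  private
    module F = FiniteField F
    module E = FiniteField E
  field
    ι      : F.Carrier → E.Carrier
    ι-+    : ∀ a b → ι (a F.+ b) ≡ (ι a E.+ ι b)
    ι-*    : ∀ a b → ι (a F.* b) ≡ (ι a E.* ι b)
    ι-1    : ι F.1# ≡ E.1#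

-- Geometry.  Fix finite fields F = F_q, E = F_{q^3} and an embedding.
-- V = E^3 is simultaneously the underlying vector space of PG(2,q^3)
-- (over E) and, viewed as an F-vector space of dimension 9, the
-- underlying vector space of PG(8,q) (Bose representation).

module Geometry {F E : FiniteField} (X : Extension F E) where
  private
    module F = FiniteField F
    module E = FiniteField E
  open Extension X

  K = F.Carrier
  L = E.Carrier

  record V : Set where
    constructor ⟨_,_,_⟩
    field
      x₀ x₁ x₂ : L
  open V public

  0V : V
  0V = ⟨ E.0# , E.0# , E.0# ⟩

  _⊕_ : V → V → V
  u ⊕ w = ⟨ x₀ u E.+ x₀ w , x₁ u E.+ x₁ w , x₂ u E.+ x₂ w ⟩

  _·_ : L → V → V
  λ' · u = ⟨ λ' E.* x₀ u , λ' E.* x₁ u , λ' E.* x₂ u ⟩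

  _·ᶠ_ : K → V → V
  c ·ᶠ u = ι c · u

  infixl 6 _⊕_
  infixr 7 _·_ _·ᶠ_

  NonZero : V → Set
  NonZero u = ¬ (u ≡ 0V)

  NonZeroE : L → Set
  NonZeroE a = ¬ (a ≡ E.0#)

  NonZeroF : K → Set
  NonZeroF a = ¬ (a ≡ F.0#)

  _∼E_ : V → V → Set
  u ∼E w = ∃ λ (a : L) → NonZeroE a × (w ≡ a · u)

  _∼F_ : V → V → Set
  u ∼F w = ∃ λ (c : K) → NonZeroF c × (w ≡ c ·ᶠ u)

  DepE : V → V → V → Set
  DepE u v w = ∃ λ (a : L) → ∃ λ (b : L) → ∃ λ (c : L) →
    (NonZeroE a ⊎ NonZeroE b ⊎ NonZeroE c) × (a · u ⊕ b · v ⊕ c · w ≡ 0V)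

  DepF : V → V → V → Set
  DepF u v w = ∃ λ (a : K) → ∃ λ (b : K) → ∃ λ (c : K) →
    (NonZeroF a ⊎ NonZeroF b ⊎ NonZeroF c) × (a ·ᶠ u ⊕ b ·ᶠ v ⊕ c ·ᶠ w ≡ 0V)

  IndepF₂ : V → V → Set
  IndepF₂ u v = ∀ a b → (a ·ᶠ u ⊕ b ·ᶠ v ≡ 0V) → (a ≡ F.0#) × (b ≡ F.0#)

  InSpan₂ : V → V → V → Set
  InSpan₂ u v w = ∃ λ (a : K) → ∃ λ (b : K) → w ≡ a ·ᶠ u ⊕ b ·ᶠ v

  InSpan₃ : V → V → V → V → Set
  InSpan₃ u v z w = ∃ λ (a : K) → ∃ λ (b : K) → ∃ λ (c : K) →
    w ≡ a ·ᶠ u ⊕ b ·ᶠ v ⊕ c ·ᶠ z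

  -- Collineations of PG(2,q^3), represented by a lift to vectors

  record Collineation : Set where
    field
      map        : V → V
      nonzero    : ∀ u → NonZero u → NonZero (map u)
      resp       : ∀ u w → NonZero u → u ∼E w → map u ∼E map w
      injective  : ∀ u w → NonZero u → NonZero w → map u ∼E map w → u ∼E w
      surjective : ∀ w → NonZero w → ∃ λ u → NonZero u × (map u ∼E w)
      collinear  : ∀ u v w → NonZero u → NonZero v → NonZero w →
                   DepE u v w → DepE (map u) (map v) (map w)
      collinear⁻ : ∀ u v w → NonZero u → NonZero v → NonZero w →
                   DepE (map u) (map v) (map w) → DepE u v w

  Order3 : Collineation → Set
  Order3 φ = (∀ u → NonZero u → u ∼E φ₃ u) × ∃ λ u → NonZero u × ¬ (u ∼E Collineation.map φ u)
    where φ₃ : V → V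
          φ₃ u = Collineation.map φ (Collineation.map φ (Collineation.map φ u))

  -- the F_q-subplane of PG(2,q^3) determined by a frame b₀ b₁ b₂
  -- (E-independent vectors): points with F-coordinates w.r.t. the frame
  InSubplane : V → V → V → V → Set
  InSubplane b₀ b₁ b₂ u = ∃ λ (w : V) → NonZero w × InSpan₃ b₀ b₁ b₂ w × (w ∼E u)

  module Types (φ : Collineation) (b₀ b₁ b₂ : V) (σ : V → V) where
    φ′ = Collineation.map φ

    TypeI : V → Set
    TypeI u = NonZero u × InSubplane b₀ b₁ b₂ u

    TypeII : V → Set
    TypeII u = NonZero u × ¬ (u ∼E φ′ u) × ¬ (u ∼E φ′ (φ′ u)) × ¬ (φ′ u ∼E φ′ (φ′ u))
               × DepE u (φ′ u) (φ′ (φ′ u))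

    TypeIII : V → Set
    TypeIII u = NonZero u × ¬ DepE u (φ′ u) (φ′ (φ′ u))

    -- points of PG(8,q): a nonzero u ∈ V lies in the Bose plane [[P]]
    -- of the point P = ⟨u⟩_E, so u is an X-point iff P has type X.
    IIIpoint : V → Set
    IIIpoint = TypeIII

    FixedPoint : V → Set
    FixedPoint u = NonZero u × u ∼F σ u

    IIvdots : V → Set
    IIvdots u = TypeII u × DepF u (σ u) (σ (σ u))

    IIIdots : V → Set
    IIIdots = IIIpoint

    record Plane : Set where
      constructor plane
      field
        p₀ p₁ p₂ : V
        indep : ¬ DepF p₀ p₁ p₂

    OnPlane : Plane → V → Set
    OnPlane (plane a b c _) u = NonZero u × InSpan₃ a b c u

    SamePlane : Plane → Plane → Set
    SamePlane π (plane a b c _) = OnPlane π a × OnPlane π b × OnPlane π c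

    FixedPlane : Plane → Set
    FixedPlane π@(plane a b c _) = OnPlane π (σ a) × OnPlane π (σ b) × OnPlane π (σ c)

    FixedIIIPlane : Plane → Set
    FixedIIIPlane π = FixedPlane π × ∃ λ u → OnPlane π u × IIIpoint u

    record Line : Set where
      constructor line
      field
        l₀ l₁ : V
        indep : IndepF₂ l₀ l₁

    OnLine : Line → V → Set
    OnLine (line a b _) u = NonZero u × InSpan₂ a b u

    SameLine : Line → Line → Set
    SameLine ℓ (line a b _) = OnLine ℓ a × OnLine ℓ b

    FixedLine : Line → Set
    FixedLine ℓ@(line a b _) = OnLine ℓ (σ a) × OnLine ℓ (σ b)

    FixedIILine : Line → Set
    FixedIILine ℓ = FixedLine ℓ × ∃ λ u → OnLine ℓ u × IIvdots u

    LineInPlane : Plane → Line → Set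
    LineInPlane π (line a b _) = OnPlane π a × OnPlane π b

HasCount : {A : Set} → (R : A → A → Set) → (P : A → Set) → ℕ → Set
HasCount {A} R P k = Σ (List A) λ xs →
  (length xs ≡ k) × All P xs × AllPairs (λ x y → ¬ R x y) xs ×
  (∀ x → P x → Any (R x) xs)

nq : ℕ → ℤ
nq q with q % 3
... | 0 = + 0
... | 1 = + 1
... | _ = ℤ.-[1+ 0 ]

gq : ℕ → ℕ
gq q = gcd 3 (q ∸ 1)

{-# OPTIONS --safe #-}

-- Write q = |F|.  Comparing σ(a v) for v in the subplane shows that, in coordinates with respect to the
-- frame, σ is x ↦ c θ(x) for a constant c and an automorphism θ of E of order 3, whose fixed field is F
-- because |E| = q³.  A vector u is then a III-point iff its Moore determinant det(x, θx, θ²x) is nonzero,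
-- i.e. iff its coordinates form an F-basis of E; so there are (q³-1)(q³-q)(q³-q²) such vectors.
--
-- A fixed-III-plane through a III-point u is the F-span of u, σu, σ²u, and σ acts on the coordinates
-- (a, b, c) by rotation.  Hence a u + b σu + c σ²u is a III-point iff the circulant determinant
-- a³ + b³ + c³ - 3abc is nonzero, the fixed points are the (λ², λ, 1) with λ³ = 1, and the fixed-II-lines
-- are the lines a + λb + λ²c = 0.  These lines contain all singular points other than fixed ones, each of
-- those just once, and each line carries as many fixed points as x² + x + 1 has roots in F.
-- That number is q + 1 modulo 3, by letting x ↦ -1/(1+x) act on F \ {0, -1}, and it is at most 2.
-- Counting incident pairs of III-points and fixed-III-planes gives the number of planes.

module Submission where

open import Defs
open import Level using (0ℓ)
open import Algebra.Bundles using (CommutativeRing; RawRing)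
open import Algebra.Solver.Ring.AlmostCommutativeRing using (fromCommutativeRing; _-Raw-AlmostCommutative⟶_)
open import Data.Nat as ℕ using (ℕ; zero; suc)
import Data.Nat.Properties as ℕₚ
import Data.Nat.DivMod as DivMod
import Data.Nat.Divisibility as Div
import Data.Nat.GCD as GCD
open import Data.Nat.Solver using (module +-*-Solver)
open import Data.Integer as ℤ using (ℤ; -[1+_]; _⊖_)
import Data.Integer.Properties as ℤₚ
import Data.Integer.Solver as ℤ-Solver
open import Data.Fin using (Fin; zero; suc)
import Data.Fin.Properties as Finₚ
open import Data.Maybe using (Maybe; just; nothing)
open import Data.Product using (Σ; ∃; _×_; _,_; proj₁; proj₂)
open import Data.Product.Properties using (≡-dec)
open import Data.Sum using (_⊎_; inj₁; inj₂; [_,_]′)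
open import Data.Empty using (⊥; ⊥-elim)
open import Data.List using (List; []; _∷_; length; _++_; lookup; filter)
import Data.List.Properties as Listₚ
open import Data.List.Membership.Propositional using (lose; find)
open import Data.List.Membership.Propositional.Properties using (∈-lookup; ∈-AllPairs₂)
open import Data.List.Relation.Unary.All as All using (All; []; _∷_)
import Data.List.Relation.Unary.All.Properties as Allₚ
open import Data.List.Relation.Unary.Any as Any using (Any; here; there; any?)
import Data.List.Relation.Unary.Any.Properties as Anyₚ
open import Data.List.Relation.Unary.AllPairs using (AllPairs; []; _∷_)
import Data.List.Relation.Unary.AllPairs.Properties as AllPairsₚ
open import Relation.Binary.PropositionalEquality using (_≡_; refl; sym; trans; cong; cong₂; subst; module ≡-Reasoning)
open import Relation.Nullary using (¬_; Dec; yes; no; ¬?; _×-dec_; _⊎-dec_)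
open import Relation.Nullary.Decidable using (map′; decidable-stable)
open import Function using (_∘_; id)

-- The map σ is given as an F-linear map that induces φ, so its semilinearity over E has to be
-- extracted: σ preserves E-proportionality, and the subplane supplies enough σ-stable E-lines to
-- force the same coordinate function in all three directions. Two fields are in play throughout.
-- Types of points are defined by dependence over E, while planes and lines live over F. The bridge
-- is that the orbit of a III-point is independent over E: a fixed-III-plane therefore meets each
-- Bose plane in at most one point, and dependence within it is tested by a determinant with entries
-- in F. Inside such a plane c and θ disappear, since σ³ = 1 makes σ an exact rotation. The
-- circulant is treated by polynomial certificates because diagonalising the rotation fails in
-- characteristic 3 and when F lacks cube roots of unity; the three residues of q enter only through
-- the roots of x² + x + 1. Planes are counted through III-vectors, and a factor q - 1 is cancelled
-- at the end.

module Counting where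

  -- Counting up to a relation: pigeonhole, quotients, fibres.

  private variable
    A B : Set
    P Q : A → Set
    R S : A → A → Set
    k m n : ℕ

  -- The laws are asked on `P` only: `SamePlaneIII` below is symmetric only between III-points, and
  -- `Orbit` in `count-order-3` relies on a cube law that is assumed on `P` alone.
  record EquivOn {A : Set} (P : A → Set) (R : A → A → Set) : Set where
    field
      reflexive  : ∀ {x} → P x → R x x
      symmetric  : ∀ {x y} → P x → P y → R x y → R y x
      transitive : ∀ {x y z} → P x → P y → P z → R x y → R y z → R x z

  ≡-equivOn : EquivOn P _≡_
  ≡-equivOn = record { reflexive = λ _ → refl ; symmetric = λ _ _ → sym ; transitive = λ _ _ _ → trans }

  lookup-injective : EquivOn P R → ∀ {xs} → All P xs → AllPairs (λ x y → ¬ R x y) xs →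
    ∀ i j → R (lookup xs i) (lookup xs j) → i ≡ j
  lookup-injective e (p ∷ ps) (r ∷ rs) zero    zero    h = refl
  lookup-injective e (p ∷ ps) (r ∷ rs) zero    (suc j) h = ⊥-elim (All.lookup r (∈-lookup j) h)
  lookup-injective e (p ∷ ps) (r ∷ rs) (suc i) zero    h =
    ⊥-elim (All.lookup r (∈-lookup i) (EquivOn.symmetric e (All.lookup ps (∈-lookup i)) p h))
  lookup-injective e (p ∷ ps) (r ∷ rs) (suc i) (suc j) h = cong suc (lookup-injective e ps rs i j h)

  -- Pigeonhole: x goes to the index of the representative that covers f x. Injectivity is phrased
  -- through a common `S`-neighbour z, that representative, so that `S` itself needs no laws.
  count-≤ : {A B : Set} {P : A → Set} {R : A → A → Set} {Q : B → Set} {S : B → B → Set} →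
    EquivOn P R → HasCount R P m → HasCount S Q n → (f : ∀ x → P x → B) → (∀ x p → Q (f x p)) →
    (∀ x p y p′ z → Q z → S (f x p) z → S (f y p′) z → R x y) → m ℕ.≤ n
  count-≤ {S = S} e (xs , refl , ps , rs , _) (ys , refl , qs , _ , cover) f fQ inj =
    Finₚ.injective⇒≤ {f = φ} λ {i} {j} h → lookup-injective e ps rs i j (φ-inj i j h)
    where
    member : ∀ i → _
    member i = All.lookup ps (∈-lookup i)
    found : ∀ i → _
    found i = cover _ (fQ (lookup xs i) (member i))
    φ : Fin (length xs) → Fin (length ys)
    φ i = Any.index (found i)
    φ-inj : ∀ i j → φ i ≡ φ j → _
    φ-inj i j h = inj _ (member i) _ (member j) (lookup ys (φ j)) (All.lookup qs (∈-lookup (φ j)))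
      (subst (λ z → S _ (lookup ys z)) h (Anyₚ.lookup-index (found i))) (Anyₚ.lookup-index (found j))

  count-unique : EquivOn P R → HasCount R P m → HasCount R P n → m ≡ n
  count-unique {P = P} {R = R} e c d = ℕₚ.≤-antisym (go c d) (go d c)
    where
    open EquivOn e
    go : ∀ {m n} → HasCount R P m → HasCount R P n → m ℕ.≤ n
    go c d = count-≤ e c d (λ x _ → x) (λ _ p → p)
      λ x p y p′ z q h h′ → transitive p q p′ h (symmetric p′ q h′)

  count-cong : (∀ x → P x → Q x) → (∀ x → Q x → P x) → HasCount R P n → HasCount R Q n
  count-cong to from (xs , l , ps , rs , cover) =
    xs , l , All.map (to _) ps , rs , λ x q → cover x (from x q)

  -- The last premise carries the class of a preimage of b to b itself, so that S needs no laws.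
  count-transfer : {A B : Set} {P : A → Set} {R : A → A → Set} {Q : B → Set} {S : B → B → Set} →
    (f : ∀ x → P x → B) → (∀ x p → Q (f x p)) →
    (∀ x p y p′ → S (f x p) (f y p′) → R x y) →
    (∀ b → Q b → ∃ λ x → P x × (∀ y p → R x y → S b (f y p))) →
    HasCount R P n → HasCount S Q n
  count-transfer {A = A} {B} {P} {R} {Q} {S} f fQ inj surj (xs , refl , ps , rs , cover) =
    image ps , length-image ps , all-image ps , pairs-image ps rs , λ b q →
      let x , p , h = surj b q in any-image ps (cover x p) (h _ _)
    where
    image : ∀ {xs} → All P xs → List B
    image = All.reduce (λ {x} p → f x p)
    length-image : ∀ {xs} (ps : All P xs) → length (image ps) ≡ length xs
    length-image [] = refl
    length-image (p ∷ ps) = cong suc (length-image ps)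
    all-image : ∀ {xs} (ps : All P xs) → All Q (image ps)
    all-image [] = []
    all-image (p ∷ ps) = fQ _ p ∷ all-image ps
    apart-image : ∀ {x xs} p (ps : All P xs) → All (λ y → ¬ R x y) xs → All (λ b → ¬ S (f x p) b) (image ps)
    apart-image p [] [] = []
    apart-image p (p′ ∷ ps) (r ∷ rs) = (λ h → r (inj _ p _ p′ h)) ∷ apart-image p ps rs
    pairs-image : ∀ {xs} (ps : All P xs) → AllPairs (λ x y → ¬ R x y) xs → AllPairs (λ b c → ¬ S b c) (image ps)
    pairs-image [] [] = []
    pairs-image (p ∷ ps) (r ∷ rs) = apart-image p ps r ∷ pairs-image ps rs
    any-image : ∀ {b x xs} (ps : All P xs) → Any (R x) xs → (∀ {y} {p} → R x y → S b (f y p)) → Any (S b) (image ps)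
    any-image (p ∷ ps) (here r) h = here (h r)
    any-image (p ∷ ps) (there r) h = there (any-image ps r h)

  count-union : HasCount R P m → HasCount R Q n → (∀ x y → P x → Q y → ¬ R x y) →
    HasCount R (λ x → P x ⊎ Q x) (m ℕ.+ n)
  count-union (xs , refl , ps , rs , cover) (ys , refl , qs , rs′ , cover′) apart =
    xs ++ ys , Listₚ.length-++ xs
    , Allₚ.++⁺ (All.map inj₁ ps) (All.map inj₂ qs)
    , AllPairsₚ.++⁺ rs rs′ (All.map (λ p → All.map (apart _ _ p) qs) ps)
    , λ x → [ (λ p → Anyₚ.++⁺ˡ (cover x p)) , (λ q → Anyₚ.++⁺ʳ xs (cover′ x q)) ]′

  count-filter : {A : Set} {P D : A → Set} {R : A → A → Set} → (∀ x → Dec (D x)) →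
    (∀ {x y} → P x → P y → R x y → D x → D y) → HasCount R P n →
    ∃ λ k → HasCount R (λ x → P x × D x) k
  count-filter {P = P} {D} {R} D? resp (xs , _ , ps , rs , cover) =
    _ , filter D? xs , refl , All.zip (Allₚ.filter⁺ D? ps , Allₚ.all-filter D? xs)
    , AllPairsₚ.filter⁺ D? rs , λ x (p , d) → keep p d (cover x p)
    where
    keep : ∀ {x} → P x → D x → Any (R x) xs → Any (R x) (filter D? xs)
    keep p d a with Anyₚ.filter⁺ D? a
    ... | inj₁ a′ = a′
    ... | inj₂ ¬d = let p′ , r = All.lookupAny ps a in ⊥-elim (¬d (resp p p′ r d))

  count-split : {A : Set} {P D : A → Set} {R : A → A → Set} → EquivOn P R → (∀ x → Dec (D x)) →
    (∀ {x y} → P x → P y → R x y → D x → D y) → HasCount R P n →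
    ∃ λ k → ∃ λ l → HasCount R (λ x → P x × D x) k × HasCount R (λ x → P x × ¬ D x) l × k ℕ.+ l ≡ n
  count-split {P = P} {D} {R} e D? resp c =
    let k , ck = count-filter D? resp c
        l , cl = count-filter (λ x → ¬? (D? x)) (λ p p′ r ¬d d → ¬d (resp p′ p (symmetric p p′ r) d)) c
        u = count-union ck cl λ x y (p , d) (p′ , ¬d) r → ¬d (resp p p′ r d)
    in k , l , ck , cl , count-unique e (count-cong (λ x → [ proj₁ , proj₁ ]′) part u) c
    where
    open EquivOn e
    part : ∀ x → P x → (P x × D x) ⊎ (P x × ¬ D x)
    part x p with D? x
    ... | yes d = inj₁ (p , d)
    ... | no ¬d = inj₂ (p , ¬d)

  -- An element is kept only if no element retained so far is `S`-related to it. The number of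
  -- classes stays unspecified here; a fibre count determines it later.
  count-quotient : {A : Set} {P : A → Set} {R S : A → A → Set} → EquivOn P S → (∀ x y → Dec (S x y)) →
    (∀ {x y} → P x → P y → R x y → S x y) → HasCount R P n → ∃ λ k → HasCount S P k
  count-quotient {P = P} {R} {S} e S? R⊆S (xs , _ , ps , _ , cover) =
    let ys , qs , ss , f = thin ps
    in _ , ys , refl , qs , ss , λ x p → f p (relate p ps (cover x p))
    where
    open EquivOn e
    relate : ∀ {x xs} → P x → All P xs → Any (R x) xs → Any (S x) xs
    relate p (p′ ∷ ps) (here r) = here (R⊆S p p′ r)
    relate p (p′ ∷ ps) (there a) = there (relate p ps a)
    via : ∀ {x y ys} → P x → P y → S x y → All P ys → Any (S y) ys → Any (S x) ys
    via p p′ s (q ∷ qs) (here s′) = here (transitive p p′ q s s′)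
    via p p′ s (q ∷ qs) (there a) = there (via p p′ s qs a)
    thin : ∀ {xs} → All P xs → ∃ λ ys → All P ys × AllPairs (λ x y → ¬ S x y) ys ×
      (∀ {x} → P x → Any (S x) xs → Any (S x) ys)
    thin [] = [] , [] , [] , λ _ ()
    thin {x ∷ xs} (p ∷ ps) with thin ps
    ... | ys , qs , ss , f with any? (S? x) ys
    ... | yes a = ys , qs , ss , λ { p′ (here s) → via p′ p s qs a ; p′ (there a′) → f p′ a′ }
    ... | no ¬a = x ∷ ys , p ∷ qs , Allₚ.¬Any⇒All¬ ys ¬a ∷ ss ,
      λ { p′ (here s) → here s ; p′ (there a′) → there (f p′ a′) }

  -- Double counting with an incidence relation `G` in place of a function. The premise on
  -- `S`-related y lets every x be attached to a listed representative, and the separation premise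
  -- keeps the fibres over different representatives disjoint.
  count-fibres : {A B : Set} {P : A → Set} {R : A → A → Set} {Q : B → Set} {S : B → B → Set} →
    HasCount S Q n → (G : A → B → Set) → (∀ x → P x → ∃ λ y → Q y × G x y) →
    (∀ {x y y′} → P x → Q y → Q y′ → G x y → S y y′ → G x y′) →
    (∀ {x x′ y y′} → P x → P x′ → Q y → Q y′ → R x x′ → G x y → G x′ y′ → S y y′) →
    (∀ y → Q y → HasCount R (λ x → P x × G x y) k) →
    HasCount R P (n ℕ.* k)
  count-fibres {n = n} {k = k} {A = A} {B} {P} {R} {Q} {S} (ys , refl , qs , ss , cover) G total resp separate fibre =
    count-cong (λ _ → proj₁) (λ x p → p , (let y , q , g = total x p in move p q g qs (cover y q))) (go qs ss)
    where
    move : ∀ {x y ys} → P x → Q y → G x y → All Q ys → Any (S y) ys → Any (G x) ys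
    move p q g (q′ ∷ _) (here s) = here (resp p q q′ g s)
    move p q g (_ ∷ qs) (there a) = there (move p q g qs a)
    go : ∀ {ys} → All Q ys → AllPairs (λ y y′ → ¬ S y y′) ys →
      HasCount R (λ x → P x × Any (G x) ys) (length ys ℕ.* k)
    go [] [] = [] , refl , [] , [] , λ _ ()
    go {y ∷ ys} (q ∷ qs) (s ∷ ss) = count-cong
      (λ x → [ (λ (p , g) → p , here g) , (λ (p , a) → p , there a) ]′)
      (λ { x (p , here g) → inj₁ (p , g) ; x (p , there a) → inj₂ (p , a) })
      (count-union (fibre y q) (go qs ss) λ x x′ (p , g) (p′ , a) r → clash p p′ r g qs s a)
      where
      clash : ∀ {x x′ ys} → P x → P x′ → R x x′ → G x y → All Q ys → All (λ y′ → ¬ S y y′) ys →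
        Any (G x′) ys → ⊥
      clash p p′ r g (q′ ∷ _) (¬s ∷ _) (here g′) = ¬s (separate p p′ q q′ r g g′)
      clash p p′ r g (_ ∷ qs) (_ ∷ ss) (there a) = clash p p′ r g qs ss a

  count-Σ : {P : A → Set} {Q : A → B → Set} → HasCount _≡_ P m → (∀ a → P a → HasCount _≡_ (Q a) n) →
    HasCount _≡_ (λ ((a , b) : A × B) → P a × Q a b) (m ℕ.* n)
  count-Σ {Q = Q} cP cQ = count-fibres cP (λ x a → proj₁ x ≡ a) (λ x (p , _) → _ , p , refl)
    (λ { _ _ _ refl refl → refl }) (λ { _ _ _ _ refl refl refl → refl })
    λ a p → count-transfer (λ b _ → a , b) (λ b q → (p , q) , refl) (λ { _ _ _ _ refl → refl })
      (λ { (a , b) ((_ , q) , refl) → b , q , λ { _ _ refl → refl } }) (cQ a p)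

  count-pairs : {P : A → Set} {Q : B → Set} → HasCount _≡_ P m → HasCount _≡_ Q n →
    HasCount _≡_ (λ ((a , b) : A × B) → P a × Q b) (m ℕ.* n)
  count-pairs cP cQ = count-Σ cP λ _ _ → cQ

  -- A permutation of order 3 moves its non-fixed elements in orbits of size 3.
  count-order-3 : {A : Set} {P : A → Set} → (∀ (x y : A) → Dec (x ≡ y)) → HasCount _≡_ P n →
    (ρ : A → A) → (∀ {x} → P x → P (ρ x)) → (∀ {x} → P x → ρ (ρ (ρ x)) ≡ x) →
    ∃ λ k → ∃ λ l → HasCount _≡_ (λ x → P x × ρ x ≡ x) k × k ℕ.+ l ℕ.* 3 ≡ n
  count-order-3 {n = n} {A = A} {P} _≟_ c ρ closed cube =
    let k , l , ck , cl , eq = count-split ≡-equivOn (λ x → ρ x ≟ x) (λ { _ _ refl d → d }) c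
        j , cj = count-quotient orbit-equiv orbit? (λ { _ _ refl → inj₁ refl }) cl
        c3 = count-fibres cj (λ x y → Orbit y x) (λ x p → x , p , inj₁ refl)
               (λ p q q′ g s → transitive q′ q p (symmetric q q′ s) g)
               (λ { p _ q q′ refl g g′ → transitive q p q′ g (symmetric q′ p g′) })
               fibre
    in k , j , ck , trans (cong (k ℕ.+_) (count-unique ≡-equivOn c3 cl)) eq
    where
    Moved : A → Set
    Moved x = P x × ¬ ρ x ≡ x
    Orbit : A → A → Set
    Orbit x y = y ≡ x ⊎ y ≡ ρ x ⊎ y ≡ ρ (ρ x)
    orbit? : ∀ x y → Dec (Orbit x y)
    orbit? x y = (y ≟ x) ⊎-dec ((y ≟ ρ x) ⊎-dec (y ≟ ρ (ρ x)))
    orbit-equiv : EquivOn Moved Orbit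
    orbit-equiv = record { reflexive = λ _ → inj₁ refl ; symmetric = s ; transitive = t }
      where
      s : ∀ {x y} → Moved x → Moved y → Orbit x y → Orbit y x
      s (p , _) _ (inj₁ refl) = inj₁ refl
      s (p , _) _ (inj₂ (inj₁ refl)) = inj₂ (inj₂ (sym (cube p)))
      s (p , _) _ (inj₂ (inj₂ refl)) = inj₂ (inj₁ (sym (cube p)))
      t : ∀ {x y z} → Moved x → Moved y → Moved z → Orbit x y → Orbit y z → Orbit x z
      t _ _ _ (inj₁ refl) o = o
      t _ _ _ (inj₂ (inj₁ refl)) (inj₁ refl) = inj₂ (inj₁ refl)
      t _ _ _ (inj₂ (inj₁ refl)) (inj₂ (inj₁ refl)) = inj₂ (inj₂ refl)
      t (p , _) _ _ (inj₂ (inj₁ refl)) (inj₂ (inj₂ refl)) = inj₁ (cube p)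
      t _ _ _ (inj₂ (inj₂ refl)) (inj₁ refl) = inj₂ (inj₂ refl)
      t (p , _) _ _ (inj₂ (inj₂ refl)) (inj₂ (inj₁ refl)) = inj₁ (cube p)
      t (p , _) _ _ (inj₂ (inj₂ refl)) (inj₂ (inj₂ refl)) = inj₂ (inj₁ (cong ρ (cube p)))
    open EquivOn orbit-equiv
    moved : ∀ {x} → Moved x → Moved (ρ x)
    moved (p , ne) = closed p , λ h → ne (trans (sym (cong ρ (cube p))) (trans (cong (ρ ∘ ρ) h) (cube p)))
    fibre : ∀ y → Moved y → HasCount _≡_ (λ x → Moved x × Orbit y x) 3
    fibre y m@(p , ne) = y ∷ ρ y ∷ ρ (ρ y) ∷ [] , refl
      , (m , inj₁ refl) ∷ (moved m , inj₂ (inj₁ refl)) ∷ (moved (moved m) , inj₂ (inj₂ refl)) ∷ []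
      , ((λ h → ne (sym h)) ∷ (λ h → ne (trans (cong ρ h) (cube p))) ∷ [])
        ∷ ((λ h → proj₂ (moved m) (sym h)) ∷ []) ∷ [] ∷ []
      , λ { x (_ , inj₁ h) → here h ; x (_ , inj₂ (inj₁ h)) → there (here h)
          ; x (_ , inj₂ (inj₂ h)) → there (there (here h)) }

  count-remove : {A : Set} {P : A → Set} → (∀ (x y : A) → Dec (x ≡ y)) → HasCount _≡_ P n → ∀ a → P a →
    ∃ λ m → HasCount _≡_ (λ x → P x × ¬ x ≡ a) m × n ≡ suc m
  count-remove {P = P} _≟_ c a p =
    let k , l , ck , cl , eq = count-split ≡-equivOn (_≟ a) (λ { _ _ refl d → d }) c
        one : HasCount _≡_ (λ x → P x × x ≡ a) 1
        one = a ∷ [] , refl , (p , refl) ∷ [] , [] ∷ [] , λ { x (_ , h) → here h }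
    in l , cl , trans (sym eq) (cong (ℕ._+ l) (count-unique ≡-equivOn ck one))

  count-complement : {A : Set} {P D : A → Set} → HasCount _≡_ P n → (∀ x → Dec (D x)) → (∀ x → D x → P x) →
    HasCount _≡_ D k → HasCount _≡_ (λ x → P x × ¬ D x) (n ℕ.∸ k)
  count-complement c D? D⊆P cD =
    let i , j , ci , cj , e = count-split ≡-equivOn D? (λ { _ _ refl d → d }) c
        i≡k = count-unique ≡-equivOn ci (count-cong (λ x d → D⊆P x d , d) (λ _ → proj₂) cD)
    in subst (HasCount _≡_ _) (trans (sym (ℕₚ.m+n∸m≡n i j)) (cong₂ ℕ._∸_ e i≡k)) cj

open Counting

cong₃ : {A B C D : Set} (f : A → B → C → D) {a a′ : A} {b b′ : B} {c c′ : C} → a ≡ a′ → b ≡ b′ → c ≡ c′ → f a b c ≡ f a′ b′ c′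
cong₃ f refl refl refl = refl

-- The constants n and g by residue of q modulo 3.

gcd-3-+ : ∀ k l → GCD.gcd 3 (k ℕ.+ l ℕ.* 3) ≡ GCD.gcd 3 k
gcd-3-+ k l = Div.∣-antisym
  (GCD.gcd-greatest (GCD.gcd[m,n]∣m 3 (k ℕ.+ l ℕ.* 3)) (Div.∣m+n∣m⇒∣n (subst (GCD.gcd 3 (k ℕ.+ l ℕ.* 3) Div.∣_) (ℕₚ.+-comm k (l ℕ.* 3)) (GCD.gcd[m,n]∣n 3 (k ℕ.+ l ℕ.* 3)))
    (Div.∣n⇒∣m*n l (GCD.gcd[m,n]∣m 3 (k ℕ.+ l ℕ.* 3)))))
  (GCD.gcd-greatest (GCD.gcd[m,n]∣m 3 k) (Div.∣m∣n⇒∣m+n (GCD.gcd[m,n]∣n 3 k) (Div.∣n⇒∣m*n l (GCD.gcd[m,n]∣m 3 k))))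

-- The shapes 3 + 3l, 4 + 3l and 2 + 3l are 2 + r + 3l for r = 1, 2 and 0 roots of x² + x + 1; the 2
-- accounts for the elements 0 and -1, which the order 3 map on the field leaves out.
residue₀ : ∀ {q} l → q ≡ 3 ℕ.+ l ℕ.* 3 → nq q ≡ ℤ.+ 0 × gq q ≡ 1
residue₀ l refl = nq₀ (3 ℕ.+ l ℕ.* 3) (DivMod.[m+kn]%n≡m%n 3 l 3) , gcd-3-+ 2 l
  where
  nq₀ : ∀ q → q ℕ.% 3 ≡ 0 → nq q ≡ ℤ.+ 0
  nq₀ q h with q ℕ.% 3 | h
  ... | .0 | refl = refl

residue₁ : ∀ {q} l → q ≡ 4 ℕ.+ l ℕ.* 3 → nq q ≡ ℤ.+ 1 × gq q ≡ 3
residue₁ l refl = nq₁ (4 ℕ.+ l ℕ.* 3) (DivMod.[m+kn]%n≡m%n 4 l 3) , gcd-3-+ 3 l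
  where
  nq₁ : ∀ q → q ℕ.% 3 ≡ 1 → nq q ≡ ℤ.+ 1
  nq₁ q h with q ℕ.% 3 | h
  ... | .1 | refl = refl

residue₂ : ∀ {q} l → q ≡ 2 ℕ.+ l ℕ.* 3 → nq q ≡ -[1+ 0 ] × gq q ≡ 1
residue₂ l refl = nq₂ (2 ℕ.+ l ℕ.* 3) (DivMod.[m+kn]%n≡m%n 2 l 3) , gcd-3-+ 1 l
  where
  nq₂ : ∀ q → q ℕ.% 3 ≡ 2 → nq q ≡ -[1+ 0 ]
  nq₂ q h with q ℕ.% 3 | h
  ... | .2 | refl = refl

-- Finite fields: polynomial identities, 3×3 determinants, cube roots of unity.

module FieldTheory (K : FiniteField) where
  open FiniteField K public

  commutativeRing : CommutativeRing 0ℓ 0ℓ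
  commutativeRing = record { isCommutativeRing = isCommutativeRing }
  open CommutativeRing commutativeRing public
    using (+-identityˡ; +-identityʳ; +-comm; +-assoc; *-identityˡ; *-identityʳ; *-comm; *-assoc; zeroˡ; zeroʳ; -‿inverseʳ; _-_)
  private
    module R = CommutativeRing commutativeRing
  open import Algebra.Properties.Semiring.Mult.TCOptimised R.semiring using (×-homo-+; ×1-homo-*; 1+×)
    renaming (_×_ to _×ₙ_)
  open import Algebra.Properties.Ring R.ring using (-‿distribˡ-*; -‿distribʳ-*; -0#≈0#; -‿involutive)
  open import Algebra.Properties.AbelianGroup R.+-abelianGroup using (⁻¹-∙-comm)

  -- Integer coefficients give the ring solver constants whose equality computes. Every identity it
  -- certifies holds over ℤ, hence in all characteristics, 3 included.
  embedℤ : ℤ → Carrier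
  embedℤ (ℤ.+ n) = n ×ₙ 1#
  embedℤ -[1+ n ] = - (suc n ×ₙ 1#)

  private
    embed-neg : ∀ i → embedℤ (ℤ.- i) ≡ - embedℤ i
    embed-neg (ℤ.+ zero) = sym -0#≈0#
    embed-neg (ℤ.+ suc n) = refl
    embed-neg -[1+ n ] = sym (-‿involutive _)

    embed-⊖ : ∀ m n → embedℤ (m ⊖ n) ≡ m ×ₙ 1# - n ×ₙ 1#
    embed-⊖ m zero = sym (trans (cong (m ×ₙ 1# +_) -0#≈0#) (+-identityʳ _))
    embed-⊖ zero (suc n) = sym (+-identityˡ _)
    embed-⊖ (suc m) (suc n) = begin
      embedℤ (suc m ⊖ suc n)                    ≡⟨ cong embedℤ (ℤₚ.[1+m]⊖[1+n]≡m⊖n m n) ⟩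
      embedℤ (m ⊖ n)                            ≡⟨ embed-⊖ m n ⟩
      m ×ₙ 1# - n ×ₙ 1#                         ≡⟨ sym (+-identityˡ _) ⟩
      0# + (m ×ₙ 1# - n ×ₙ 1#)                  ≡⟨ cong (_+ (m ×ₙ 1# - n ×ₙ 1#)) (sym (-‿inverseʳ 1#)) ⟩
      (1# - 1#) + (m ×ₙ 1# - n ×ₙ 1#)           ≡⟨ +-assoc _ _ _ ⟩
      1# + (- 1# + (m ×ₙ 1# - n ×ₙ 1#))         ≡⟨ cong (1# +_) (sym (+-assoc _ _ _)) ⟩
      1# + ((- 1# + m ×ₙ 1#) - n ×ₙ 1#)         ≡⟨ cong (λ z → 1# + (z - n ×ₙ 1#)) (+-comm _ _) ⟩
      1# + ((m ×ₙ 1# - 1#) - n ×ₙ 1#)           ≡⟨ cong (1# +_) (+-assoc _ _ _) ⟩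
      1# + (m ×ₙ 1# + (- 1# - n ×ₙ 1#))         ≡⟨ sym (+-assoc _ _ _) ⟩
      (1# + m ×ₙ 1#) + (- 1# - n ×ₙ 1#)         ≡⟨ cong (1# + m ×ₙ 1# +_) (⁻¹-∙-comm _ _) ⟩
      (1# + m ×ₙ 1#) - (1# + n ×ₙ 1#)           ≡⟨ sym (cong₂ _-_ (1+× m 1#) (1+× n 1#)) ⟩
      suc m ×ₙ 1# - suc n ×ₙ 1#                 ∎
      where open ≡-Reasoning

    embed-+ : ∀ i j → embedℤ (i ℤ.+ j) ≡ embedℤ i + embedℤ j
    embed-+ (ℤ.+ m) (ℤ.+ n) = ×-homo-+ 1# m n
    embed-+ (ℤ.+ m) -[1+ n ] = embed-⊖ m (suc n)
    embed-+ -[1+ m ] (ℤ.+ n) = trans (embed-⊖ n (suc m)) (+-comm _ _)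
    embed-+ -[1+ m ] -[1+ n ] = trans (cong (λ k → - (k ×ₙ 1#)) (sym (ℕₚ.+-suc (suc m) n)))
      (trans (cong -_ (×-homo-+ 1# (suc m) (suc n))) (sym (⁻¹-∙-comm _ _)))

    embed-*⁺ : ∀ m j → embedℤ (ℤ.+ m ℤ.* j) ≡ embedℤ (ℤ.+ m) * embedℤ j
    embed-*⁺ m (ℤ.+ n) = trans (cong embedℤ (sym (ℤₚ.pos-* m n))) (×1-homo-* m n)
    embed-*⁺ m -[1+ n ] = begin
      embedℤ (ℤ.+ m ℤ.* ℤ.- (ℤ.+ suc n))        ≡⟨ cong embedℤ (sym (ℤₚ.neg-distribʳ-* (ℤ.+ m) (ℤ.+ suc n))) ⟩
      embedℤ (ℤ.- (ℤ.+ m ℤ.* ℤ.+ suc n))        ≡⟨ embed-neg (ℤ.+ m ℤ.* ℤ.+ suc n) ⟩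
      - embedℤ (ℤ.+ m ℤ.* ℤ.+ suc n)            ≡⟨ cong -_ (embed-*⁺ m (ℤ.+ suc n)) ⟩
      - (m ×ₙ 1# * suc n ×ₙ 1#)                 ≡⟨ -‿distribʳ-* _ _ ⟩
      m ×ₙ 1# * - (suc n ×ₙ 1#)                 ∎
      where open ≡-Reasoning

    embed-* : ∀ i j → embedℤ (i ℤ.* j) ≡ embedℤ i * embedℤ j
    embed-* (ℤ.+ m) j = embed-*⁺ m j
    embed-* -[1+ m ] j = begin
      embedℤ (ℤ.- (ℤ.+ suc m) ℤ.* j)            ≡⟨ cong embedℤ (sym (ℤₚ.neg-distribˡ-* (ℤ.+ suc m) j)) ⟩
      embedℤ (ℤ.- (ℤ.+ suc m ℤ.* j))            ≡⟨ embed-neg (ℤ.+ suc m ℤ.* j) ⟩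
      - embedℤ (ℤ.+ suc m ℤ.* j)                ≡⟨ cong -_ (embed-*⁺ (suc m) j) ⟩
      - (suc m ×ₙ 1# * embedℤ j)                ≡⟨ -‿distribˡ-* _ _ ⟩
      - (suc m ×ₙ 1#) * embedℤ j                ∎
      where open ≡-Reasoning

    ℤ-rawRing : RawRing 0ℓ 0ℓ
    ℤ-rawRing = record { Carrier = ℤ ; _≈_ = _≡_ ; _+_ = ℤ._+_ ; _*_ = ℤ._*_ ; -_ = ℤ.-_ ; 0# = ℤ.+ 0 ; 1# = ℤ.+ 1 }

    embedding : ℤ-rawRing -Raw-AlmostCommutative⟶ fromCommutativeRing commutativeRing
    embedding = record { ⟦_⟧ = embedℤ ; +-homo = embed-+ ; *-homo = embed-* ; -‿homo = embed-neg ; 0-homo = refl ; 1-homo = refl }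

    coefficient≟ : ∀ i j → Maybe (embedℤ i ≡ embedℤ j)
    coefficient≟ i j with i ℤₚ.≟ j
    ... | yes h = just (cong embedℤ h)
    ... | no _ = nothing

  open import Algebra.Solver.Ring ℤ-rawRing (fromCommutativeRing commutativeRing) embedding coefficient≟ public
    using (solve; _:=_; _:+_; _:*_; _:-_; :-_; con; Polynomial)

  :0 :1 : ∀ {n} → Polynomial n
  :0 = con (ℤ.+ 0)
  :1 = con (ℤ.+ 1)

  Tri : Set
  Tri = Carrier × Carrier × Carrier

  infixl 6 _⊞_
  infixr 7 _⊡_
  _⊞_ : Tri → Tri → Tri
  (x , y , z) ⊞ (x′ , y′ , z′) = x + x′ , y + y′ , z + z′
  _⊡_ : Carrier → Tri → Tri
  c ⊡ (x , y , z) = c * x , c * y , c * z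

  det : Tri → Tri → Tri → Carrier
  det (x₀ , x₁ , x₂) (y₀ , y₁ , y₂) (z₀ , z₁ , z₂) =
    x₀ * (y₁ * z₂ - y₂ * z₁) + x₁ * (y₂ * z₀ - y₀ * z₂) + x₂ * (y₀ * z₁ - y₁ * z₀)

  :det : ∀ {n} → (x₀ x₁ x₂ y₀ y₁ y₂ z₀ z₁ z₂ : Polynomial n) → Polynomial n
  :det x₀ x₁ x₂ y₀ y₁ y₂ z₀ z₁ z₂ =
    x₀ :* (y₁ :* z₂ :- y₂ :* z₁) :+ x₁ :* (y₂ :* z₀ :- y₀ :* z₂) :+ x₂ :* (y₀ :* z₁ :- y₁ :* z₀)

  infix 4 _≟_
  _≟_ : ∀ x y → Dec (x ≡ y)
  x ≟ y with ∈-AllPairs₂ unique (complete x) (complete y)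
  ... | inj₁ h = yes h
  ... | inj₂ (inj₁ h) = no h
  ... | inj₂ (inj₂ h) = no (h ∘ sym)

  exists? : {P : Carrier → Set} → (∀ x → Dec (P x)) → Dec (∃ P)
  exists? P? = map′ (λ a → _ , proj₂ (proj₂ (find a))) (λ (x , p) → lose (complete x) p) (any? P? elements)

  count-carrier : HasCount _≡_ (λ (x : Carrier) → x ≡ x) order
  count-carrier = elements , refl , All.tabulate (λ _ → refl) , unique , λ x _ → complete x

  cancel : ∀ {x y} → ¬ x ≡ 0# → x * y ≡ 0# → y ≡ 0#
  cancel {x} {y} x≢0 h = let i , xi = inverse x x≢0 in begin
    y              ≡⟨ sym (*-identityˡ y) ⟩
    1# * y         ≡⟨ cong (_* y) (sym xi) ⟩
    (x * i) * y    ≡⟨ solve 3 (λ x i y → (x :* i) :* y := i :* (x :* y)) refl x i y ⟩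
    i * (x * y)    ≡⟨ cong (i *_) h ⟩
    i * 0#         ≡⟨ zeroʳ i ⟩
    0#             ∎
    where open ≡-Reasoning

  *-nonzero : ∀ {x y} → ¬ x ≡ 0# → ¬ y ≡ 0# → ¬ x * y ≡ 0#
  *-nonzero x≢0 y≢0 h = y≢0 (cancel x≢0 h)

  zero-product : ∀ x {y} → x * y ≡ 0# → x ≡ 0# ⊎ y ≡ 0#
  zero-product x h with x ≟ 0#
  ... | yes p = inj₁ p
  ... | no p = inj₂ (cancel p h)

  unit-nonzero : ∀ {x y} → x * y ≡ 1# → ¬ x ≡ 0#
  unit-nonzero h refl = 0≢1 (trans (sym (zeroˡ _)) h)

  difference-zero : ∀ {x y} → x ≡ y → x - y ≡ 0#
  difference-zero refl = -‿inverseʳ _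

  equal-of-difference : ∀ {x y} → x - y ≡ 0# → x ≡ y
  equal-of-difference {x} {y} h = begin
    x            ≡⟨ solve 2 (λ x y → x := (x :- y) :+ y) refl x y ⟩
    (x - y) + y  ≡⟨ cong (_+ y) h ⟩
    0# + y       ≡⟨ +-identityˡ y ⟩
    y            ∎
    where open ≡-Reasoning

  cancel-≡ : ∀ {c x y} → ¬ c ≡ 0# → c * x ≡ c * y → x ≡ y
  cancel-≡ {c} {x} {y} c≢0 h = equal-of-difference (cancel c≢0
    (trans (solve 3 (λ c x y → c :* (x :- y) := c :* x :- c :* y) refl c x y) (difference-zero h)))

  -- Ideal-membership certificates: the solver verifies an explicit polynomial combination, and the
  -- hypotheses kill its generators.
  vanish : ∀ {b k h} → b ≡ k * h → h ≡ 0# → b ≡ 0#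
  vanish {k = k} e h = trans e (trans (cong (k *_) h) (zeroʳ k))

  vanish₂ : ∀ {b k h l g} → b ≡ k * h + l * g → h ≡ 0# → g ≡ 0# → b ≡ 0#
  vanish₂ {k = k} {l = l} e refl refl =
    trans e (trans (cong₂ _+_ (zeroʳ k) (zeroʳ l)) (+-identityˡ 0#))

  vanish₃ : ∀ {b k h l g m f} → b ≡ k * h + l * g + m * f → h ≡ 0# → g ≡ 0# → f ≡ 0# → b ≡ 0#
  vanish₃ {k = k} {l = l} {m = m} e refl refl refl = trans e (trans (cong₂ _+_
    (trans (cong₂ _+_ (zeroʳ k) (zeroʳ l)) (+-identityˡ 0#)) (zeroʳ m)) (+-identityˡ 0#))

  0T : Tri
  0T = 0# , 0# , 0#

  infix 4 _≟T_
  _≟T_ : (s t : Tri) → Dec (s ≡ t)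
  _≟T_ = ≡-dec _≟_ (≡-dec _≟_ _≟_)

  tri-≡ : ∀ {a b c a′ b′ c′ : Carrier} → a ≡ a′ → b ≡ b′ → c ≡ c′ → (a , b , c) ≡ (a′ , b′ , c′)
  tri-≡ refl refl refl = refl

  combination : Tri → Tri → Tri → Tri → Tri
  combination (a , b , c) x y z = a ⊡ x ⊞ b ⊡ y ⊞ c ⊡ z

  Dependent : Tri → Tri → Tri → Set
  Dependent x y z = ∃ λ t → ¬ t ≡ 0T × combination t x y z ≡ 0T

  e₀ e₁ e₂ : Tri
  e₀ = 1# , 0# , 0#
  e₁ = 0# , 1# , 0#
  e₂ = 0# , 0# , 1#

  minor₀ minor₁ minor₂ : Tri → Tri → Carrier
  minor₀ (x₀ , x₁ , x₂) (y₀ , y₁ , y₂) = x₁ * y₂ - x₂ * y₁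
  minor₁ (x₀ , x₁ , x₂) (y₀ , y₁ , y₂) = x₂ * y₀ - x₀ * y₂
  minor₂ (x₀ , x₁ , x₂) (y₀ , y₁ , y₂) = x₀ * y₁ - x₁ * y₀

  -- One row of adj(M) M = det(M) I for the matrix M with rows x, y, z. These coefficients give a
  -- linear dependence when the determinant vanishes and, after scaling, Cramer's rule when it does
  -- not.
  cofactors₀ : ∀ x y z → combination (minor₀ y z , minor₀ z x , minor₀ x y) x y z ≡ det x y z ⊡ e₀
  cofactors₀ (x₀ , x₁ , x₂) (y₀ , y₁ , y₂) (z₀ , z₁ , z₂) = tri-≡
    (solve 9 (λ x₀ x₁ x₂ y₀ y₁ y₂ z₀ z₁ z₂ → (y₁ :* z₂ :- y₂ :* z₁) :* x₀ :+ (z₁ :* x₂ :- z₂ :* x₁) :* y₀ :+ (x₁ :* y₂ :- x₂ :* y₁) :* z₀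
      := :det x₀ x₁ x₂ y₀ y₁ y₂ z₀ z₁ z₂ :* :1) refl x₀ x₁ x₂ y₀ y₁ y₂ z₀ z₁ z₂)
    (solve 9 (λ x₀ x₁ x₂ y₀ y₁ y₂ z₀ z₁ z₂ → (y₁ :* z₂ :- y₂ :* z₁) :* x₁ :+ (z₁ :* x₂ :- z₂ :* x₁) :* y₁ :+ (x₁ :* y₂ :- x₂ :* y₁) :* z₁
      := :det x₀ x₁ x₂ y₀ y₁ y₂ z₀ z₁ z₂ :* :0) refl x₀ x₁ x₂ y₀ y₁ y₂ z₀ z₁ z₂)
    (solve 9 (λ x₀ x₁ x₂ y₀ y₁ y₂ z₀ z₁ z₂ → (y₁ :* z₂ :- y₂ :* z₁) :* x₂ :+ (z₁ :* x₂ :- z₂ :* x₁) :* y₂ :+ (x₁ :* y₂ :- x₂ :* y₁) :* z₂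
      := :det x₀ x₁ x₂ y₀ y₁ y₂ z₀ z₁ z₂ :* :0) refl x₀ x₁ x₂ y₀ y₁ y₂ z₀ z₁ z₂)

  rotate : Tri → Tri
  rotate (a , b , c) = c , a , b

  -- Cyclically permuting the coordinates preserves the determinant and permutes the columns of cofactors.
  private
    det-rotate : ∀ x y z → det (rotate x) (rotate y) (rotate z) ≡ det x y z
    det-rotate (x₀ , x₁ , x₂) (y₀ , y₁ , y₂) (z₀ , z₁ , z₂) =
      solve 9 (λ x₀ x₁ x₂ y₀ y₁ y₂ z₀ z₁ z₂ → :det x₂ x₀ x₁ y₂ y₀ y₁ z₂ z₀ z₁ := :det x₀ x₁ x₂ y₀ y₁ y₂ z₀ z₁ z₂)
        refl x₀ x₁ x₂ y₀ y₁ y₂ z₀ z₁ z₂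

  cofactors₂ : ∀ x y z → combination (minor₂ y z , minor₂ z x , minor₂ x y) x y z ≡ det x y z ⊡ e₂
  cofactors₂ x y z = cong (rotate ∘ rotate) (trans (cofactors₀ (rotate x) (rotate y) (rotate z))
    (cong (_⊡ e₀) (det-rotate x y z)))

  cofactors₁ : ∀ x y z → combination (minor₁ y z , minor₁ z x , minor₁ x y) x y z ≡ det x y z ⊡ e₁
  cofactors₁ x y z = cong (rotate ∘ rotate) (trans (cofactors₂ (rotate x) (rotate y) (rotate z))
    (cong (_⊡ e₂) (det-rotate x y z)))

  0⊡ : ∀ t → 0# ⊡ t ≡ 0T
  0⊡ _ = tri-≡ (zeroˡ _) (zeroˡ _) (zeroˡ _)

  1⊡ : ∀ t → 1# ⊡ t ≡ t
  1⊡ _ = tri-≡ (*-identityˡ _) (*-identityˡ _) (*-identityˡ _)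

  det-rotate-rows : ∀ x y z → det y z x ≡ det x y z
  det-rotate-rows (x₀ , x₁ , x₂) (y₀ , y₁ , y₂) (z₀ , z₁ , z₂) =
    solve 9 (λ x₀ x₁ x₂ y₀ y₁ y₂ z₀ z₁ z₂ → :det y₀ y₁ y₂ z₀ z₁ z₂ x₀ x₁ x₂ := :det x₀ x₁ x₂ y₀ y₁ y₂ z₀ z₁ z₂)
      refl x₀ x₁ x₂ y₀ y₁ y₂ z₀ z₁ z₂

  coordinate≢0 : ∀ {a b c} → ¬ (a , b , c) ≡ 0T → ¬ a ≡ 0# ⊎ ¬ b ≡ 0# ⊎ ¬ c ≡ 0#
  coordinate≢0 {a} {b} {c} t≢0 with a ≟ 0# | b ≟ 0# | c ≟ 0#
  ... | no h | _ | _ = inj₁ h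
  ... | yes _ | no h | _ = inj₂ (inj₁ h)
  ... | yes _ | yes _ | no h = inj₂ (inj₂ h)
  ... | yes refl | yes refl | yes refl = ⊥-elim (t≢0 refl)

  -- If a ≠ 0, expanding along the cofactors of x writes a det(x, y, z) as a combination of the
  -- coordinates of the vanishing vector. A cyclic shift of the rows brings any other nonzero
  -- coefficient to the front.
  dependent⇒det≡0 : ∀ {x y z} → Dependent x y z → det x y z ≡ 0#
  dependent⇒det≡0 {x} {y} {z} ((a , b , c) , t≢0 , h) = [ first x y z a b c h
    , [ (λ b≢0 → trans (sym (det-rotate-rows x y z)) (first y z x b c a (trans (cycle a b c x y z) h) b≢0))
    , (λ c≢0 → trans (det-rotate-rows z x y) (first z x y c a b (trans (sym (cycle c a b z x y)) h) c≢0)) ]′ ]′ (coordinate≢0 t≢0)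
    where
    cycle : ∀ a b c x y z → combination (b , c , a) y z x ≡ combination (a , b , c) x y z
    cycle a b c (x₀ , x₁ , x₂) (y₀ , y₁ , y₂) (z₀ , z₁ , z₂) = tri-≡ (move _ _ _) (move _ _ _) (move _ _ _)
      where
      move : ∀ p q r → q + r + p ≡ p + q + r
      move = solve 3 (λ p q r → q :+ r :+ p := p :+ q :+ r) refl
    first : ∀ x y z a b c → combination (a , b , c) x y z ≡ 0T → ¬ a ≡ 0# → det x y z ≡ 0#
    first (x₀ , x₁ , x₂) (y₀ , y₁ , y₂) (z₀ , z₁ , z₂) a b c h a≢0 = cancel a≢0 (vanish₃
      (solve 12 (λ a b c x₀ x₁ x₂ y₀ y₁ y₂ z₀ z₁ z₂ → a :* :det x₀ x₁ x₂ y₀ y₁ y₂ z₀ z₁ z₂ :=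
        (y₁ :* z₂ :- y₂ :* z₁) :* (a :* x₀ :+ b :* y₀ :+ c :* z₀)
        :+ (y₂ :* z₀ :- y₀ :* z₂) :* (a :* x₁ :+ b :* y₁ :+ c :* z₁)
        :+ (y₀ :* z₁ :- y₁ :* z₀) :* (a :* x₂ :+ b :* y₂ :+ c :* z₂)) refl a b c x₀ x₁ x₂ y₀ y₁ y₂ z₀ z₁ z₂)
      (cong proj₁ h) (cong (proj₁ ∘ proj₂) h) (cong (proj₂ ∘ proj₂) h))

  -- A nonzero row of the adjugate is itself a dependence. If all three rows vanish, then all 2×2
  -- minors of x and y do, so either x = 0 or some x_j ≠ 0 gives the relation y_j x - x_j y = 0.
  det≡0⇒dependent : ∀ {x y z} → det x y z ≡ 0# → Dependent x y z
  det≡0⇒dependent {x@(x₀ , x₁ , x₂)} {y@(y₀ , y₁ , y₂)} {z@(z₀ , z₁ , z₂)} h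
    with (minor₀ y z , minor₀ z x , minor₀ x y) ≟T 0T | (minor₁ y z , minor₁ z x , minor₁ x y) ≟T 0T
       | (minor₂ y z , minor₂ z x , minor₂ x y) ≟T 0T
  ... | no t≢0 | _ | _ = _ , t≢0 , trans (cofactors₀ x y z) (trans (cong (_⊡ e₀) h) (0⊡ e₀))
  ... | yes _ | no t≢0 | _ = _ , t≢0 , trans (cofactors₁ x y z) (trans (cong (_⊡ e₁) h) (0⊡ e₁))
  ... | yes _ | yes _ | no t≢0 = _ , t≢0 , trans (cofactors₂ x y z) (trans (cong (_⊡ e₂) h) (0⊡ e₂))
  ... | yes m₀ | yes m₁ | yes m₂ with x ≟T 0T
  ...   | yes refl = e₀ , (λ e → 0≢1 (sym (cong proj₁ e))) , tri-≡ (collapse y₀ z₀) (collapse y₁ z₁) (collapse y₂ z₂)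
    where
    collapse : ∀ p q → 1# * 0# + 0# * p + 0# * q ≡ 0#
    collapse = solve 2 (λ p q → :1 :* :0 :+ :0 :* p :+ :0 :* q := :0) refl
  ...   | no x≢0 = parallel (coordinate≢0 x≢0)
    where
    x₁y₂ : x₁ * y₂ ≡ x₂ * y₁
    x₁y₂ = equal-of-difference (cong (proj₂ ∘ proj₂) m₀)
    x₂y₀ : x₂ * y₀ ≡ x₀ * y₂
    x₂y₀ = equal-of-difference (cong (proj₂ ∘ proj₂) m₁)
    x₀y₁ : x₀ * y₁ ≡ x₁ * y₀
    x₀y₁ = equal-of-difference (cong (proj₂ ∘ proj₂) m₂)
    entry : ∀ {xⱼ yₖ xₖ yⱼ} z → xⱼ * yₖ ≡ xₖ * yⱼ → yⱼ * xₖ + (- xⱼ) * yₖ + 0# * z ≡ 0#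
    entry {xⱼ} {yₖ} {xₖ} {yⱼ} z e = vanish {k = - 1#} (solve 5 (λ xⱼ yₖ xₖ yⱼ z →
      yⱼ :* xₖ :+ (:- xⱼ) :* yₖ :+ :0 :* z := (:- :1) :* (xⱼ :* yₖ :- xₖ :* yⱼ)) refl xⱼ yₖ xₖ yⱼ z) (difference-zero e)
    negated : ∀ {p q r} → ¬ p ≡ 0# → ¬ (q , - p , r) ≡ 0T
    negated {p} p≢0 e = p≢0 (vanish {k = - 1#} (solve 1 (λ p → p := (:- :1) :* (:- p)) refl p) (cong (proj₁ ∘ proj₂) e))
    parallel : ¬ x₀ ≡ 0# ⊎ ¬ x₁ ≡ 0# ⊎ ¬ x₂ ≡ 0# → Dependent x y z
    parallel (inj₁ p) = (y₀ , - x₀ , 0#) , negated p , tri-≡ (entry z₀ refl) (entry z₁ x₀y₁) (entry z₂ (sym x₂y₀))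
    parallel (inj₂ (inj₁ p)) = (y₁ , - x₁ , 0#) , negated p , tri-≡ (entry z₀ (sym x₀y₁)) (entry z₁ refl) (entry z₂ x₁y₂)
    parallel (inj₂ (inj₂ p)) = (y₂ , - x₂ , 0#) , negated p , tri-≡ (entry z₀ x₂y₀) (entry z₁ (sym x₁y₂)) (entry z₂ refl)

  combination-assoc : ∀ t s₀ s₁ s₂ x y z → combination (combination t s₀ s₁ s₂) x y z
    ≡ combination t (combination s₀ x y z) (combination s₁ x y z) (combination s₂ x y z)
  combination-assoc (a , b , c) (p₀ , p₁ , p₂) (q₀ , q₁ , q₂) (r₀ , r₁ , r₂) (x₀ , x₁ , x₂) (y₀ , y₁ , y₂) (z₀ , z₁ , z₂) =
    tri-≡ (entry x₀ y₀ z₀) (entry x₁ y₁ z₁) (entry x₂ y₂ z₂)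
    where
    entry : ∀ x y z → (a * p₀ + b * q₀ + c * r₀) * x + (a * p₁ + b * q₁ + c * r₁) * y + (a * p₂ + b * q₂ + c * r₂) * z
      ≡ a * (p₀ * x + p₁ * y + p₂ * z) + b * (q₀ * x + q₁ * y + q₂ * z) + c * (r₀ * x + r₁ * y + r₂ * z)
    entry = solve 15 (λ a b c p₀ p₁ p₂ q₀ q₁ q₂ r₀ r₁ r₂ x y z →
      (a :* p₀ :+ b :* q₀ :+ c :* r₀) :* x :+ (a :* p₁ :+ b :* q₁ :+ c :* r₁) :* y :+ (a :* p₂ :+ b :* q₂ :+ c :* r₂) :* z
      := a :* (p₀ :* x :+ p₁ :* y :+ p₂ :* z) :+ b :* (q₀ :* x :+ q₁ :* y :+ q₂ :* z) :+ c :* (r₀ :* x :+ r₁ :* y :+ r₂ :* z))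
      refl a b c p₀ p₁ p₂ q₀ q₁ q₂ r₀ r₁ r₂

  spanning : ∀ {x y z} → ¬ det x y z ≡ 0# → ∀ t → ∃ λ s → combination s x y z ≡ t
  spanning {x} {y} {z} d≢0 t@(t₀ , t₁ , t₂) with inverse (det x y z) d≢0
  ... | i , di = combination (i ⊡ t) C₀ C₁ C₂ , trans (combination-assoc (i ⊡ t) C₀ C₁ C₂ x y z)
      (trans (cong₃ (combination (i ⊡ t)) (cofactors₀ x y z) (cofactors₁ x y z) (cofactors₂ x y z))
             (tri-≡ (finish₀ t₀ t₁ t₂) (finish₁ t₀ t₁ t₂) (finish₂ t₀ t₁ t₂)))
    where
    C₀ C₁ C₂ : Tri
    C₀ = minor₀ y z , minor₀ z x , minor₀ x y
    C₁ = minor₁ y z , minor₁ z x , minor₁ x y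
    C₂ = minor₂ y z , minor₂ z x , minor₂ x y
    d = det x y z
    unit : ∀ {p} → (d * i) * p ≡ p
    unit {p} = trans (cong (_* p) di) (*-identityˡ p)
    finish₀ : ∀ a b c → (i * a) * (d * 1#) + (i * b) * (d * 0#) + (i * c) * (d * 0#) ≡ a
    finish₀ a b c = trans (solve 5 (λ i d a b c → (i :* a) :* (d :* :1) :+ (i :* b) :* (d :* :0) :+ (i :* c) :* (d :* :0) := (d :* i) :* a) refl i d a b c) unit
    finish₁ : ∀ a b c → (i * a) * (d * 0#) + (i * b) * (d * 1#) + (i * c) * (d * 0#) ≡ b
    finish₁ a b c = trans (solve 5 (λ i d a b c → (i :* a) :* (d :* :0) :+ (i :* b) :* (d :* :1) :+ (i :* c) :* (d :* :0) := (d :* i) :* b) refl i d a b c) unit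
    finish₂ : ∀ a b c → (i * a) * (d * 0#) + (i * b) * (d * 0#) + (i * c) * (d * 1#) ≡ c
    finish₂ a b c = trans (solve 5 (λ i d a b c → (i :* a) :* (d :* :0) :+ (i :* b) :* (d :* :0) :+ (i :* c) :* (d :* :1) := (d :* i) :* c) refl i d a b c) unit

  combination-injective : ∀ {x y z} → ¬ Dependent x y z → ∀ {s t} → combination s x y z ≡ combination t x y z → s ≡ t
  combination-injective {x₀ , x₁ , x₂} {y₀ , y₁ , y₂} {z₀ , z₁ , z₂} ind {a , b , c} {a′ , b′ , c′} h
    with (a - a′ , b - b′ , c - c′) ≟T 0T
  ... | yes e = tri-≡ (equal-of-difference (cong proj₁ e)) (equal-of-difference (cong (proj₁ ∘ proj₂) e))
                      (equal-of-difference (cong (proj₂ ∘ proj₂) e))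
  ... | no e = ⊥-elim (ind (_ , e , tri-≡ (entry x₀ y₀ z₀ (cong proj₁ h)) (entry x₁ y₁ z₁ (cong (proj₁ ∘ proj₂) h))
                      (entry x₂ y₂ z₂ (cong (proj₂ ∘ proj₂) h))))
    where
    entry : ∀ x y z → a * x + b * y + c * z ≡ a′ * x + b′ * y + c′ * z → (a - a′) * x + (b - b′) * y + (c - c′) * z ≡ 0#
    entry x y z e = trans (solve 9 (λ a b c a′ b′ c′ x y z → (a :- a′) :* x :+ (b :- b′) :* y :+ (c :- c′) :* z :=
      (a :* x :+ b :* y :+ c :* z) :- (a′ :* x :+ b′ :* y :+ c′ :* z)) refl a b c a′ b′ c′ x y z) (difference-zero e)

  Φ₃-Root : Carrier → Set
  Φ₃-Root x = x * x + x + 1# ≡ 0#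

  CubeRoot : Carrier → Set
  CubeRoot x = x * x * x ≡ 1#

  -1#≢0 : ¬ - 1# ≡ 0#
  -1#≢0 h = 0≢1 (sym (vanish {k = - 1#} (solve 0 (:1 := (:- :1) :* (:- :1)) refl) h))

  -- The Möbius transformation x ↦ -1/(1+x) has order 3, and its fixed points are the roots of x²+x+1.
  private
    Generic : Carrier → Set
    Generic x = ¬ x ≡ 0# × ¬ 1# + x ≡ 0#

    möbius : Carrier → Carrier
    möbius x with 1# + x ≟ 0#
    -- A default at x = -1, a value that `Generic` excludes.
    ... | yes _ = 0#
    ... | no h = - proj₁ (inverse (1# + x) h)

    -- The image y of x is handled through the polynomial relation (1 + x) y + 1 = 0, which
    -- determines y; the later facts then follow from certificates without inverses.
    möbius-spec : ∀ {x} → ¬ 1# + x ≡ 0# → möbius x + x * möbius x + 1# ≡ 0#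
    möbius-spec {x} p with 1# + x ≟ 0#
    ... | yes h = ⊥-elim (p h)
    ... | no h = let i , e = inverse (1# + x) h in
      vanish {k = - 1#} (solve 2 (λ x i → (:- i) :+ x :* (:- i) :+ :1 := (:- :1) :* ((:1 :+ x) :* i :- :1)) refl x i)
        (difference-zero e)

    möbius-unique : ∀ {x y z} → ¬ 1# + x ≡ 0# → y + x * y + 1# ≡ 0# → z + x * z + 1# ≡ 0# → y ≡ z
    möbius-unique {x} {y} {z} p e f = equal-of-difference (cancel p (vanish₂ {k = 1#} {l = - 1#}
      (solve 3 (λ x y z → (:1 :+ x) :* (y :- z) := :1 :* (y :+ x :* y :+ :1) :+ (:- :1) :* (z :+ x :* z :+ :1)) refl x y z) e f))

    möbius-generic : ∀ {x} → Generic x → Generic (möbius x)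
    möbius-generic {x} (x≢0 , p) = y≢0 y e , λ h → x≢0 (vanish₂ {k = x + 1#} {l = - 1#}
        (solve 2 (λ x y → x := (x :+ :1) :* (:1 :+ y) :+ (:- :1) :* (y :+ x :* y :+ :1)) refl x y) h e)
      where
      y = möbius x
      e = möbius-spec p
      y≢0 : ∀ y → y + x * y + 1# ≡ 0# → ¬ y ≡ 0#
      y≢0 y e h = 0≢1 (sym (vanish₂ {k = 1#} {l = - (1# + x)} (solve 2 (λ x y →
        :1 := :1 :* (y :+ x :* y :+ :1) :+ (:- (:1 :+ x)) :* y) refl x y) e h))

    möbius-cube : ∀ {x} → Generic x → möbius (möbius (möbius x)) ≡ x
    -- The relations for x ↦ y and y ↦ z combine to y times the relation for z ↦ x, and y is
    -- cancelled because it is generic.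
    möbius-cube {x} g = möbius-unique (proj₂ gz) (möbius-spec (proj₂ gz)) (cancel (proj₁ gy) (vanish₂ {k = 1# + z} {l = - 1#}
        (solve 3 (λ x y z → y :* (x :+ z :* x :+ :1) := (:1 :+ z) :* (y :+ x :* y :+ :1) :+ (:- :1) :* (z :+ y :* z :+ :1)) refl x y z)
        (möbius-spec (proj₂ g)) (möbius-spec (proj₂ gy))))
      where
      y = möbius x
      z = möbius y
      gy = möbius-generic g
      gz = möbius-generic gy

    fixed⇒root : ∀ {x} → Generic x → möbius x ≡ x → Φ₃-Root x
    fixed⇒root {x} (_ , p) h = trans (cong (_+ 1#) (+-comm _ _)) (subst (λ y → y + x * y + 1# ≡ 0#) h (möbius-spec p))

    root⇒generic : ∀ {x} → Φ₃-Root x → Generic x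
    root⇒generic {x} r =
      (λ h → 0≢1 (sym (vanish₂ {k = 1#} {l = - (x + 1#)} (solve 1 (λ x → :1 := :1 :* (x :* x :+ x :+ :1) :+ (:- (x :+ :1)) :* x) refl x) r h)))
      , λ h → 0≢1 (sym (vanish₂ {k = 1#} {l = - x} (solve 1 (λ x → :1 := :1 :* (x :* x :+ x :+ :1) :+ (:- x) :* (:1 :+ x)) refl x) r h))

    root⇒fixed : ∀ {x} → Φ₃-Root x → möbius x ≡ x
    root⇒fixed {x} r = let p = proj₂ (root⇒generic r) in
      möbius-unique p (möbius-spec p) (trans (cong (_+ 1#) (+-comm _ _)) r)

    count-roots-mod-3 : ∃ λ r → ∃ λ l → HasCount _≡_ Φ₃-Root r × order ≡ 2 ℕ.+ (r ℕ.+ l ℕ.* 3)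
    count-roots-mod-3 =
      let m , cm , e = count-remove _≟_ count-carrier 0# refl
          k , ck , f = count-remove _≟_ cm (- 1#) (refl , -1#≢0)
          c = count-cong {Q = Generic} (λ x ((_ , p) , h) → p , λ z → h (-1-from z)) (λ x (p , h) → (refl , p) , λ z → h (-1-to z)) ck
          r , l , cr , g = count-order-3 _≟_ c möbius möbius-generic möbius-cube
      in r , l , count-cong (λ x (g , h) → fixed⇒root g h) (λ x r → root⇒generic r , root⇒fixed r) cr
        , trans e (cong suc (trans f (cong suc (sym g))))
      where
      -1-from : ∀ {x} → 1# + x ≡ 0# → x ≡ - 1#
      -1-from {x} h = equal-of-difference (trans (solve 1 (λ x → x :- (:- :1) := :1 :+ x) refl x) h)
      -1-to : ∀ {x} → x ≡ - 1# → 1# + x ≡ 0#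
      -1-to refl = -‿inverseʳ 1#

  root⇒cube-root : ∀ {x} → Φ₃-Root x → CubeRoot x
  root⇒cube-root {x} r = equal-of-difference (vanish {k = x - 1#}
    (solve 1 (λ x → x :* x :* x :- :1 := (x :- :1) :* (x :* x :+ x :+ :1)) refl x) r)

  root-square : ∀ {x} → Φ₃-Root x → Φ₃-Root (x * x)
  root-square {x} r = vanish {k = x * x - x + 1#} (solve 1 (λ ν →
    (ν :* ν) :* (ν :* ν) :+ ν :* ν :+ :1 := (ν :* ν :- ν :+ :1) :* (ν :* ν :+ ν :+ :1)) refl x) r

  one-cube-root : CubeRoot 1#
  one-cube-root = solve 0 (:1 :* :1 :* :1 := :1) refl

  cube-root-cases : ∀ {x} → CubeRoot x → x ≡ 1# ⊎ Φ₃-Root x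
  cube-root-cases {x} h = [ (λ e → inj₁ (equal-of-difference e)) , inj₂ ]′ (zero-product (x - 1#)
    (trans (solve 1 (λ x → (x :- :1) :* (x :* x :+ x :+ :1) := x :* x :* x :- :1) refl x) (difference-zero h)))

  private
    no-roots : (∀ x → ¬ Φ₃-Root x) → HasCount _≡_ Φ₃-Root 0 × HasCount _≡_ CubeRoot 1
    no-roots none = ([] , refl , [] , [] , λ x r → ⊥-elim (none x r))
      , (1# ∷ [] , refl , one-cube-root ∷ [] , [] ∷ [] ,
         λ x h → [ here , (λ r → ⊥-elim (none x r)) ]′ (cube-root-cases h))

    -- Here 3 = 0, so x² + x + 1 = (x - 1)² and x³ - 1 = (x - 1)³: everything collapses to x = 1.
    double-root : Φ₃-Root 1# → HasCount _≡_ Φ₃-Root 1 × HasCount _≡_ CubeRoot 1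
    double-root one = (1# ∷ [] , refl , one ∷ [] , [] ∷ [] , λ x r → here (only r))
      , (1# ∷ [] , refl , one-cube-root ∷ [] , [] ∷ [] , λ x h → here ([ id , only ]′ (cube-root-cases h)))
      where
      only : ∀ {x} → Φ₃-Root x → x ≡ 1#
      only {x} r = equal-of-difference ([ id , id ]′ (zero-product (x - 1#) (vanish₂ {k = 1#} {l = - x}
        (solve 1 (λ x → (x :- :1) :* (x :- :1) := :1 :* (x :* x :+ x :+ :1) :+ (:- x) :* (:1 :* :1 :+ :1 :+ :1)) refl x) r one)))

    -- The factorisation is x² + x + 1 = (x - ν)(x - ν²). The two roots differ, since ν = ν² would
    -- give ν = 1, which is excluded.
    distinct-roots : ∀ {ν} → Φ₃-Root ν → ¬ Φ₃-Root 1# → HasCount _≡_ Φ₃-Root 2 × HasCount _≡_ CubeRoot 3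
    distinct-roots {ν} r ¬one =
      (ν ∷ ν * ν ∷ [] , refl , r ∷ r² ∷ [] , (ν≢ν² ∷ []) ∷ [] ∷ [] , λ x h → [ here , (λ z → there (here z)) ]′ (only h))
      , (1# ∷ ν ∷ ν * ν ∷ [] , refl , one-cube-root ∷ root⇒cube-root r ∷ root⇒cube-root r² ∷ []
        , ((λ h → ¬one (subst Φ₃-Root (sym h) r)) ∷ (λ h → ¬one (subst Φ₃-Root (sym h) r²)) ∷ []) ∷ (ν≢ν² ∷ []) ∷ [] ∷ []
        , λ x h → [ here , (λ r → there ([ here , (λ z → there (here z)) ]′ (only r))) ]′ (cube-root-cases h))
      where
      r² : Φ₃-Root (ν * ν)
      r² = root-square r
      ν≢ν² : ¬ ν ≡ ν * ν
      ν≢ν² h = ¬one (subst Φ₃-Root (sym (cancel-≡ (proj₁ (root⇒generic r))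
        (trans (solve 1 (λ ν → ν :* :1 := ν) refl ν) h))) r)
      only : ∀ {x} → Φ₃-Root x → x ≡ ν ⊎ x ≡ ν * ν
      only {x} s = [ (λ e → inj₁ (equal-of-difference e)) , (λ e → inj₂ (equal-of-difference e)) ]′ (zero-product (x - ν)
        (vanish₂ {k = 1#} {l = ν - 1# - x} (solve 2 (λ x ν → (x :- ν) :* (x :- ν :* ν) :=
          :1 :* (x :* x :+ x :+ :1) :+ (ν :- :1 :- x) :* (ν :* ν :+ ν :+ :1)) refl x ν) s r))

  -- The root count r = n + 1 will be the number of fixed points on each fixed-II-line, and the cube
  -- roots index both the fixed points and the lines. The bound r ≤ 2 makes the subtraction from q +
  -- 1 exact and leaves a moved point on each line.
  CubeRootCounts : Set
  CubeRootCounts = ∃ λ r → HasCount _≡_ Φ₃-Root r × HasCount _≡_ CubeRoot (gq order)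
    × ℤ.+ r ≡ nq order ℤ.+ ℤ.+ 1 × r ℕ.≤ 2

  private
    residue : ∀ {r s l} → HasCount _≡_ Φ₃-Root r → order ≡ 2 ℕ.+ (r ℕ.+ l ℕ.* 3) → HasCount _≡_ Φ₃-Root s →
      order ≡ 2 ℕ.+ (s ℕ.+ l ℕ.* 3)
    residue {l = l} c e c′ = trans e (cong (λ r → 2 ℕ.+ (r ℕ.+ l ℕ.* 3)) (count-unique ≡-equivOn c c′))

    package : ∀ {r g n} → HasCount _≡_ Φ₃-Root r × HasCount _≡_ CubeRoot g → nq order ≡ n × gq order ≡ g →
      ℤ.+ r ≡ n ℤ.+ ℤ.+ 1 → r ℕ.≤ 2 → CubeRootCounts
    package (c , c′) (n , g) e b = _ , c , subst (HasCount _≡_ CubeRoot) (sym g) c′ , trans e (cong (ℤ._+ ℤ.+ 1) (sym n)) , b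

    -- The element 1 is a root exactly when 3 = 0, so the two decisions give r = 0, 2 or 1. Once r
    -- is known, q = 2 + r + 3l reveals the residue of q.
    classify : ∀ {r l} → HasCount _≡_ Φ₃-Root r → order ≡ 2 ℕ.+ (r ℕ.+ l ℕ.* 3) → Dec (∃ Φ₃-Root) →
      Dec (Φ₃-Root 1#) → CubeRootCounts
    classify {l = l} c e (no none) _ = let counts = no-roots (λ x p → none (x , p)) in
      package counts (residue₂ l (residue {l = l} c e (proj₁ counts))) refl ℕ.z≤n
    classify {l = l} c e (yes (ν , p)) (no ¬one) = let counts = distinct-roots p ¬one in
      package counts (residue₁ l (residue {l = l} c e (proj₁ counts))) refl (ℕ.s≤s (ℕ.s≤s ℕ.z≤n))
    classify {l = l} c e (yes _) (yes one) = let counts = double-root one in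
      package counts (residue₀ l (residue {l = l} c e (proj₁ counts))) refl (ℕ.s≤s ℕ.z≤n)

  abstract
    cube-root-counts : CubeRootCounts
    cube-root-counts = let r , l , c , e = count-roots-mod-3 in
      classify {l = l} c e (exists? (λ x → x * x + x + 1# ≟ 0#)) (1# * 1# + 1# + 1# ≟ 0#)

private
  square : ∀ p → suc p ℕ.* suc p ≡ suc (suc (suc p) ℕ.* p)
  square = solve 1 (λ p → (con 1 :+ p) :* (con 1 :+ p) := con 1 :+ (con 1 :+ (con 1 :+ p)) :* p) refl
    where open +-*-Solver

  -- With p = q - 1, the factor p² + 3p + 3 is q² + q + 1, the number of points of a plane; writing
  -- it in p avoids truncated subtraction.
  cubic : ∀ p → suc p ℕ.* (suc p ℕ.* suc p) ≡ suc ((p ℕ.* p ℕ.+ 3 ℕ.* p ℕ.+ 3) ℕ.* p)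
  cubic = solve 1 (λ p → (con 1 :+ p) :* ((con 1 :+ p) :* (con 1 :+ p)) :=
    con 1 :+ (p :* p :+ con 3 :* p :+ con 3) :* p) refl
    where open +-*-Solver

-- The plane PG(2,q) with the rotation of coordinates and the circulant cubic.

module Circulants (K : FiniteField) where
  open FieldTheory K

  infix 4 _~_
  _~_ : Tri → Tri → Set
  s ~ t = ∃ λ c → ¬ c ≡ 0# × t ≡ c ⊡ s

  ⊡-assoc : ∀ a b t → a ⊡ b ⊡ t ≡ (a * b) ⊡ t
  ⊡-assoc a b t = tri-≡ (sym (*-assoc _ _ _)) (sym (*-assoc _ _ _)) (sym (*-assoc _ _ _))

  ~-refl : ∀ {t} → t ~ t
  ~-refl = 1# , 0≢1 ∘ sym , sym (1⊡ _)

  ~-sym : ∀ {s t} → s ~ t → t ~ s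
  ~-sym {s} (c , c≢0 , refl) = let i , e = inverse c c≢0 ; e′ = trans (*-comm i c) e in
    i , unit-nonzero e′ , sym (trans (⊡-assoc i c s) (trans (cong (_⊡ s) e′) (1⊡ s)))

  ~-trans : ∀ {s t u} → s ~ t → t ~ u → s ~ u
  ~-trans {s} (c , c≢0 , refl) (d , d≢0 , refl) = d * c , *-nonzero d≢0 c≢0 , ⊡-assoc d c s

  ~-equivOn : {P : Tri → Set} → EquivOn P _~_
  ~-equivOn = record { reflexive = λ _ → ~-refl ; symmetric = λ _ _ → ~-sym ; transitive = λ _ _ _ → ~-trans }

  infix 4 _~?_
  _~?_ : ∀ s t → Dec (s ~ t)
  s ~? t = exists? λ c → ¬? (c ≟ 0#) ×-dec (t ≟T c ⊡ s)

  NonZeroT : Tri → Set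
  NonZeroT t = ¬ t ≡ 0T

  Closed : (Tri → Set) → Set
  Closed P = ∀ {s t} → s ~ t → P s → P t

  ⊡-nonzero : ∀ {c t} → ¬ c ≡ 0# → NonZeroT t → NonZeroT (c ⊡ t)
  ⊡-nonzero c≢0 t≢0 h = t≢0 (tri-≡ (cancel c≢0 (cong proj₁ h)) (cancel c≢0 (cong (proj₁ ∘ proj₂) h)) (cancel c≢0 (cong (proj₂ ∘ proj₂) h)))

  nonzero-closed : Closed NonZeroT
  nonzero-closed (c , c≢0 , refl) = ⊡-nonzero c≢0

  ⊡-cancelʳ : ∀ {c d t} → NonZeroT t → c ⊡ t ≡ d ⊡ t → c ≡ d
  ⊡-cancelʳ {c} {d} {x , y , z} t≢0 h =
    [ (λ p → by p (cong proj₁ h)) , [ (λ p → by p (cong (proj₁ ∘ proj₂) h)) , (λ p → by p (cong (proj₂ ∘ proj₂) h)) ]′ ]′ (coordinate≢0 t≢0)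
    where
    by : ∀ {x} → ¬ x ≡ 0# → c * x ≡ d * x → c ≡ d
    by p e = cancel-≡ p (trans (*-comm _ _) (trans e (*-comm _ _)))

  abstract
    units : ∃ λ p → HasCount _≡_ (λ x → ¬ x ≡ 0#) p × order ≡ suc p
    units = let p , c , e = count-remove _≟_ count-carrier 0# refl in
      p , count-cong (λ _ → proj₂) (λ _ h → refl , h) c , e

  p : ℕ
  p = proj₁ units

  count-units : HasCount _≡_ (λ x → ¬ x ≡ 0#) p
  count-units = proj₁ (proj₂ units)

  order≡1+p : order ≡ suc p
  order≡1+p = proj₂ (proj₂ units)

  -- Scaling acts freely on nonzero vectors, so every class has exactly p = q - 1 members. The
  -- result is kept as a product, from which p is cancelled when a number of points is needed.
  count-up-to-scaling : ∀ {P m} → Closed P → (∀ {t} → P t → NonZeroT t) → HasCount _≡_ P m →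
    ∃ λ k → HasCount _~_ P k × k ℕ.* p ≡ m
  count-up-to-scaling {P} closed nonzero c =
    let k , ck = count-quotient ~-equivOn _~?_ (λ { _ _ refl → ~-refl }) c
    in k , ck , count-unique ≡-equivOn (count-fibres ck (λ x t → t ~ x) (λ x h → x , h , ~-refl)
         (λ _ _ _ g s → ~-trans (~-sym s) g) (λ { _ _ _ _ refl g g′ → ~-trans g (~-sym g′) }) orbit) c
    where
    orbit : ∀ t → P t → HasCount _≡_ (λ x → P x × t ~ x) p
    orbit t h = count-transfer (λ c _ → c ⊡ t) (λ c c≢0 → closed (c , c≢0 , refl) h , c , c≢0 , refl)
      (λ _ _ _ _ → ⊡-cancelʳ (nonzero h)) (λ { _ (_ , c , c≢0 , refl) → c , c≢0 , λ { _ _ refl → refl } }) count-units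

  count-nonzero : ∃ λ m → HasCount _≡_ NonZeroT m × order ℕ.* (order ℕ.* order) ≡ suc m
  count-nonzero = let m , c , e = count-remove _≟T_ (count-pairs count-carrier (count-pairs count-carrier count-carrier)) 0T (refl , refl , refl)
    in m , count-cong (λ _ → proj₂) (λ _ h → (refl , refl , refl) , h) c , e

  circulant : Tri → Carrier
  circulant t = det t (rotate t) (rotate (rotate t))

  Fixed : Tri → Set
  Fixed t = t ~ rotate t

  -- For l³ = 1 this linear form is multiplied by l when its argument is rotated, so its kernel is
  -- an invariant line.
  OnLine : Carrier → Tri → Set
  OnLine l (a , b , c) = a + l * b + l * l * c ≡ 0#

  :circulant : ∀ {n} → (a b c : Polynomial n) → Polynomial n
  :circulant a b c = :det a b c c a b b c a

  fixed-closed : Closed Fixed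
  fixed-closed {t} (c , c≢0 , refl) (d , d≢0 , e) = d , d≢0 , (begin
    c ⊡ rotate t    ≡⟨ cong (c ⊡_) e ⟩
    c ⊡ d ⊡ t       ≡⟨ ⊡-assoc c d t ⟩
    (c * d) ⊡ t     ≡⟨ cong (_⊡ t) (*-comm c d) ⟩
    (d * c) ⊡ t     ≡⟨ sym (⊡-assoc d c t) ⟩
    d ⊡ c ⊡ t       ∎)
    where open ≡-Reasoning

  line-closed : ∀ {l} → Closed (OnLine l)
  line-closed {l} {x , y , z} (c , c≢0 , refl) h = vanish {k = c} (solve 5 (λ l c x y z →
    c :* x :+ l :* (c :* y) :+ l :* l :* (c :* z) := c :* (x :+ l :* y :+ l :* l :* z)) refl l c x y z) h

  Singular : Tri → Set
  Singular t = circulant t ≡ 0#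

  singular-closed : Closed Singular
  singular-closed {x , y , z} (c , c≢0 , refl) h = vanish {k = c * c * c} (solve 4 (λ c x y z →
    :circulant (c :* x) (c :* y) (c :* z) := (c :* c :* c) :* :circulant x y z) refl c x y z) h

  eigenvector : Carrier → Tri
  eigenvector l = l * l , l , 1#

  eigenvector-nonzero : ∀ l → NonZeroT (eigenvector l)
  eigenvector-nonzero l h = 0≢1 (sym (cong (proj₂ ∘ proj₂) h))

  cube-root-nonzero : ∀ {l} → CubeRoot l → ¬ l ≡ 0#
  cube-root-nonzero h = unit-nonzero (trans (sym (*-assoc _ _ _)) h)

  eigenvector-fixed : ∀ {l} → CubeRoot l → Fixed (eigenvector l)
  eigenvector-fixed {l} h = l , cube-root-nonzero h ,
    tri-≡ (sym (trans (sym (*-assoc _ _ _)) h)) refl (sym (trans (*-comm _ _) (*-identityˡ l)))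

  -- From rotate t = l t come b = l c, a = l b and c = l a. All coordinates are thus multiples of c,
  -- which must be nonzero, and going once round gives l³ = 1.
  fixed⇒eigenvector : ∀ {t} → NonZeroT t → Fixed t → ∃ λ l → CubeRoot l × t ~ eigenvector l
  fixed⇒eigenvector {a , b , c} t≢0 (l , l≢0 , e) = l , cube , ~-sym (c , c≢0 , tri-≡ a-eq b-eq (sym (trans (*-comm _ _) (*-identityˡ c))))
    where
    ca : c ≡ l * a
    ca = cong proj₁ e
    ab : a ≡ l * b
    ab = cong (proj₁ ∘ proj₂) e
    bc : b ≡ l * c
    bc = cong (proj₂ ∘ proj₂) e
    b-eq : b ≡ c * l
    b-eq = trans bc (*-comm l c)
    a-eq : a ≡ c * (l * l)
    a-eq = trans ab (trans (cong (l *_) bc) (solve 2 (λ l c → l :* (l :* c) := c :* (l :* l)) refl l c))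
    c≢0 : ¬ c ≡ 0#
    c≢0 refl = t≢0 (tri-≡ (trans a-eq (zeroˡ _)) (trans b-eq (zeroˡ _)) refl)
    cube : CubeRoot l
    cube = cancel-≡ c≢0 (trans (solve 2 (λ l c → c :* (l :* l :* l) := l :* (c :* (l :* l))) refl l c)
      (trans (cong (l *_) (sym a-eq)) (trans (sym ca) (sym (trans (*-comm _ _) (*-identityˡ c))))))

  eigenvector-injective : ∀ {l m} → eigenvector l ~ eigenvector m → l ≡ m
  eigenvector-injective {l} (c , _ , e) = sym (trans (cong (proj₁ ∘ proj₂) e)
    (trans (cong (_* l) (sym (trans (cong (proj₂ ∘ proj₂) e) (trans (*-comm _ _) (*-identityˡ c))))) (*-identityˡ l)))

  count-fixed : HasCount _~_ (λ t → NonZeroT t × Fixed t) (gq order)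
  count-fixed = count-transfer (λ l _ → eigenvector l) (λ l h → eigenvector-nonzero l , eigenvector-fixed h)
    (λ _ _ _ _ → eigenvector-injective)
    (λ t (t≢0 , f) → let l , h , s = fixed⇒eigenvector t≢0 f in l , h , λ { _ _ refl → s })
    (proj₁ (proj₂ (proj₂ cube-root-counts)))

  fixed⇒singular : ∀ {t} → NonZeroT t → Fixed t → Singular t
  fixed⇒singular t≢0 f = let l , h , s = fixed⇒eigenvector t≢0 f in singular-closed (~-sym s)
    (vanish {k = l * l * l - 1#} (solve 1 (λ l → :circulant (l :* l) l :1 := (l :* l :* l :- :1) :* (l :* l :* l :- :1)) refl l) (difference-zero h))

  -- Substitute l b and l² c for b and c in the factorisation of a³ + b³ + c³ - 3abc by a + b + c.
  -- The substitution changes the cubic only by a multiple of l³ - 1, which is the second term of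
  -- the certificate.
  line⇒singular : ∀ {l t} → CubeRoot l → OnLine l t → Singular t
  line⇒singular {l} {a , b , c} h e = vanish₂
    {k = a * a + l * b * (l * b) + l * l * c * (l * l * c) - a * (l * b) - a * (l * l * c) - l * b * (l * l * c)}
    {l = (1# + 1# + 1#) * (a * b * c) - b * b * b - (1# + l * l * l) * (c * c * c)}
    (solve 4 (λ l a b c → :circulant a b c :=
      (a :* a :+ l :* b :* (l :* b) :+ l :* l :* c :* (l :* l :* c) :- a :* (l :* b) :- a :* (l :* l :* c) :- l :* b :* (l :* l :* c))
        :* (a :+ l :* b :+ l :* l :* c)
      :+ ((:1 :+ :1 :+ :1) :* (a :* b :* c) :- b :* b :* b :- (:1 :+ l :* l :* l) :* (c :* c :* c)) :* (l :* l :* l :- :1)) refl l a b c)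
    e (difference-zero h)

  -- If a + b + c ≠ 0, the other factor of the cubic vanishes; with x = a - b and y = b - c it
  -- equals x² + xy + y². For y = 0 this forces a = b = c, a fixed point. For y ≠ 0 the ratio ν = x
  -- / y is a root of ν² + ν + 1.
  singular⇒line : ∀ {t} → Singular t → ¬ Fixed t → ∃ λ l → CubeRoot l × OnLine l t
  singular⇒line {a , b , c} s ¬f = [ (λ e → 1# , one-cube-root , trans (solve 3 (λ a b c →
      a :+ :1 :* b :+ :1 :* :1 :* c := a :+ b :+ c) refl a b c) e) , quadratic ]′ (zero-product (a + b + c)
      (trans (solve 3 (λ a b c → (a :+ b :+ c) :* (a :* a :+ b :* b :+ c :* c :- a :* b :- b :* c :- c :* a)
        := :circulant a b c) refl a b c) s))
    where
    quadratic : a * a + b * b + c * c - a * b - b * c - c * a ≡ 0# → ∃ λ l → CubeRoot l × OnLine l (a , b , c)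
    quadratic q with b - c ≟ 0#
    ... | yes bc with equal-of-difference bc
    ...   | refl with equal-of-difference ([ id , id ]′ (zero-product (a - b) (trans (solve 2 (λ a b →
            (a :- b) :* (a :- b) := a :* a :+ b :* b :+ b :* b :- a :* b :- b :* b :- b :* a) refl a b) q)))
    ...     | refl = ⊥-elim (¬f ~-refl)
    -- The relation x = ν y reads a - (1 + ν) b + ν c = 0. As -(1 + ν) = ν² and ν = ν⁴, this is the
    -- line with parameter ν².
    quadratic q | no y≢0 = ν * ν , root⇒cube-root (root-square r) , vanish₂ {k = 1#} {l = b + c * ν * (ν - 1#)}
        (solve 4 (λ a b c ν → a :+ ν :* ν :* b :+ ν :* ν :* (ν :* ν) :* c :=
          :1 :* ((a :- b) :- ν :* (b :- c)) :+ (b :+ c :* ν :* (ν :- :1)) :* (ν :* ν :+ ν :+ :1)) refl a b c ν) x-νy r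
      where
      i = proj₁ (inverse (b - c) y≢0)
      ν = (a - b) * i
      x-νy : (a - b) - ν * (b - c) ≡ 0#
      x-νy = vanish {k = - (a - b)} (solve 3 (λ x y i → x :- x :* i :* y := (:- x) :* (y :* i :- :1)) refl (a - b) (b - c) i)
        (difference-zero (proj₂ (inverse (b - c) y≢0)))
      r : Φ₃-Root ν
      r = cancel (*-nonzero y≢0 y≢0) (vanish₂ {k = 1#} {l = - ((a - b) + ν * (b - c) + (b - c))}
        (solve 4 (λ a b c ν → (b :- c) :* (b :- c) :* (ν :* ν :+ ν :+ :1) :=
          :1 :* (a :* a :+ b :* b :+ c :* c :- a :* b :- b :* c :- c :* a)
          :+ (:- ((a :- b) :+ ν :* (b :- c) :+ (b :- c))) :* ((a :- b) :- ν :* (b :- c))) refl a b c ν) q x-νy)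

  -- Subtracting the two equations and cancelling l - m gives b = κ c with κ = -(l + m), the third
  -- cube root of unity. From l³ = m³ one gets l² + lm + m² = 0, which yields a = κ b and c = κ a.
  lines-meet-in-fixed : ∀ {l m t} → CubeRoot l → CubeRoot m → ¬ l ≡ m → OnLine l t → OnLine m t → Fixed t
  lines-meet-in-fixed {l} {m} {a , b , c} hl hm l≢m el em =
    κ , cube-root-nonzero cube , tri-≡ (equal-of-difference ca) (equal-of-difference ab) (equal-of-difference bc)
    where
    κ = - (l + m)
    D≢0 : ¬ l - m ≡ 0#
    D≢0 h = l≢m (equal-of-difference h)
    S : l * l + l * m + m * m ≡ 0#
    S = cancel D≢0 (vanish₂ {k = 1#} {l = - 1#} (solve 2 (λ l m → (l :- m) :* (l :* l :+ l :* m :+ m :* m) :=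
      :1 :* (l :* l :* l :- :1) :+ (:- :1) :* (m :* m :* m :- :1)) refl l m) (difference-zero hl) (difference-zero hm))
    cube : CubeRoot κ
    cube = equal-of-difference (vanish₂ {k = - (l + m + m)} {l = 1#} (solve 2 (λ l m → let κ = :- (l :+ m) in κ :* κ :* κ :- :1 :=
      (:- (l :+ m :+ m)) :* (l :* l :+ l :* m :+ m :* m) :+ :1 :* (m :* m :* m :- :1)) refl l m) S (difference-zero hm))
    bc : b - κ * c ≡ 0#
    bc = cancel D≢0 (vanish₂ {k = 1#} {l = - 1#} (solve 5 (λ l m a b c → (l :- m) :* (b :- (:- (l :+ m)) :* c) :=
      :1 :* (a :+ l :* b :+ l :* l :* c) :+ (:- :1) :* (a :+ m :* b :+ m :* m :* c)) refl l m a b c) el em)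
    ab : a - κ * b ≡ 0#
    ab = vanish₃ {k = 1#} {l = m} {m = - c} (solve 5 (λ l m a b c → a :- (:- (l :+ m)) :* b :=
      :1 :* (a :+ l :* b :+ l :* l :* c) :+ m :* (b :- (:- (l :+ m)) :* c) :+ (:- c) :* (l :* l :+ l :* m :+ m :* m)) refl l m a b c) el bc S
    ca : c - κ * a ≡ 0#
    ca = vanish₃ {k = - κ} {l = - (κ * κ)} {m = - c} (solve 4 (λ κ a b c → c :- κ :* a :=
      (:- κ) :* (a :- κ :* b) :+ (:- (κ :* κ)) :* (b :- κ :* c) :+ (:- c) :* (κ :* κ :* κ :- :1)) refl κ a b c) ab bc (difference-zero cube)

  p≢0 : ¬ p ≡ 0
  p≢0 h = empty (subst (HasCount _≡_ _) h count-units)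
    where
    empty : ¬ HasCount _≡_ (λ x → ¬ x ≡ 0#) 0
    empty ([] , _ , _ , _ , cover) with cover 1# (0≢1 ∘ sym)
    ... | ()

  *p-cancel : ∀ {m n} → m ℕ.* p ≡ n ℕ.* p → m ≡ n
  *p-cancel {m} {n} = ℕₚ.*-cancelʳ-≡ m n p ⦃ ℕ.≢-nonZero p≢0 ⦄

  linePoint : Carrier → Carrier → Carrier → Tri
  linePoint l b c = - (l * b + l * l * c) , b , c

  linePoint-on : ∀ l b c → OnLine l (linePoint l b c)
  linePoint-on = solve 3 (λ l b c → (:- (l :* b :+ l :* l :* c)) :+ l :* b :+ l :* l :* c := :0) refl

  line⇒linePoint : ∀ {l a b c} → OnLine l (a , b , c) → (a , b , c) ≡ linePoint l b c
  line⇒linePoint {l} {a} {b} {c} o = tri-≡ (equal-of-difference (trans (solve 4 (λ l a b c →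
    a :- (:- (l :* b :+ l :* l :* c)) := a :+ l :* b :+ l :* l :* c) refl l a b c) o)) refl refl

  count-line : ∀ l → HasCount _~_ (λ t → NonZeroT t × OnLine l t) (suc order)
  count-line l =
    let m , cm , e = count-remove (≡-dec _≟_ _≟_) (count-pairs count-carrier count-carrier) (0# , 0#) (refl , refl)
        k , ck , f = count-up-to-scaling (λ s (nz , o) → nonzero-closed s nz , line-closed s o) proj₁
          (count-transfer point point-on (λ { (b , c) _ (b′ , c′) _ h → cong₂ _,_ (cong (proj₁ ∘ proj₂) h) (cong (proj₂ ∘ proj₂) h) }) onto cm)
    in subst (HasCount _~_ _) (*p-cancel (trans f (ℕₚ.suc-injective (trans (sym e) (trans (cong₂ ℕ._*_ order≡1+p order≡1+p)
         (trans (square p) (cong (λ q → suc (suc q ℕ.* p)) (sym order≡1+p)))))))) ck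
    where
    Pair : Carrier × Carrier → Set
    Pair x = (proj₁ x ≡ proj₁ x × proj₂ x ≡ proj₂ x) × ¬ x ≡ (0# , 0#)
    point : ∀ x → Pair x → Tri
    point (b , c) _ = linePoint l b c
    point-on : ∀ x h → NonZeroT (point x h) × OnLine l (point x h)
    point-on (b , c) h = (λ e → proj₂ h (cong₂ _,_ (cong (proj₁ ∘ proj₂) e) (cong (proj₂ ∘ proj₂) e))) , linePoint-on l b c
    onto : ∀ t → NonZeroT t × OnLine l t → ∃ λ x → Pair x × (∀ y h → x ≡ y → t ≡ point y h)
    onto (a , b , c) (nz , o) = (b , c) , ((refl , refl) , λ { refl → nz (trans (line⇒linePoint o) (tri-≡ neg-zero refl refl)) })
      , λ { _ _ refl → line⇒linePoint o }
      where
      neg-zero : - (l * 0# + l * l * 0#) ≡ 0#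
      neg-zero = solve 1 (λ l → :- (l :* :0 :+ l :* l :* :0) := :0) refl l

  -- At `eigenvector (l * ν)` the line equation becomes l² (ν² + ν + 1) = 0. Conversely a cube root
  -- m is l ν for ν = m l², because l² is the inverse of l.
  count-fixed-on-line : ∀ {l} → CubeRoot l → HasCount _~_ (λ t → (NonZeroT t × OnLine l t) × Fixed t) (proj₁ cube-root-counts)
  count-fixed-on-line {l} hl = count-transfer (λ ν _ → eigenvector (l * ν))
    (λ ν r → (eigenvector-nonzero (l * ν) , on r) , eigenvector-fixed (cube r))
    (λ _ _ _ _ s → cancel-≡ (cube-root-nonzero hl) (eigenvector-injective s))
    onto (proj₁ (proj₂ cube-root-counts))
    where
    on : ∀ {ν} → Φ₃-Root ν → OnLine l (eigenvector (l * ν))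
    on {ν} r = vanish {k = l * l} (solve 2 (λ l ν → l :* ν :* (l :* ν) :+ l :* (l :* ν) :+ l :* l :* :1 :=
      l :* l :* (ν :* ν :+ ν :+ :1)) refl l ν) r
    cube : ∀ {ν} → Φ₃-Root ν → CubeRoot (l * ν)
    cube {ν} r = trans (solve 2 (λ l ν → l :* ν :* (l :* ν) :* (l :* ν) := (l :* l :* l) :* (ν :* ν :* ν)) refl l ν)
      (trans (cong₂ _*_ hl (root⇒cube-root r)) (*-identityˡ 1#))
    onto : ∀ t → (NonZeroT t × OnLine l t) × Fixed t →
      ∃ λ ν → Φ₃-Root ν × (∀ ν′ → Φ₃-Root ν′ → ν ≡ ν′ → t ~ eigenvector (l * ν′))
    onto t ((nz , o) , f) with fixed⇒eigenvector nz f
    ... | m , hm , s = m * (l * l) , r , λ { _ _ refl → subst (λ z → t ~ eigenvector z) (sym lν) s }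
      where
      lν : l * (m * (l * l)) ≡ m
      lν = trans (solve 2 (λ l m → l :* (m :* (l :* l)) := l :* l :* l :* m) refl l m) (trans (cong (_* m) hl) (*-identityˡ m))
      r : Φ₃-Root (m * (l * l))
      r = vanish₂ {k = l} {l = - 1# + m * m * l} (solve 2 (λ l m → m :* (l :* l) :* (m :* (l :* l)) :+ m :* (l :* l) :+ :1 :=
          l :* (m :* m :+ l :* m :+ l :* l :* :1) :+ (:- :1 :+ m :* m :* l) :* (l :* l :* l :- :1)) refl l m)
        (line-closed s o) (difference-zero hl)

  moved-per-line : ℕ
  moved-per-line = suc order ℕ.∸ proj₁ cube-root-counts

  fixed? : ∀ t → Dec (Fixed t)
  fixed? t = t ~? rotate t

  count-moved-on-line : ∀ {l} → CubeRoot l → HasCount _~_ (λ t → (NonZeroT t × OnLine l t) × ¬ Fixed t) moved-per-line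
  count-moved-on-line {l} hl =
    let r = proj₁ cube-root-counts
        k , n , ck , cn , e = count-split ~-equivOn fixed? (λ _ _ → fixed-closed) (count-line l)
    in subst (HasCount _~_ _) (trans (sym (ℕₚ.m+n∸m≡n k n)) (cong₂ ℕ._∸_ e (count-unique ~-equivOn ck (count-fixed-on-line hl)))) cn

  SingularMoved : Tri → Set
  SingularMoved t = NonZeroT t × Singular t × ¬ Fixed t

  count-singular-moved : HasCount _~_ SingularMoved (gq order ℕ.* moved-per-line)
  count-singular-moved = count-fibres (proj₁ (proj₂ (proj₂ cube-root-counts))) (λ t l → OnLine l t)
    (λ t (_ , s , f) → singular⇒line s f) (λ { _ _ _ o refl → o }) same
    λ l h → count-cong (λ t ((nz , o) , f) → (nz , line⇒singular h o , f) , o) (λ t ((nz , _ , f) , o) → (nz , o) , f) (count-moved-on-line h)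
    where
    same : ∀ {s t l m} → SingularMoved s → SingularMoved t → CubeRoot l → CubeRoot m → s ~ t → OnLine l s → OnLine m t → l ≡ m
    same {l = l} {m} (_ , _ , f) _ hl hm s ol om with l ≟ m
    ... | yes h = h
    ... | no h = ⊥-elim (f (lines-meet-in-fixed hl hm h ol (line-closed (~-sym s) om)))

  Regular : Tri → Set
  Regular t = NonZeroT t × ¬ Singular t

  abstract
    -- Two counts of the same set: k points enter the contents of a plane, and m vectors are what
    -- III-vectors are grouped by when planes are counted. The last equation partitions the plane
    -- into regular, fixed and moved singular points.
    count-regular : ∃ λ k → ∃ λ m → HasCount _~_ Regular k × HasCount _≡_ Regular m × k ℕ.* p ≡ m
      × k ℕ.+ (gq order ℕ.+ gq order ℕ.* moved-per-line) ≡ p ℕ.* p ℕ.+ 3 ℕ.* p ℕ.+ 3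
    count-regular =
      let n , cn , e = count-nonzero
          j , cj , f = count-up-to-scaling nonzero-closed id cn
          _ , k , cs , ck , f₁ = count-split ~-equivOn (λ t → circulant t ≟ 0#) (λ _ _ → singular-closed) cj
          _ , m , _ , cm , _ = count-split ≡-equivOn (λ t → circulant t ≟ 0#) (λ { _ _ refl h → h }) cn
          i , ci , f₂ = count-up-to-scaling (λ s (nz , h) → nonzero-closed s nz , h ∘ singular-closed (~-sym s)) proj₁ cm
          a , b , ca , cb , f₃ = count-split ~-equivOn fixed? (λ _ _ → fixed-closed) cs
          a≡ = count-unique ~-equivOn ca (count-cong (λ t (nz , h) → (nz , fixed⇒singular nz h) , h) (λ t ((nz , _) , h) → nz , h) count-fixed)
          b≡ = count-unique ~-equivOn cb (count-cong (λ t (nz , s , h) → (nz , s) , h) (λ t ((nz , s) , h) → nz , s , h) count-singular-moved)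
      in k , m , ck , cm , trans (cong (ℕ._* p) (count-unique ~-equivOn ck ci)) f₂
        , trans (ℕₚ.+-comm k _) (trans (cong (ℕ._+ k) (trans (cong₂ ℕ._+_ (sym a≡) (sym b≡)) f₃)) (trans f₁
           (*p-cancel (trans f (ℕₚ.suc-injective (trans (sym e) (trans (cong (λ q → q ℕ.* (q ℕ.* q)) order≡1+p) (cubic p))))))))

  rotate-~ : ∀ {s t} → s ~ t → rotate s ~ rotate t
  rotate-~ (c , c≢0 , refl) = c , c≢0 , refl

  line-extensional : ∀ {l a b c a′ b′ c′} → OnLine l (a , b , c) → OnLine l (a′ , b′ , c′) → b ≡ b′ → c ≡ c′ →
    (a , b , c) ≡ (a′ , b′ , c′)
  line-extensional o o′ refl refl = trans (line⇒linePoint o) (sym (line⇒linePoint o′))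

  line-rotate : ∀ {l t} → CubeRoot l → OnLine l t → OnLine l (rotate t)
  line-rotate {l} {a , b , c} h o = vanish₂ {k = l} {l = - c} (solve 4 (λ l a b c → c :+ l :* a :+ l :* l :* b :=
    l :* (a :+ l :* b :+ l :* l :* c) :+ (:- c) :* (l :* l :* l :- :1)) refl l a b c) o (difference-zero h)

  line-combination : ∀ {l s t} x y → OnLine l s → OnLine l t → OnLine l (x ⊡ s ⊞ y ⊡ t)
  line-combination {l} {a , b , c} {a′ , b′ , c′} x y o o′ = vanish₂ {k = x} {l = y} (solve 9 (λ l x y a b c a′ b′ c′ →
    (x :* a :+ y :* a′) :+ l :* (x :* b :+ y :* b′) :+ l :* l :* (x :* c :+ y :* c′) :=
    x :* (a :+ l :* b :+ l :* l :* c) :+ y :* (a′ :+ l :* b′ :+ l :* l :* c′)) refl l x y a b c a′ b′ c′) o o′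

  -- A moved point and its rotation are independent, so they span their line.
  moved-spans-line : ∀ {l t s} → CubeRoot l → NonZeroT t → OnLine l t → ¬ Fixed t → OnLine l s →
    ∃ λ x → ∃ λ y → s ≡ x ⊡ t ⊞ y ⊡ rotate t
  moved-spans-line {l} {t@(a , b , c)} {a′ , b′ , c′} h t≢0 o ¬f o′ =
    -- Cramer's rule in the last two coordinates, where t and its rotation read (b, c) and (a, b)
    -- with determinant b² - ac. The first coordinate then follows from the line equation.
    i * (b′ * b - c′ * a) , i * (c′ * b - b′ * c) ,
    line-extensional o′ (line-combination _ _ o (line-rotate h o))
      (scaled (solve 6 (λ i a b c b′ c′ → i :* (b′ :* b :- c′ :* a) :* b :+ i :* (c′ :* b :- b′ :* c) :* a :=
        ((b :* b :- a :* c) :* i) :* b′) refl i a b c b′ c′))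
      (scaled (solve 6 (λ i a b c b′ c′ → i :* (b′ :* b :- c′ :* a) :* c :+ i :* (c′ :* b :- b′ :* c) :* b :=
        ((b :* b :- a :* c) :* i) :* c′) refl i a b c b′ c′))
    where
    r = rotate t
    o-zero : OnLine l 0T
    o-zero = solve 1 (λ l → :0 :+ l :* :0 :+ l :* l :* :0 := :0) refl l
    swap : ∀ {x y} → x ⊡ t ⊞ (- y) ⊡ r ≡ 0T → x ⊡ t ≡ y ⊡ r
    swap {x} {y} e = tri-≡ (entry (cong proj₁ e)) (entry (cong (proj₁ ∘ proj₂) e)) (entry (cong (proj₂ ∘ proj₂) e))
      where
      entry : ∀ {p q} → x * p + (- y) * q ≡ 0# → x * p ≡ y * q
      entry {p} {q} e = equal-of-difference (trans (solve 4 (λ x y p q → x :* p :- y :* q := x :* p :+ (:- y) :* q) refl x y p q) e)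
    proportional : ∀ {x y} → x ⊡ t ≡ y ⊡ r → y ≡ 0#
    proportional {x} {y} e with y ≟ 0#
    ... | yes y≡0 = y≡0
    ... | no y≢0 = ⊥-elim (¬f (~-trans (x , x≢0 , refl) (subst (_~ r) (sym e) (~-sym (y , y≢0 , refl)))))
      where
      x≢0 : ¬ x ≡ 0#
      x≢0 refl = ⊡-nonzero {t = r} y≢0 (λ z → t≢0 (cong (rotate ∘ rotate) z)) (trans (sym e) (0⊡ t))
    -- If b² = ac, then b t - c r and a t - b r vanish in the last two coordinates and, being on the
    -- line, altogether. As t is not proportional to its rotation r, this forces c = b = 0, and the
    -- line equation gives a = 0.
    D≢0 : ¬ b * b - a * c ≡ 0#
    D≢0 d = t≢0 (tri-≡ a≡0 b≡0 c≡0)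
      where
      c≡0 : c ≡ 0#
      c≡0 = proportional (swap (line-extensional (line-combination b (- c) o (line-rotate h o)) o-zero
        (trans (solve 3 (λ a b c → b :* b :+ (:- c) :* a := b :* b :- a :* c) refl a b c) d)
        (solve 2 (λ b c → b :* c :+ (:- c) :* b := :0) refl b c)))
      b≡0 : b ≡ 0#
      b≡0 = proportional (swap (line-extensional (line-combination a (- b) o (line-rotate h o)) o-zero
        (solve 2 (λ a b → a :* b :+ (:- b) :* a := :0) refl a b)
        (vanish {k = - 1#} (solve 3 (λ a b c → a :* c :+ (:- b) :* b := (:- :1) :* (b :* b :- a :* c)) refl a b c) d)))
      a≡0 : a ≡ 0#
      a≡0 = vanish₃ {k = 1#} {l = - l} {m = - (l * l)} (solve 4 (λ l a b c → a := :1 :* (a :+ l :* b :+ l :* l :* c) :+ (:- l) :* b :+ (:- (l :* l)) :* c) refl l a b c) o b≡0 c≡0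
    i = proj₁ (inverse (b * b - a * c) D≢0)
    scaled : ∀ {z w} → w ≡ ((b * b - a * c) * i) * z → z ≡ w
    scaled {z} e = sym (trans e (trans (cong (_* z) (proj₂ (inverse (b * b - a * c) D≢0))) (*-identityˡ z)))

  -- The line has q + 1 ≥ 3 points, of which r ≤ 2 are fixed.
  moved-point-on-line : ∀ {l} → CubeRoot l → ∃ λ t → NonZeroT t × OnLine l t × ¬ Fixed t
  moved-point-on-line h = witness (count-moved-on-line h) positive
    where
    positive : ¬ moved-per-line ≡ 0
    positive e = ℕₚ.<⇒≱ (ℕₚ.≤-trans (ℕ.s≤s (proj₂ (proj₂ (proj₂ (proj₂ cube-root-counts))))) 3≤1+q) (ℕₚ.m∸n≡0⇒m≤n e)
      where
      3≤1+q : 3 ℕ.≤ suc order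
      3≤1+q = ℕ.s≤s (subst (2 ℕ.≤_) (sym order≡1+p) (ℕ.s≤s (ℕₚ.n≢0⇒n>0 p≢0)))
    witness : ∀ {n l} → HasCount _~_ (λ t → (NonZeroT t × OnLine l t) × ¬ Fixed t) n → ¬ n ≡ 0 →
      ∃ λ t → NonZeroT t × OnLine l t × ¬ Fixed t
    witness ([] , refl , _) n≢0 = ⊥-elim (n≢0 refl)
    witness (t ∷ _ , _ , ((nz , o) , f) All.∷ _ , _) _ = t , nz , o , f

-- The embedding of F in E and coordinates in E³.

module Embedding {F E : FiniteField} (X : Extension F E) where
  open Extension X public
  module F where
    open FieldTheory F public
    open Circulants F public
  module E where
    open FieldTheory E public
    open Circulants E public

  ι-0 : ι F.0# ≡ E.0#
  ι-0 = begin
    ι F.0#                          ≡⟨ E.solve 1 (λ x → x E.:= (x E.:+ x) E.:- x) refl (ι F.0#) ⟩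
    (ι F.0# E.+ ι F.0#) E.- ι F.0#  ≡⟨ cong (E._- ι F.0#) (sym (ι-+ F.0# F.0#)) ⟩
    ι (F.0# F.+ F.0#) E.- ι F.0#    ≡⟨ cong (λ x → ι x E.- ι F.0#) (F.+-identityˡ F.0#) ⟩
    ι F.0# E.- ι F.0#               ≡⟨ E.-‿inverseʳ _ ⟩
    E.0#                            ∎
    where open ≡-Reasoning

  ι-neg : ∀ x → ι (F.- x) ≡ E.- ι x
  ι-neg x = E.equal-of-difference (begin
    ι (F.- x) E.- (E.- ι x)  ≡⟨ E.solve 2 (λ y x → y E.:- (E.:- x) E.:= x E.:+ y) refl (ι (F.- x)) (ι x) ⟩
    ι x E.+ ι (F.- x)        ≡⟨ sym (ι-+ _ _) ⟩
    ι (x F.- x)              ≡⟨ cong ι (F.-‿inverseʳ x) ⟩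
    ι F.0#                   ≡⟨ ι-0 ⟩
    E.0#                     ∎)
    where open ≡-Reasoning

  ι-nonzero : ∀ {x} → ¬ x ≡ F.0# → ¬ ι x ≡ E.0#
  ι-nonzero {x} x≢0 = let i , e = F.inverse x x≢0 in
    E.unit-nonzero (trans (sym (ι-* x i)) (trans (cong ι e) ι-1))

  ι-injective : ∀ {x y} → ι x ≡ ι y → x ≡ y
  ι-injective {x} {y} h with x F.- y F.≟ F.0#
  ... | yes e = F.equal-of-difference e
  ... | no n = ⊥-elim (ι-nonzero n (trans (ι-+ _ _) (trans (cong (ι x E.+_) (ι-neg y)) (E.difference-zero h))))

  ιT : F.Tri → E.Tri
  ιT (a , b , c) = ι a , ι b , ι c

  ιT-injective : ∀ {s t} → ιT s ≡ ιT t → s ≡ t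
  ιT-injective h = F.tri-≡ (ι-injective (cong proj₁ h)) (ι-injective (cong (proj₁ ∘ proj₂) h)) (ι-injective (cong (proj₂ ∘ proj₂) h))

  ιT-0 : ιT F.0T ≡ E.0T
  ιT-0 = E.tri-≡ ι-0 ι-0 ι-0

  ιT-⊡ : ∀ c t → ιT (c F.⊡ t) ≡ ι c E.⊡ ιT t
  ιT-⊡ c _ = E.tri-≡ (ι-* _ _) (ι-* _ _) (ι-* _ _)

  ιT-⊞ : ∀ s t → ιT (s F.⊞ t) ≡ ιT s E.⊞ ιT t
  ιT-⊞ _ _ = E.tri-≡ (ι-+ _ _) (ι-+ _ _) (ι-+ _ _)

  ιT-combination : ∀ t x y z → ιT (F.combination t x y z) ≡ E.combination (ιT t) (ιT x) (ιT y) (ιT z)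
  ιT-combination (a , b , c) x y z = trans (ιT-⊞ _ _) (cong₂ E._⊞_ (trans (ιT-⊞ _ _) (cong₂ E._⊞_ (ιT-⊡ a x) (ιT-⊡ b y))) (ιT-⊡ c z))

  ι-det : ∀ x y z → ι (F.det x y z) ≡ E.det (ιT x) (ιT y) (ιT z)
  ι-det (x₀ , x₁ , x₂) (y₀ , y₁ , y₂) (z₀ , z₁ , z₂) =
    trans (ι-+ _ _) (cong₂ E._+_ (trans (ι-+ _ _) (cong₂ E._+_ (term _ _ _ _ _) (term _ _ _ _ _))) (term _ _ _ _ _))
    where
    term : ∀ x a b c d → ι (x F.* (a F.* b F.- c F.* d)) ≡ ι x E.* (ι a E.* ι b E.- ι c E.* ι d)
    term x a b c d = trans (ι-* _ _) (cong (ι x E.*_) (trans (ι-+ _ _) (cong₂ E._+_ (ι-* a b) (trans (ι-neg _) (cong E.-_ (ι-* c d))))))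

  -- For rows with entries in F, dependence over either field is the vanishing of one and the same
  -- determinant, and `ι` is injective.
  dependent-descends : ∀ {x y z} → E.Dependent (ιT x) (ιT y) (ιT z) → F.Dependent x y z
  dependent-descends h = F.det≡0⇒dependent (ι-injective (trans (ι-det _ _ _) (trans (E.dependent⇒det≡0 h) (sym ι-0))))

  open Geometry X public

  toT : V → E.Tri
  toT v = x₀ v , x₁ v , x₂ v

  fromT : E.Tri → V
  fromT (a , b , c) = ⟨ a , b , c ⟩

  infix 4 _≟V_
  _≟V_ : (u v : V) → Dec (u ≡ v)
  u ≟V v = map′ (cong fromT) (cong toT) (toT u E.≟T toT v)

  ∼E-to : ∀ {u w} → u ∼E w → toT u E.~ toT w
  ∼E-to (a , a≢0 , e) = a , a≢0 , cong toT e

  ∼E-from : ∀ {u w} → toT u E.~ toT w → u ∼E w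
  ∼E-from (a , a≢0 , e) = a , a≢0 , cong fromT e

  ∼E-refl : ∀ {u} → u ∼E u
  ∼E-refl = ∼E-from E.~-refl

  ∼E-sym : ∀ {u w} → u ∼E w → w ∼E u
  ∼E-sym h = ∼E-from (E.~-sym (∼E-to h))

  ∼E-trans : ∀ {u v w} → u ∼E v → v ∼E w → u ∼E w
  ∼E-trans h g = ∼E-from (E.~-trans (∼E-to h) (∼E-to g))

  ∼E-nonzero : ∀ {u w} → u ∼E w → NonZero u → NonZero w
  ∼E-nonzero h nz e = E.nonzero-closed (∼E-to h) (nz ∘ cong fromT) (cong toT e)

  ∼F⇒∼E : ∀ {u w} → u ∼F w → u ∼E w
  ∼F⇒∼E (c , c≢0 , e) = ι c , ι-nonzero c≢0 , e

  DepE-to : ∀ {u v w} → DepE u v w → E.Dependent (toT u) (toT v) (toT w)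
  DepE-to (a , b , c , nz , e) = (a , b , c) ,
    (λ h → [ (λ n → n (cong proj₁ h)) , [ (λ n → n (cong (proj₁ ∘ proj₂) h)) , (λ n → n (cong (proj₂ ∘ proj₂) h)) ]′ ]′ nz) , cong toT e

  DepE-from : ∀ {u v w} → E.Dependent (toT u) (toT v) (toT w) → DepE u v w
  DepE-from ((a , b , c) , nz , e) = a , b , c , E.coordinate≢0 nz , cong fromT e

  DepF⇒DepE : ∀ {u v w} → DepF u v w → DepE u v w
  DepF⇒DepE (a , b , c , nz , e) = ι a , ι b , ι c ,
    [ (λ n → inj₁ (ι-nonzero n)) , [ (λ n → inj₂ (inj₁ (ι-nonzero n))) , (λ n → inj₂ (inj₂ (ι-nonzero n))) ]′ ]′ nz , e

  det-scale : ∀ a b c x y z → E.det (a E.⊡ x) (b E.⊡ y) (c E.⊡ z) ≡ (a E.* b E.* c) E.* E.det x y z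
  det-scale a b c (x₀ , x₁ , x₂) (y₀ , y₁ , y₂) (z₀ , z₁ , z₂) = E.solve 12 (λ a b c x₀ x₁ x₂ y₀ y₁ y₂ z₀ z₁ z₂ →
    E.:det (a E.:* x₀) (a E.:* x₁) (a E.:* x₂) (b E.:* y₀) (b E.:* y₁) (b E.:* y₂) (c E.:* z₀) (c E.:* z₁) (c E.:* z₂) E.:=
    (a E.:* b E.:* c) E.:* E.:det x₀ x₁ x₂ y₀ y₁ y₂ z₀ z₁ z₂) refl a b c x₀ x₁ x₂ y₀ y₁ y₂ z₀ z₁ z₂

  DepE-resp : ∀ {u v w u′ v′ w′} → u ∼E u′ → v ∼E v′ → w ∼E w′ → DepE u v w → DepE u′ v′ w′
  DepE-resp (a , _ , refl) (b , _ , refl) (c , _ , refl) h = DepE-from (E.det≡0⇒dependent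
    (E.vanish {k = a E.* b E.* c} (det-scale a b c _ _ _) (E.dependent⇒det≡0 (DepE-to h))))

  lin : V → V → V → E.Tri → V
  lin u v w (a , b , c) = a · u ⊕ b · v ⊕ c · w

  linF : V → V → V → F.Tri → V
  linF u v w t = lin u v w (ιT t)

  lin-⊡ : ∀ {u v w} a t → lin u v w (a E.⊡ t) ≡ a · lin u v w t
  lin-⊡ {u} {v} {w} a (x , y , z) = cong fromT (E.tri-≡ (entry _ _ _) (entry _ _ _) (entry _ _ _))
    where
    entry : ∀ p q r → a E.* x E.* p E.+ a E.* y E.* q E.+ a E.* z E.* r ≡ a E.* (x E.* p E.+ y E.* q E.+ z E.* r)
    entry = E.solve 7 (λ a x y z p q r → a E.:* x E.:* p E.:+ a E.:* y E.:* q E.:+ a E.:* z E.:* r E.:= a E.:* (x E.:* p E.:+ y E.:* q E.:+ z E.:* r)) refl a x y z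

  lin-⊞ : ∀ {u v w} s t → lin u v w (s E.⊞ t) ≡ lin u v w s ⊕ lin u v w t
  lin-⊞ {u} {v} {w} (x , y , z) (x′ , y′ , z′) = cong fromT (E.tri-≡ (entry _ _ _) (entry _ _ _) (entry _ _ _))
    where
    entry : ∀ p q r → (x E.+ x′) E.* p E.+ (y E.+ y′) E.* q E.+ (z E.+ z′) E.* r ≡ (x E.* p E.+ y E.* q E.+ z E.* r) E.+ (x′ E.* p E.+ y′ E.* q E.+ z′ E.* r)
    entry = E.solve 9 (λ x y z x′ y′ z′ p q r → (x E.:+ x′) E.:* p E.:+ (y E.:+ y′) E.:* q E.:+ (z E.:+ z′) E.:* r
      E.:= (x E.:* p E.:+ y E.:* q E.:+ z E.:* r) E.:+ (x′ E.:* p E.:+ y′ E.:* q E.:+ z′ E.:* r)) refl x y z x′ y′ z′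

  lin-0 : ∀ {u v w} → lin u v w E.0T ≡ 0V
  lin-0 {u} {v} {w} = cong fromT (E.tri-≡ (entry _ _ _) (entry _ _ _) (entry _ _ _))
    where
    entry : ∀ p q r → E.0# E.* p E.+ E.0# E.* q E.+ E.0# E.* r ≡ E.0#
    entry = E.solve 3 (λ p q r → E.:0 E.:* p E.:+ E.:0 E.:* q E.:+ E.:0 E.:* r E.:= E.:0) refl

  linF-⊡ : ∀ {u v w} c t → linF u v w (c F.⊡ t) ≡ c ·ᶠ linF u v w t
  linF-⊡ c t = trans (cong (lin _ _ _) (ιT-⊡ c t)) (lin-⊡ (ι c) (ιT t))

  linF-⊞ : ∀ {u v w} s t → linF u v w (s F.⊞ t) ≡ linF u v w s ⊕ linF u v w t
  linF-⊞ s t = trans (cong (lin _ _ _) (ιT-⊞ s t)) (lin-⊞ (ιT s) (ιT t))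

  linF-0 : ∀ {u v w} → linF u v w F.0T ≡ 0V
  linF-0 = trans (cong (lin _ _ _) ιT-0) lin-0

  linF-combination : ∀ {u v w} t x y z → linF u v w (F.combination t x y z)
    ≡ linF (linF u v w x) (linF u v w y) (linF u v w z) t
  linF-combination {u} {v} {w} t x y z = trans (cong (lin u v w) (ιT-combination t x y z))
    (cong fromT (E.combination-assoc (ιT t) (ιT x) (ιT y) (ιT z) (toT u) (toT v) (toT w)))

  linF-e₀ : ∀ {u v w} → linF u v w F.e₀ ≡ u
  linF-e₀ = cong fromT (E.tri-≡ (entry _ _ _) (entry _ _ _) (entry _ _ _))
    where
    entry : ∀ p q r → ι F.1# E.* p E.+ ι F.0# E.* q E.+ ι F.0# E.* r ≡ p
    entry p q r rewrite ι-1 | ι-0 = E.solve 3 (λ p q r → E.:1 E.:* p E.:+ E.:0 E.:* q E.:+ E.:0 E.:* r E.:= p) refl p q r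

  linF-e₁ : ∀ {u v w} → linF u v w F.e₁ ≡ v
  linF-e₁ = cong fromT (E.tri-≡ (entry _ _ _) (entry _ _ _) (entry _ _ _))
    where
    entry : ∀ p q r → ι F.0# E.* p E.+ ι F.1# E.* q E.+ ι F.0# E.* r ≡ q
    entry p q r rewrite ι-1 | ι-0 = E.solve 3 (λ p q r → E.:0 E.:* p E.:+ E.:1 E.:* q E.:+ E.:0 E.:* r E.:= q) refl p q r

  linF-e₂ : ∀ {u v w} → linF u v w F.e₂ ≡ w
  linF-e₂ = cong fromT (E.tri-≡ (entry _ _ _) (entry _ _ _) (entry _ _ _))
    where
    entry : ∀ p q r → ι F.0# E.* p E.+ ι F.0# E.* q E.+ ι F.1# E.* r ≡ r
    entry p q r rewrite ι-1 | ι-0 = E.solve 3 (λ p q r → E.:0 E.:* p E.:+ E.:0 E.:* q E.:+ E.:1 E.:* r E.:= r) refl p q r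

  module Independent {v₀ v₁ v₂ : V} (ind : ¬ DepE v₀ v₁ v₂) where

    lin-injective : ∀ {s t} → lin v₀ v₁ v₂ s ≡ lin v₀ v₁ v₂ t → s ≡ t
    lin-injective h = E.combination-injective (ind ∘ DepE-from) (cong toT h)

    lin-onto : ∀ w → ∃ λ t → w ≡ lin v₀ v₁ v₂ t
    lin-onto w = let t , e = E.spanning (ind ∘ DepE-from ∘ E.det≡0⇒dependent) (toT w) in t , cong fromT (sym e)

    lin-nonzero : ∀ {t} → ¬ t ≡ E.0T → NonZero (lin v₀ v₁ v₂ t)
    lin-nonzero t≢0 h = t≢0 (lin-injective (trans h (sym lin-0)))

    linF-injective : ∀ {s t} → linF v₀ v₁ v₂ s ≡ linF v₀ v₁ v₂ t → s ≡ t
    linF-injective h = ιT-injective (lin-injective h)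

    linF-nonzero : ∀ {t} → ¬ t ≡ F.0T → NonZero (linF v₀ v₁ v₂ t)
    linF-nonzero t≢0 = lin-nonzero (λ h → t≢0 (ιT-injective (trans h (sym ιT-0))))

    DepE-lin : ∀ {x y z} → E.Dependent x y z → DepE (lin v₀ v₁ v₂ x) (lin v₀ v₁ v₂ y) (lin v₀ v₁ v₂ z)
    DepE-lin {x} {y} {z} (t , t≢0 , h) = DepE-from (t , t≢0 ,
      trans (sym (E.combination-assoc t x y z _ _ _)) (trans (cong (toT ∘ lin v₀ v₁ v₂) h) (cong toT (lin-0 {v₀} {v₁} {v₂}))))

    DepE-lin⁻ : ∀ {x y z} → DepE (lin v₀ v₁ v₂ x) (lin v₀ v₁ v₂ y) (lin v₀ v₁ v₂ z) → E.Dependent x y z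
    DepE-lin⁻ {x} {y} {z} d = let t , t≢0 , h = DepE-to d in t , t≢0 ,
      lin-injective (cong fromT (trans (E.combination-assoc t x y z _ _ _) (trans h (sym (cong toT (lin-0 {v₀} {v₁} {v₂}))))))

  -- An automorphism of order 3: fixed field, Moore determinant, bases of E over F.

  record GaloisAutomorphism : Set where
    field
      θ       : E.Carrier → E.Carrier
      θ-+     : ∀ x y → θ (x E.+ y) ≡ θ x E.+ θ y
      θ-*     : ∀ x y → θ (x E.* y) ≡ θ x E.* θ y
      θ-ι     : ∀ k → θ (ι k) ≡ ι k
      θ-cube  : ∀ x → θ (θ (θ x)) ≡ x
      moved   : ∃ λ t → ¬ θ t ≡ t

  module Galois (G : GaloisAutomorphism) (degree : E.order ≡ F.order ℕ.^ 3) where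
    open GaloisAutomorphism G

    θ-1 : θ E.1# ≡ E.1#
    θ-1 = trans (cong θ (sym ι-1)) (trans (θ-ι F.1#) ι-1)

    θ-0 : θ E.0# ≡ E.0#
    θ-0 = trans (cong θ (sym ι-0)) (trans (θ-ι F.0#) ι-0)

    θ-neg : ∀ x → θ (E.- x) ≡ E.- θ x
    θ-neg x = E.equal-of-difference (trans (E.solve 2 (λ y x → y E.:- (E.:- x) E.:= x E.:+ y) refl (θ (E.- x)) (θ x))
      (trans (sym (θ-+ _ _)) (trans (cong θ (E.-‿inverseʳ x)) θ-0)))

    θ-- : ∀ x y → θ (x E.- y) ≡ θ x E.- θ y
    θ-- x y = trans (θ-+ _ _) (cong (θ x E.+_) (θ-neg y))

    θ-nonzero : ∀ {x} → ¬ x ≡ E.0# → ¬ θ x ≡ E.0#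
    θ-nonzero x≢0 h = x≢0 (trans (sym (θ-cube _)) (trans (cong (θ ∘ θ) h) (trans (cong θ θ-0) θ-0)))

    private
      t = proj₁ moved
      θt≢t = proj₂ moved

      θθt≢t : ¬ θ (θ t) ≡ t
      θθt≢t h = θt≢t (trans (cong θ (sym h)) (θ-cube t))

      -- Applying θ and subtracting eliminates one coefficient at a time.
      quadratic-independent : ∀ {a b c} → θ a ≡ a → θ b ≡ b → θ c ≡ c → a E.+ b E.* t E.+ c E.* (t E.* t) ≡ E.0# →
        a ≡ E.0# × b ≡ E.0# × c ≡ E.0#
      quadratic-independent {a} {b} {c} fa fb fc h = a≡0 , b≡0 , c≡0
        where
        open ≡-Reasoning
        s = θ t
        r = θ s
        apply : a E.+ b E.* s E.+ c E.* (s E.* s) ≡ E.0#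
        apply = begin
          a E.+ b E.* s E.+ c E.* (s E.* s)
            ≡⟨ sym (cong₂ E._+_ (cong₂ E._+_ fa (trans (θ-* b t) (cong (E._* s) fb))) (trans (θ-* c _) (cong₂ E._*_ fc (θ-* t t)))) ⟩
          θ a E.+ θ (b E.* t) E.+ θ (c E.* (t E.* t))  ≡⟨ cong (E._+ θ (c E.* (t E.* t))) (sym (θ-+ _ _)) ⟩
          θ (a E.+ b E.* t) E.+ θ (c E.* (t E.* t))    ≡⟨ sym (θ-+ _ _) ⟩
          θ (a E.+ b E.* t E.+ c E.* (t E.* t))        ≡⟨ cong θ h ⟩
          θ E.0#                                       ≡⟨ θ-0 ⟩
          E.0#                                         ∎
        slope : b E.+ c E.* (s E.+ t) ≡ E.0#
        slope = E.cancel (λ e → θt≢t (E.equal-of-difference e)) (E.vanish₂ {k = E.1#} {l = E.- E.1#}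
          (E.solve 5 (λ a b c s t → (s E.:- t) E.:* (b E.:+ c E.:* (s E.:+ t)) E.:=
            E.:1 E.:* (a E.:+ b E.:* s E.:+ c E.:* (s E.:* s)) E.:+ (E.:- E.:1) E.:* (a E.:+ b E.:* t E.:+ c E.:* (t E.:* t))) refl a b c s t) apply h)
        apply-slope : b E.+ c E.* (r E.+ s) ≡ E.0#
        apply-slope = begin
          b E.+ c E.* (r E.+ s)            ≡⟨ sym (cong₂ E._+_ fb (trans (θ-* c _) (cong₂ E._*_ fc (θ-+ s t)))) ⟩
          θ b E.+ θ (c E.* (s E.+ t))      ≡⟨ sym (θ-+ _ _) ⟩
          θ (b E.+ c E.* (s E.+ t))        ≡⟨ cong θ slope ⟩
          θ E.0#                           ≡⟨ θ-0 ⟩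
          E.0#                             ∎
        c≡0 : c ≡ E.0#
        c≡0 = E.cancel (λ e → θθt≢t (E.equal-of-difference e)) (E.vanish₂ {k = E.1#} {l = E.- E.1#}
          (E.solve 5 (λ b c r s t → (r E.:- t) E.:* c E.:=
            E.:1 E.:* (b E.:+ c E.:* (r E.:+ s)) E.:+ (E.:- E.:1) E.:* (b E.:+ c E.:* (s E.:+ t))) refl b c r s t) apply-slope slope)
        b≡0 : b ≡ E.0#
        b≡0 = E.vanish₂ {k = E.1#} {l = E.- (s E.+ t)} (E.solve 4 (λ b c s t → b E.:=
          E.:1 E.:* (b E.:+ c E.:* (s E.:+ t)) E.:+ (E.:- (s E.:+ t)) E.:* c) refl b c s t) slope c≡0
        a≡0 : a ≡ E.0#
        a≡0 = E.vanish₃ {k = E.1#} {l = E.- t} {m = E.- (t E.* t)} (E.solve 4 (λ a b c t → a E.:=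
          E.:1 E.:* (a E.:+ b E.:* t E.:+ c E.:* (t E.:* t)) E.:+ (E.:- t) E.:* b E.:+ (E.:- (t E.:* t)) E.:* c) refl a b c t) h b≡0 c≡0

    -- The fixed field K of θ satisfies |K|³ ≤ |E| = |F|³, since 1, t, t² are independent over it.
    fixed-field : ∀ {x} → θ x ≡ x → ∃ λ k → x ≡ ι k
    fixed-field {x} fx with F.exists? (λ k → x E.≟ ι k)
    ... | yes h = h
    ... | no outside = ⊥-elim (ℕₚ.<⇒≱ cubes cubes′)
      where
      Fix : E.Carrier → Set
      Fix y = y ≡ y × θ y ≡ y
      fixes = count-filter {D = λ y → θ y ≡ y} (λ y → θ y E.≟ y) (λ { _ _ refl h → h }) E.count-carrier
      k = proj₁ fixes
      count-image : HasCount _≡_ (λ y → ∃ λ c → y ≡ ι c) F.order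
      count-image = count-transfer (λ c _ → ι c) (λ c _ → c , refl) (λ _ _ _ _ → ι-injective)
        (λ { _ (c , refl) → c , refl , λ { _ _ refl → refl } }) F.count-carrier
      -- A fixed x outside the image of F makes at least q + 1 fixed elements, and then the cube of
      -- their number exceeds |E|.
      larger : HasCount _≡_ (λ y → y ≡ x ⊎ ∃ λ c → y ≡ ι c) (suc F.order)
      larger = count-union (x ∷ [] , refl , refl ∷ [] , [] ∷ [] , λ _ → here) count-image
        λ { _ _ refl (c , refl) refl → outside (c , refl) }
      q<k : F.order ℕ.< k
      q<k = count-≤ ≡-equivOn larger (proj₂ fixes) (λ y _ → y) (λ { y (inj₁ refl) → refl , fx ; y (inj₂ (c , refl)) → refl , θ-ι c })
        λ { _ _ _ _ _ _ refl refl → refl }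
      value : E.Tri → E.Carrier
      value (a , b , c) = a E.+ b E.* t E.+ c E.* (t E.* t)
      value-injective : ∀ s → (Fix (proj₁ s) × Fix (proj₁ (proj₂ s)) × Fix (proj₂ (proj₂ s))) →
        ∀ s′ → (Fix (proj₁ s′) × Fix (proj₁ (proj₂ s′)) × Fix (proj₂ (proj₂ s′))) → value s ≡ value s′ → s ≡ s′
      value-injective (a , b , c) ((_ , fa) , (_ , fb) , (_ , fc)) (a′ , b′ , c′) ((_ , fa′) , (_ , fb′) , (_ , fc′)) h =
        let za , zb , zc = quadratic-independent (trans (θ-- a a′) (cong₂ E._-_ fa fa′)) (trans (θ-- b b′) (cong₂ E._-_ fb fb′))
              (trans (θ-- c c′) (cong₂ E._-_ fc fc′))
              (trans (E.solve 7 (λ a b c a′ b′ c′ t → (a E.:- a′) E.:+ (b E.:- b′) E.:* t E.:+ (c E.:- c′) E.:* (t E.:* t) E.:=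
                (a E.:+ b E.:* t E.:+ c E.:* (t E.:* t)) E.:- (a′ E.:+ b′ E.:* t E.:+ c′ E.:* (t E.:* t))) refl a b c a′ b′ c′ t) (E.difference-zero h))
        in E.tri-≡ (E.equal-of-difference za) (E.equal-of-difference zb) (E.equal-of-difference zc)
      cubes′ : k ℕ.* (k ℕ.* k) ℕ.≤ F.order ℕ.* (F.order ℕ.* F.order)
      cubes′ = ℕₚ.≤-trans (count-≤ ≡-equivOn (count-pairs (proj₂ fixes) (count-pairs (proj₂ fixes) (proj₂ fixes))) E.count-carrier
        (λ s _ → value s) (λ _ _ → refl) (λ s p s′ p′ _ _ e e′ → value-injective s p s′ p′ (trans e (sym e′))))
        (ℕₚ.≤-reflexive (trans degree (cong (λ z → F.order ℕ.* (F.order ℕ.* z)) (ℕₚ.*-identityʳ F.order))))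
      cubes : F.order ℕ.* (F.order ℕ.* F.order) ℕ.< k ℕ.* (k ℕ.* k)
      cubes = ℕₚ.*-mono-< q<k (ℕₚ.*-mono-< q<k q<k)

    θT : E.Tri → E.Tri
    θT (a , b , c) = θ a , θ b , θ c

    moore : E.Tri → E.Carrier
    moore x = E.det x (θT x) (θT (θT x))

    InSpan₁ : E.Carrier → E.Carrier → Set
    InSpan₁ a b = ∃ λ k → b ≡ ι k E.* a

    InSpan₁₂ : E.Carrier → E.Carrier → E.Carrier → Set
    InSpan₁₂ a b c = ∃ λ k → ∃ λ l → c ≡ ι k E.* a E.+ ι l E.* b

    -- Independence is stated as a chain of exclusions so that bases can be counted one coordinate
    -- at a time: 1, q and q² values of E are forbidden in turn.
    BasisOverF : E.Tri → Set
    BasisOverF (a , b , c) = ¬ a ≡ E.0# × ¬ InSpan₁ a b × ¬ InSpan₁₂ a b c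

    private
      θ-ι* : ∀ k x → θ (ι k E.* x) ≡ ι k E.* θ x
      θ-ι* k x = trans (θ-* _ _) (cong (E._* θ x) (θ-ι k))

      θ-span : ∀ k l x y → θ (ι k E.* x E.+ ι l E.* y) ≡ ι k E.* θ x E.+ ι l E.* θ y
      θ-span k l x y = trans (θ-+ _ _) (cong₂ E._+_ (θ-ι* k x) (θ-ι* l y))

    -- A relation over F between the coordinates is preserved by θ, so it holds in every row and
    -- makes the columns of the Moore matrix dependent.
    moore≢0⇒basis : ∀ x → ¬ moore x ≡ E.0# → BasisOverF x
    moore≢0⇒basis (a , b , c) m≢0 = a≢0 , not-span₁ , not-span₂
      where
      a≢0 : ¬ a ≡ E.0#
      a≢0 refl = m≢0 (E.vanish₃ {k = _} {l = _} {m = _} (E.solve 9 (λ a b c a′ b′ c′ a″ b″ c″ → E.:det a b c a′ b′ c′ a″ b″ c″ E.:=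
        (b′ E.:* c″ E.:- c′ E.:* b″) E.:* a E.:+ (b″ E.:* c E.:- c″ E.:* b) E.:* a′ E.:+ (b E.:* c′ E.:- c E.:* b′) E.:* a″)
        refl a b c (θ a) (θ b) (θ c) (θ (θ a)) (θ (θ b)) (θ (θ c))) refl θ-0 (trans (cong θ θ-0) θ-0))
      not-span₁ : ¬ InSpan₁ a b
      not-span₁ (k , refl) = m≢0 (trans (cong₂ (λ u v → E.det (a , b , c) (θ a , u , θ c) (θ (θ a) , v , θ (θ c))) (θ-ι* k a) (trans (cong θ (θ-ι* k a)) (θ-ι* k (θ a))))
        (E.solve 7 (λ k a c a′ c′ a″ c″ → E.:det a (k E.:* a) c a′ (k E.:* a′) c′ a″ (k E.:* a″) c″ E.:= E.:0)
          refl (ι k) a c (θ a) (θ c) (θ (θ a)) (θ (θ c))))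
      not-span₂ : ¬ InSpan₁₂ a b c
      not-span₂ (k , l , refl) = m≢0 (trans (cong₂ (λ u v → E.det (a , b , c) (θ a , θ b , u) (θ (θ a) , θ (θ b) , v))
        (θ-span k l a b) (trans (cong θ (θ-span k l a b)) (θ-span k l (θ a) (θ b))))
        (E.solve 8 (λ k l a b a′ b′ a″ b″ → E.:det a b (k E.:* a E.:+ l E.:* b) a′ b′ (k E.:* a′ E.:+ l E.:* b′) a″ b″ (k E.:* a″ E.:+ l E.:* b″) E.:= E.:0)
          refl (ι k) (ι l) a b (θ a) (θ b) (θ (θ a)) (θ (θ b))))

    -- Put y = b / a, z = c / a, d = θ y - y, e = θ z - z. After row reduction the determinant is a
    -- θ(a) θ²(a) (d θ(e) - e θ(d)). If it vanishes and d = 0, then y lies in F. If d ≠ 0, then κ =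
    -- e / d is fixed by θ, hence so is z - κ y, and both lie in F; this writes c as an
    -- F-combination of a and b.
    basis⇒moore≢0 : ∀ x → BasisOverF x → ¬ moore x ≡ E.0#
    basis⇒moore≢0 (a , b , c) (a≢0 , ¬span₁ , ¬span₂) h = conclude
      where
      open ≡-Reasoning
      i = proj₁ (E.inverse a a≢0)
      ai : a E.* i ≡ E.1#
      ai = proj₂ (E.inverse a a≢0)
      y = b E.* i
      z = c E.* i
      normalise : ∀ x → x ≡ x E.* i E.* a
      normalise x = sym (trans (E.solve 3 (λ x i a → x E.:* i E.:* a E.:= x E.:* (a E.:* i)) refl x i a) (trans (cong (x E.*_) ai) (trans (E.*-comm _ _) (E.*-identityˡ x))))
      b-eq : b ≡ y E.* a
      b-eq = normalise b
      c-eq : c ≡ z E.* a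
      c-eq = normalise c
      θθ-* : ∀ x y → θ (θ (x E.* y)) ≡ θ (θ x) E.* θ (θ y)
      θθ-* x y = trans (cong θ (θ-* x y)) (θ-* _ _)
      d = θ y E.- y
      e = θ z E.- z
      factored : (a E.* θ a E.* θ (θ a)) E.* (d E.* θ e E.- e E.* θ d) ≡ E.0#
      factored = begin
        (a E.* θ a E.* θ (θ a)) E.* (d E.* θ e E.- e E.* θ d)
          ≡⟨ cong₂ (λ u v → (a E.* θ a E.* θ (θ a)) E.* (d E.* u E.- e E.* v)) (θ-- (θ z) z) (θ-- (θ y) y) ⟩
        (a E.* θ a E.* θ (θ a)) E.* (d E.* (θ (θ z) E.- θ z) E.- e E.* (θ (θ y) E.- θ y))
          ≡⟨ E.solve 9 (λ a a′ a″ y y′ y″ z z′ z″ → (a E.:* a′ E.:* a″) E.:* ((y′ E.:- y) E.:* (z″ E.:- z′) E.:- (z′ E.:- z) E.:* (y″ E.:- y′)) E.:=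
               E.:det a (y E.:* a) (z E.:* a) a′ (y′ E.:* a′) (z′ E.:* a′) a″ (y″ E.:* a″) (z″ E.:* a″)) refl
               a (θ a) (θ (θ a)) y (θ y) (θ (θ y)) z (θ z) (θ (θ z)) ⟩
        E.det (a , y E.* a , z E.* a) (θ a , θ y E.* θ a , θ z E.* θ a) (θ (θ a) , θ (θ y) E.* θ (θ a) , θ (θ z) E.* θ (θ a))
          ≡⟨ cong₂ (λ u v → E.det (a , y E.* a , z E.* a) u v)
               (E.tri-≡ refl (trans (sym (θ-* y a)) (cong θ (sym b-eq))) (trans (sym (θ-* z a)) (cong θ (sym c-eq))))
               (E.tri-≡ refl (trans (sym (θθ-* y a)) (cong (θ ∘ θ) (sym b-eq))) (trans (sym (θθ-* z a)) (cong (θ ∘ θ) (sym c-eq)))) ⟩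
        E.det (a , y E.* a , z E.* a) (θ a , θ b , θ c) (θ (θ a) , θ (θ b) , θ (θ c))
          ≡⟨ cong₂ (λ u v → E.det (a , u , v) (θ a , θ b , θ c) (θ (θ a) , θ (θ b) , θ (θ c))) (sym b-eq) (sym c-eq) ⟩
        moore (a , b , c)  ≡⟨ h ⟩
        E.0#               ∎
      proportional : d E.* θ e E.- e E.* θ d ≡ E.0#
      proportional = E.cancel (E.*-nonzero (E.*-nonzero a≢0 (θ-nonzero a≢0)) (θ-nonzero (θ-nonzero a≢0))) factored
      conclude : ⊥
      conclude with d E.≟ E.0#
      ... | yes d≡0 = let k , e′ = fixed-field {y} (E.equal-of-difference d≡0) in ¬span₁ (k , trans b-eq (cong (E._* a) e′))
      ... | no d≢0 = ¬span₂ (l , k , trans c-eq (E.equal-of-difference (E.vanish₂ {k = a} {l = ι k}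
            (E.solve 6 (λ z a l k y b → z E.:* a E.:- (l E.:* a E.:+ k E.:* b) E.:=
              a E.:* ((z E.:- k E.:* y) E.:- l) E.:+ k E.:* (y E.:* a E.:- b)) refl z a (ι l) (ι k) y b)
            (E.difference-zero (trans (cong (λ w → z E.- w E.* y) (sym k-eq)) l-eq)) (E.difference-zero (sym b-eq)))))
        where
        j = proj₁ (E.inverse d d≢0)
        κ = e E.* j
        κd : κ E.* d ≡ e
        κd = trans (E.solve 3 (λ e j d → e E.:* j E.:* d E.:= e E.:* (d E.:* j)) refl e j d)
          (trans (cong (e E.*_) (proj₂ (E.inverse d d≢0))) (trans (E.*-comm _ _) (E.*-identityˡ e)))
        θκ : θ κ ≡ κ
        θκ = E.equal-of-difference (E.cancel (E.*-nonzero d≢0 (θ-nonzero d≢0)) (begin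
          d E.* θ d E.* (θ κ E.- κ)
            ≡⟨ E.solve 4 (λ d d′ k k′ → d E.:* d′ E.:* (k′ E.:- k) E.:= d E.:* (k′ E.:* d′) E.:- (k E.:* d) E.:* d′) refl d (θ d) κ (θ κ) ⟩
          d E.* (θ κ E.* θ d) E.- (κ E.* d) E.* θ d  ≡⟨ cong₂ (λ u v → d E.* u E.- v E.* θ d) (trans (sym (θ-* κ d)) (cong θ κd)) κd ⟩
          d E.* θ e E.- e E.* θ d                    ≡⟨ proportional ⟩
          E.0#                                       ∎))
        k = proj₁ (fixed-field θκ)
        k-eq : κ ≡ ι k
        k-eq = proj₂ (fixed-field θκ)
        fixed-remainder : θ (z E.- κ E.* y) ≡ z E.- κ E.* y
        fixed-remainder = E.equal-of-difference (begin
          θ (z E.- κ E.* y) E.- (z E.- κ E.* y)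
            ≡⟨ cong (E._- (z E.- κ E.* y)) (trans (θ-- z (κ E.* y)) (cong (λ w → θ z E.- w) (trans (θ-* κ y) (cong (E._* θ y) θκ)))) ⟩
          (θ z E.- κ E.* θ y) E.- (z E.- κ E.* y)
            ≡⟨ E.solve 5 (λ z z′ k y y′ → (z′ E.:- k E.:* y′) E.:- (z E.:- k E.:* y) E.:= (z′ E.:- z) E.:- k E.:* (y′ E.:- y)) refl z (θ z) κ y (θ y) ⟩
          e E.- κ E.* d  ≡⟨ E.difference-zero (sym κd) ⟩
          E.0#           ∎)
        l = proj₁ (fixed-field fixed-remainder)
        l-eq : z E.- κ E.* y ≡ ι l
        l-eq = proj₂ (fixed-field fixed-remainder)

    count-bases : HasCount _≡_ BasisOverF ((E.order ℕ.∸ 1) ℕ.* ((E.order ℕ.∸ F.order) ℕ.* (E.order ℕ.∸ F.order ℕ.* F.order)))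
    count-bases = count-Σ
      (drop (count-complement E.count-carrier (E._≟ E.0#) (λ _ _ → refl) (E.0# ∷ [] , refl , refl ∷ [] , [] ∷ [] , λ _ → here)))
      λ a a≢0 → count-Σ {Q = λ b c → ¬ InSpan₁₂ a b c}
        (drop (count-complement E.count-carrier (λ b → F.exists? λ k → b E.≟ ι k E.* a) (λ _ _ → refl) (count-span₁ a≢0)))
        λ b ¬span → drop (count-complement E.count-carrier (λ c → F.exists? λ k → F.exists? λ l → c E.≟ ι k E.* a E.+ ι l E.* b)
          (λ _ _ → refl) (count-span₂ a≢0 ¬span))
      where
      drop : ∀ {D : E.Carrier → Set} {n} → HasCount _≡_ (λ x → x ≡ x × ¬ D x) n → HasCount _≡_ (λ x → ¬ D x) n
      drop = count-cong (λ _ → proj₂) (λ _ h → refl , h)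
      ι*-injective : ∀ {a k k′} → ¬ a ≡ E.0# → ι k E.* a ≡ ι k′ E.* a → k ≡ k′
      ι*-injective a≢0 h = ι-injective (E.cancel-≡ a≢0 (trans (E.*-comm _ _) (trans h (E.*-comm _ _))))
      count-span₁ : ∀ {a} → ¬ a ≡ E.0# → HasCount _≡_ (InSpan₁ a) F.order
      count-span₁ {a} a≢0 = count-transfer (λ k _ → ι k E.* a) (λ k _ → k , refl) (λ _ _ _ _ → ι*-injective a≢0)
        (λ { _ (k , refl) → k , refl , λ { _ _ refl → refl } }) F.count-carrier
      count-span₂ : ∀ {a b} → ¬ a ≡ E.0# → ¬ InSpan₁ a b → HasCount _≡_ (InSpan₁₂ a b) (F.order ℕ.* F.order)
      count-span₂ {a} {b} a≢0 ¬span = count-transfer (λ (k , l) _ → ι k E.* a E.+ ι l E.* b) (λ (k , l) _ → k , l , refl)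
        (λ (k , l) _ (k′ , l′) _ → inj k l k′ l′)
        (λ { _ (k , l , refl) → (k , l) , (refl , refl) , λ { _ _ refl → refl } }) (count-pairs F.count-carrier F.count-carrier)
        where
        inj : ∀ k l k′ l′ → ι k E.* a E.+ ι l E.* b ≡ ι k′ E.* a E.+ ι l′ E.* b → (k , l) ≡ (k′ , l′)
        inj k l k′ l′ h with l F.- l′ F.≟ F.0#
        ... | yes e with F.equal-of-difference e
        ...   | refl = cong (_, l) (ι*-injective a≢0 (E.equal-of-difference (trans
                  (E.solve 3 (λ u v w → u E.:- v E.:= (u E.:+ w) E.:- (v E.:+ w)) refl (ι k E.* a) (ι k′ E.* a) (ι l E.* b)) (E.difference-zero h))))
        inj k l k′ l′ h | no n with F.inverse (l F.- l′) n
        ... | i , e = ⊥-elim (¬span (i F.* (k′ F.- k) , (begin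
            b                                       ≡⟨ sym (E.*-identityˡ b) ⟩
            E.1# E.* b                              ≡⟨ cong (E._* b) (trans (sym ι-1) (trans (cong ι (sym e)) (ι-* _ _))) ⟩
            (ι (l F.- l′) E.* ι i) E.* b            ≡⟨ cong (λ u → (u E.* ι i) E.* b) (ι-- l l′) ⟩
            ((ι l E.- ι l′) E.* ι i) E.* b          ≡⟨ E.equal-of-difference (E.vanish {k = ι i} (E.solve 7 (λ l l′ k k′ i a b →
                 ((l E.:- l′) E.:* i) E.:* b E.:- (i E.:* (k′ E.:- k)) E.:* a E.:= i E.:* ((k E.:* a E.:+ l E.:* b) E.:- (k′ E.:* a E.:+ l′ E.:* b)))
                 refl (ι l) (ι l′) (ι k) (ι k′) (ι i) a b) (E.difference-zero h)) ⟩
            (ι i E.* (ι k′ E.- ι k)) E.* a          ≡⟨ cong (λ u → (ι i E.* u) E.* a) (sym (ι-- k′ k)) ⟩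
            (ι i E.* ι (k′ F.- k)) E.* a            ≡⟨ cong (E._* a) (sym (ι-* _ _)) ⟩
            ι (i F.* (k′ F.- k)) E.* a              ∎)))
          where
          open ≡-Reasoning
          ι-- : ∀ x y → ι (x F.- y) ≡ ι x E.- ι y
          ι-- x y = trans (ι-+ _ _) (cong (ι x E.+_) (ι-neg y))

  -- The scalar is a ratio of corresponding coordinates, taken where the first vector is nonzero, so
  -- it lies in F.
  scalar-descends : ∀ {s t e} → ¬ s ≡ F.0T → ¬ t ≡ F.0T → ιT t ≡ e E.⊡ ιT s → s F.~ t
  scalar-descends {s₀ , s₁ , s₂} {t₀ , t₁ , t₂} {e} s≢0 t≢0 h =
    [ from (cong proj₁ h) , [ from (cong (proj₁ ∘ proj₂) h) , from (cong (proj₂ ∘ proj₂) h) ]′ ]′ (F.coordinate≢0 s≢0)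
    where
    from : ∀ {x y} → ι y ≡ e E.* ι x → ¬ x ≡ F.0# → (s₀ , s₁ , s₂) F.~ (t₀ , t₁ , t₂)
    from {x} {y} g x≢0 = k , k≢0 , t-eq
      where
      i = proj₁ (F.inverse x x≢0)
      k = y F.* i
      k-eq : ι k ≡ e
      k-eq = begin
        ι (y F.* i)                 ≡⟨ ι-* y i ⟩
        ι y E.* ι i                 ≡⟨ cong (E._* ι i) g ⟩
        e E.* ι x E.* ι i           ≡⟨ E.*-assoc _ _ _ ⟩
        e E.* (ι x E.* ι i)         ≡⟨ cong (e E.*_) (trans (sym (ι-* x i)) (trans (cong ι (proj₂ (F.inverse x x≢0))) ι-1)) ⟩
        e E.* E.1#                  ≡⟨ trans (E.*-comm _ _) (E.*-identityˡ e) ⟩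
        e                           ∎
        where open ≡-Reasoning
      t-eq : (t₀ , t₁ , t₂) ≡ k F.⊡ (s₀ , s₁ , s₂)
      t-eq = ιT-injective (trans h (trans (cong (E._⊡ ιT (s₀ , s₁ , s₂)) (sym k-eq)) (sym (ιT-⊡ k (s₀ , s₁ , s₂)))))
      k≢0 : ¬ k ≡ F.0#
      k≢0 z = t≢0 (trans t-eq (trans (cong (F._⊡ (s₀ , s₁ , s₂)) z) (F.0⊡ _)))

  DepF-lin : ∀ {u v w x y z} → F.Dependent x y z → DepF (linF u v w x) (linF u v w y) (linF u v w z)
  DepF-lin {u} {v} {w} {x} {y} {z} ((a , b , c) , t≢0 , h) = a , b , c , F.coordinate≢0 t≢0 ,
    trans (sym (linF-combination {u} {v} {w} (a , b , c) x y z)) (trans (cong (linF u v w) h) (linF-0 {u} {v} {w}))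

-- The form of σ in frame coordinates.

module Setting {F E : FiniteField} (X : Extension F E) (degree : FiniteField.order E ≡ FiniteField.order F ℕ.^ 3)
  (φ : Geometry.Collineation X) (order3 : Geometry.Order3 X φ) (b₀ b₁ b₂ : Geometry.V X)
  (frame : ¬ Geometry.DepE X b₀ b₁ b₂)
  (fixes : ∀ u → Geometry.InSubplane X b₀ b₁ b₂ u → Geometry._∼E_ X u (Geometry.Collineation.map φ u))
  (σ : Geometry.V X → Geometry.V X)
  (σ-⊕ : ∀ u w → σ (Geometry._⊕_ X u w) ≡ Geometry._⊕_ X (σ u) (σ w))
  (σ-·ᶠ : ∀ c u → σ (Geometry._·ᶠ_ X c u) ≡ Geometry._·ᶠ_ X c (σ u))
  (σ-cube : ∀ u → σ (σ (σ u)) ≡ u)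
  (σ∼φ : ∀ u → Geometry.NonZero X u → Geometry._∼E_ X (σ u) (Geometry.Collineation.map φ u)) where

  open Embedding X
  open Independent frame
  open Types φ b₀ b₁ b₂ σ public
  open Collineation φ using (resp)

  σ-0 : σ 0V ≡ 0V
  σ-0 = begin
    σ 0V             ≡⟨ cong σ (sym (vanishes 0V)) ⟩
    σ (F.0# ·ᶠ 0V)   ≡⟨ σ-·ᶠ F.0# 0V ⟩
    F.0# ·ᶠ σ 0V     ≡⟨ vanishes (σ 0V) ⟩
    0V               ∎
    where
    open ≡-Reasoning
    vanishes : ∀ u → F.0# ·ᶠ u ≡ 0V
    vanishes u = trans (cong (_· u) ι-0) (cong fromT (E.0⊡ (toT u)))

  σ-nonzero : ∀ {u} → NonZero u → NonZero (σ u)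
  σ-nonzero nz h = nz (trans (sym (σ-cube _)) (trans (cong (σ ∘ σ) h) (trans (cong σ σ-0) σ-0)))

  σ-linF : ∀ {u v w} t → σ (linF u v w t) ≡ linF (σ u) (σ v) (σ w) t
  σ-linF (a , b , c) = trans (σ-⊕ _ _) (cong₂ _⊕_ (trans (σ-⊕ _ _) (cong₂ _⊕_ (σ-·ᶠ a _) (σ-·ᶠ b _))) (σ-·ᶠ c _))

  0· : ∀ u → E.0# · u ≡ 0V
  0· u = cong fromT (E.0⊡ (toT u))

  -- The vectors v and a v represent the same point of PG(2,q³), which φ respects and σ follows. At
  -- this stage the scalar may depend on v as well as on a.
  σ-semilinear : ∀ {v} → NonZero v → ∀ a → ∃ λ e → σ (a · v) ≡ e · σ v
  σ-semilinear {v} nz a with a E.≟ E.0#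
  ... | yes refl = E.0# , trans (cong σ (0· v)) (trans σ-0 (sym (0· (σ v))))
  ... | no a≢0 = let s : v ∼E (a · v)
                     s = a , a≢0 , refl
                     e , _ , h = ∼E-trans (σ∼φ v nz) (∼E-trans (resp v (a · v) nz s) (∼E-sym (σ∼φ (a · v) (∼E-nonzero s nz))))
                 in e , h

  B : E.Tri → V
  B = lin b₀ b₁ b₂

  -- A vector with coordinates in F spans a point fixed by φ, so σ maps its E-line into itself.
  σ-on-subplane : ∀ {t} → ¬ t ≡ F.0T → ∀ a → ∃ λ e → σ (B (a E.⊡ ιT t)) ≡ B (e E.⊡ ιT t)
  σ-on-subplane {t} t≢0 a =
    let v = linF b₀ b₁ b₂ t
        nz = linF-nonzero t≢0
        e , h = σ-semilinear nz a
        c , _ , g = ∼E-trans (fixes v (v , nz , (_ , _ , _ , refl) , ∼E-refl)) (∼E-sym (σ∼φ v nz))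
    in e E.* c , (begin
      σ (B (a E.⊡ ιT t))   ≡⟨ cong σ (lin-⊡ a (ιT t)) ⟩
      σ (a · v)            ≡⟨ h ⟩
      e · σ v              ≡⟨ cong (e ·_) g ⟩
      e · c · v            ≡⟨ cong fromT (E.⊡-assoc e c (toT v)) ⟩
      (e E.* c) · v        ≡⟨ sym (lin-⊡ (e E.* c) (ιT t)) ⟩
      B ((e E.* c) E.⊡ ιT t) ∎)
    where open ≡-Reasoning

  private
    one : ∀ e → e E.* ι F.1# ≡ e
    one e = trans (cong (e E.*_) ι-1) (trans (E.*-comm _ _) (E.*-identityˡ e))

    nil : ∀ e → e E.* ι F.0# ≡ E.0#
    nil e = trans (cong (e E.*_) ι-0) (E.zeroʳ e)

    axis₀ : ∀ e → e E.⊡ ιT F.e₀ ≡ (e , E.0# , E.0#)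
    axis₀ e = E.tri-≡ (one e) (nil e) (nil e)

    axis₁ : ∀ e → e E.⊡ ιT F.e₁ ≡ (E.0# , e , E.0#)
    axis₁ e = E.tri-≡ (nil e) (one e) (nil e)

    axis₂ : ∀ e → e E.⊡ ιT F.e₂ ≡ (E.0# , E.0# , e)
    axis₂ e = E.tri-≡ (nil e) (nil e) (one e)

    unit₀ : ¬ F.e₀ ≡ F.0T
    unit₀ h = F.0≢1 (sym (cong proj₁ h))

    unit₁ : ¬ F.e₁ ≡ F.0T
    unit₁ h = F.0≢1 (sym (cong (proj₁ ∘ proj₂) h))

    unit₂ : ¬ F.e₂ ≡ F.0T
    unit₂ h = F.0≢1 (sym (cong (proj₂ ∘ proj₂) h))

    f₀ f₁ f₂ : E.Carrier → E.Carrier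
    f₀ a = proj₁ (σ-on-subplane unit₀ a)
    f₁ a = proj₁ (σ-on-subplane unit₁ a)
    f₂ a = proj₁ (σ-on-subplane unit₂ a)

    σ-axis₀ : ∀ a → σ (B (a , E.0# , E.0#)) ≡ B (f₀ a , E.0# , E.0#)
    σ-axis₀ a = trans (cong (σ ∘ B) (sym (axis₀ a))) (trans (proj₂ (σ-on-subplane unit₀ a)) (cong B (axis₀ (f₀ a))))

    σ-axis₁ : ∀ a → σ (B (E.0# , a , E.0#)) ≡ B (E.0# , f₁ a , E.0#)
    σ-axis₁ a = trans (cong (σ ∘ B) (sym (axis₁ a))) (trans (proj₂ (σ-on-subplane unit₁ a)) (cong B (axis₁ (f₁ a))))

    σ-axis₂ : ∀ a → σ (B (E.0# , E.0# , a)) ≡ B (E.0# , E.0# , f₂ a)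
    σ-axis₂ a = trans (cong (σ ∘ B) (sym (axis₂ a))) (trans (proj₂ (σ-on-subplane unit₂ a)) (cong B (axis₂ (f₂ a))))

    split : ∀ x y z → B (x , y , z) ≡ B (x , E.0# , E.0#) ⊕ B (E.0# , y , E.0#) ⊕ B (E.0# , E.0# , z)
    split x y z = trans (cong B (E.tri-≡
        (E.solve 1 (λ x → x E.:= x E.:+ E.:0 E.:+ E.:0) refl x) (E.solve 1 (λ x → x E.:= E.:0 E.:+ x E.:+ E.:0) refl y)
        (E.solve 1 (λ x → x E.:= E.:0 E.:+ E.:0 E.:+ x) refl z)))
      (trans (lin-⊞ _ _) (cong (_⊕ B (E.0# , E.0# , z)) (lin-⊞ _ _)))

    σ-split : ∀ x y z → σ (B (x , y , z)) ≡ B (f₀ x , f₁ y , f₂ z)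
    σ-split x y z = begin
      σ (B (x , y , z))                                                                 ≡⟨ cong σ (split x y z) ⟩
      σ (B (x , E.0# , E.0#) ⊕ B (E.0# , y , E.0#) ⊕ B (E.0# , E.0# , z))               ≡⟨ trans (σ-⊕ _ _) (cong (_⊕ σ (B (E.0# , E.0# , z))) (σ-⊕ _ _)) ⟩
      σ (B (x , E.0# , E.0#)) ⊕ σ (B (E.0# , y , E.0#)) ⊕ σ (B (E.0# , E.0# , z))       ≡⟨ cong₂ _⊕_ (cong₂ _⊕_ (σ-axis₀ x) (σ-axis₁ y)) (σ-axis₂ z) ⟩
      B (f₀ x , E.0# , E.0#) ⊕ B (E.0# , f₁ y , E.0#) ⊕ B (E.0# , E.0# , f₂ z)           ≡⟨ sym (split _ _ _) ⟩
      B (f₀ x , f₁ y , f₂ z)                                                             ∎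
      where open ≡-Reasoning

    -- The E-line through b₀ + b₁ is also preserved by σ, so the image of a (b₀ + b₁) has equal
    -- first and second coordinates.
    f₁≡f₀ : ∀ a → f₁ a ≡ f₀ a
    f₁≡f₀ a = let e , h = σ-on-subplane {F.1# , F.1# , F.0#} (λ h → F.0≢1 (sym (cong proj₁ h))) a
                  g = lin-injective (trans (sym (σ-split _ _ _)) (trans (cong (σ ∘ B) (sym (E.tri-≡ (one a) (one a) (nil a)))) h))
              in trans (cong (proj₁ ∘ proj₂) g) (sym (cong proj₁ g))

    f₂≡f₀ : ∀ a → f₂ a ≡ f₀ a
    f₂≡f₀ a = let e , h = σ-on-subplane {F.1# , F.0# , F.1#} (λ h → F.0≢1 (sym (cong proj₁ h))) a
                  g = lin-injective (trans (sym (σ-split _ _ _)) (trans (cong (σ ∘ B) (sym (E.tri-≡ (one a) (nil a) (one a)))) h))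
              in trans (cong (proj₂ ∘ proj₂) g) (sym (cong proj₁ g))

    abstract
      coordinates : Σ (E.Carrier → E.Carrier) λ f → ∀ x y z → σ (B (x , y , z)) ≡ B (f x , f y , f z)
      coordinates = f₀ , λ x y z → trans (σ-split x y z) (cong₂ (λ u v → B (f₀ x , u , v)) (f₁≡f₀ y) (f₂≡f₀ z))

    f : E.Carrier → E.Carrier
    f = proj₁ coordinates

    σ-B : ∀ x y z → σ (B (x , y , z)) ≡ B (f x , f y , f z)
    σ-B = proj₂ coordinates

    diagonal : E.Carrier → V
    diagonal a = B (a , a , a)

    f-+ : ∀ x y → f (x E.+ y) ≡ f x E.+ f y
    f-+ x y = cong proj₁ (lin-injective (begin
      B (f (x E.+ y) , f (x E.+ y) , f (x E.+ y))   ≡⟨ sym (σ-B _ _ _) ⟩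
      σ (B ((x , x , x) E.⊞ (y , y , y)))           ≡⟨ cong σ (lin-⊞ _ _) ⟩
      σ (diagonal x ⊕ diagonal y)                   ≡⟨ σ-⊕ _ _ ⟩
      σ (diagonal x) ⊕ σ (diagonal y)               ≡⟨ cong₂ _⊕_ (σ-B _ _ _) (σ-B _ _ _) ⟩
      diagonal (f x) ⊕ diagonal (f y)               ≡⟨ sym (lin-⊞ _ _) ⟩
      B ((f x , f x , f x) E.⊞ (f y , f y , f y))   ∎))
      where open ≡-Reasoning

    f-ι : ∀ k x → f (ι k E.* x) ≡ ι k E.* f x
    f-ι k x = cong proj₁ (lin-injective (begin
      diagonal (f (ι k E.* x))          ≡⟨ sym (σ-B _ _ _) ⟩
      σ (B (ι k E.⊡ (x , x , x)))       ≡⟨ cong σ (lin-⊡ _ _) ⟩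
      σ (k ·ᶠ diagonal x)               ≡⟨ σ-·ᶠ k _ ⟩
      k ·ᶠ σ (diagonal x)               ≡⟨ cong (k ·ᶠ_) (σ-B _ _ _) ⟩
      k ·ᶠ diagonal (f x)               ≡⟨ sym (lin-⊡ _ _) ⟩
      B (ι k E.⊡ (f x , f x , f x))     ∎))
      where open ≡-Reasoning

    f-cube : ∀ x → f (f (f x)) ≡ x
    f-cube x = cong proj₁ (lin-injective (begin
      diagonal (f (f (f x)))      ≡⟨ sym (σ-B _ _ _) ⟩
      σ (diagonal (f (f x)))      ≡⟨ cong σ (sym (σ-B _ _ _)) ⟩
      σ (σ (diagonal (f x)))      ≡⟨ cong (σ ∘ σ) (sym (σ-B _ _ _)) ⟩
      σ (σ (σ (diagonal x)))      ≡⟨ σ-cube _ ⟩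
      diagonal x                  ∎))
      where open ≡-Reasoning

    -- Semilinearity at x b₀ + b₁ forces f/f(1) to be multiplicative.
    f-* : ∀ a x → f E.1# E.* f (a E.* x) ≡ f a E.* f x
    f-* a x =
      let v≢0 : ¬ (x , E.1# , E.0#) ≡ E.0T
          v≢0 = λ h → E.0≢1 (sym (cong (proj₁ ∘ proj₂) h))
          e , h = σ-semilinear (lin-nonzero v≢0) a
          g = lin-injective (begin
            B (f (a E.* x) , f (a E.* E.1#) , f (a E.* E.0#))   ≡⟨ sym (σ-B _ _ _) ⟩
            σ (B (a E.⊡ (x , E.1# , E.0#)))                     ≡⟨ cong σ (lin-⊡ _ _) ⟩
            σ (a · B (x , E.1# , E.0#))                         ≡⟨ h ⟩
            e · σ (B (x , E.1# , E.0#))                         ≡⟨ cong (e ·_) (σ-B _ _ _) ⟩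
            e · B (f x , f E.1# , f E.0#)                       ≡⟨ sym (lin-⊡ _ _) ⟩
            B (e E.⊡ (f x , f E.1# , f E.0#))                   ∎)
      in begin
        f E.1# E.* f (a E.* x)       ≡⟨ cong (f E.1# E.*_) (cong proj₁ g) ⟩
        f E.1# E.* (e E.* f x)       ≡⟨ E.solve 3 (λ c e y → c E.:* (e E.:* y) E.:= (e E.:* c) E.:* y) refl (f E.1#) e (f x) ⟩
        (e E.* f E.1#) E.* f x       ≡⟨ cong (E._* f x) (sym (cong (proj₁ ∘ proj₂) g)) ⟩
        f (a E.* E.1#) E.* f x       ≡⟨ cong (λ z → f z E.* f x) (trans (E.*-comm _ _) (E.*-identityˡ a)) ⟩
        f a E.* f x                  ∎
      where open ≡-Reasoning

    c : E.Carrier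
    c = f E.1#

    f-0 : f E.0# ≡ E.0#
    f-0 = trans (cong f (sym (trans (cong (E._* E.0#) ι-0) (E.zeroˡ _)))) (trans (f-ι F.0# E.0#) (trans (cong (E._* f E.0#) ι-0) (E.zeroˡ _)))

    c≢0 : ¬ c ≡ E.0#
    c≢0 h = E.0≢1 (sym (trans (sym (f-cube E.1#)) (trans (cong (f ∘ f) h) (trans (cong f f-0) f-0))))

    c⁻¹ : E.Carrier
    c⁻¹ = proj₁ (E.inverse c c≢0)

    cc⁻¹ : c E.* c⁻¹ ≡ E.1#
    cc⁻¹ = proj₂ (E.inverse c c≢0)

    θ : E.Carrier → E.Carrier
    θ x = c⁻¹ E.* f x

    f-θ : ∀ x → f x ≡ c E.* θ x
    f-θ x = sym (trans (sym (E.*-assoc _ _ _)) (trans (cong (E._* f x) cc⁻¹) (E.*-identityˡ _)))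

    θ-1 : θ E.1# ≡ E.1#
    θ-1 = trans (E.*-comm _ _) cc⁻¹

    θ-* : ∀ x y → θ (x E.* y) ≡ θ x E.* θ y
    θ-* x y = E.cancel-≡ (E.*-nonzero c≢0 c≢0) (begin
      c E.* c E.* θ (x E.* y)          ≡⟨ E.*-assoc _ _ _ ⟩
      c E.* (c E.* θ (x E.* y))        ≡⟨ cong (c E.*_) (sym (f-θ _)) ⟩
      c E.* f (x E.* y)                ≡⟨ f-* x y ⟩
      f x E.* f y                      ≡⟨ cong₂ E._*_ (f-θ x) (f-θ y) ⟩
      (c E.* θ x) E.* (c E.* θ y)      ≡⟨ E.solve 3 (λ c u v → (c E.:* u) E.:* (c E.:* v) E.:= c E.:* c E.:* (u E.:* v)) refl c (θ x) (θ y) ⟩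
      c E.* c E.* (θ x E.* θ y)        ∎)
      where open ≡-Reasoning

    fff : ∀ x → f (f (f x)) ≡ (c E.* θ c E.* θ (θ c)) E.* θ (θ (θ x))
    fff x = begin
      f (f (f x))                                    ≡⟨ f-θ _ ⟩
      c E.* θ (f (f x))                              ≡⟨ cong (λ z → c E.* θ z) (trans (f-θ _) (cong (λ z → c E.* θ z) (f-θ x))) ⟩
      c E.* θ (c E.* θ (c E.* θ x))                  ≡⟨ cong (c E.*_) (trans (θ-* _ _) (cong (θ c E.*_) (trans (cong θ (θ-* _ _)) (θ-* _ _)))) ⟩
      c E.* (θ c E.* (θ (θ c) E.* θ (θ (θ x))))      ≡⟨ E.solve 4 (λ c d e y → c E.:* (d E.:* (e E.:* y)) E.:= (c E.:* d E.:* e) E.:* y) refl c (θ c) (θ (θ c)) _ ⟩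
      (c E.* θ c E.* θ (θ c)) E.* θ (θ (θ x))        ∎
      where open ≡-Reasoning

    -- Evaluating σ³ = 1 at 1 shows that the norm of c is 1. It then drops out of the formula for
    -- f³, which leaves θ³ = 1.
    norm-c : c E.* θ c E.* θ (θ c) ≡ E.1#
    norm-c = trans (sym (trans (cong ((c E.* θ c E.* θ (θ c)) E.*_) (trans (cong (θ ∘ θ) θ-1) (trans (cong θ θ-1) θ-1)))
      (trans (E.*-comm _ _) (E.*-identityˡ _)))) (trans (sym (fff E.1#)) (f-cube E.1#))

    σ-θ : ∀ x y z → σ (B (x , y , z)) ≡ B (c E.⊡ (θ x , θ y , θ z))
    σ-θ x y z = trans (σ-B x y z) (cong B (E.tri-≡ (f-θ x) (f-θ y) (f-θ z)))

    -- Were θ the identity, σ would be multiplication by c and φ would fix every point, against its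
    -- order 3. This is what makes θ nontrivial.
    scalar-fixes : (∀ x → θ x ≡ x) → ∀ u → NonZero u → u ∼E φ′ u
    scalar-fixes θ-id u nz = ∼E-trans (c , c≢0 , (begin
      σ u                               ≡⟨ cong σ e ⟩
      σ (B t)                           ≡⟨ σ-θ _ _ _ ⟩
      B (c E.⊡ θ³ t)                    ≡⟨ cong (λ s → B (c E.⊡ s)) (E.tri-≡ (θ-id _) (θ-id _) (θ-id _)) ⟩
      B (c E.⊡ t)                       ≡⟨ lin-⊡ c t ⟩
      c · B t                           ≡⟨ cong (c ·_) (sym e) ⟩
      c · u                             ∎)) (σ∼φ u nz)
      where
      open ≡-Reasoning
      θ³ : E.Tri → E.Tri
      θ³ (x , y , z) = θ x , θ y , θ z
      t : E.Tri
      t = proj₁ (lin-onto u)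
      e : u ≡ B t
      e = proj₂ (lin-onto u)

    θ-moved : ∃ λ t → ¬ θ t ≡ t
    θ-moved = decide (E.exists? (λ t → ¬? (θ t E.≟ t)))
      where
      decide : Dec (∃ λ t → ¬ θ t ≡ t) → ∃ λ t → ¬ θ t ≡ t
      decide (yes h) = h
      decide (no none) = let u , nz , h = proj₂ order3 in
        ⊥-elim (h (scalar-fixes (λ x → decidable-stable (θ x E.≟ x) (λ h → none (x , h))) u nz))

    automorphism : GaloisAutomorphism
    automorphism = record
      { θ = θ
      ; θ-+ = λ x y → trans (cong (c⁻¹ E.*_) (f-+ x y)) (E.solve 3 (λ i x y → i E.:* (x E.:+ y) E.:= i E.:* x E.:+ i E.:* y) refl c⁻¹ (f x) (f y))
      ; θ-* = θ-*
      ; θ-ι = λ k → trans (cong θ (sym (one′ (ι k)))) (trans (cong (c⁻¹ E.*_) (f-ι k E.1#))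
          (trans (E.solve 3 (λ i k c → i E.:* (k E.:* c) E.:= k E.:* (c E.:* i)) refl c⁻¹ (ι k) c) (trans (cong (ι k E.*_) cc⁻¹) (one′ (ι k)))))
      ; θ-cube = λ x → trans (sym (E.*-identityˡ _)) (trans (cong (E._* θ (θ (θ x))) (sym norm-c)) (trans (sym (fff x)) (f-cube x)))
      ; moved = θ-moved
      }
      where
      one′ : ∀ x → x E.* E.1# ≡ x
      one′ x = trans (E.*-comm _ _) (E.*-identityˡ x)

  open Galois automorphism degree

  -- III-points as bases of E over F.

  dependent-σ : ∀ {u} → NonZero u → DepE u (φ′ u) (φ′ (φ′ u)) → DepE u (σ u) (σ (σ u))
  dependent-σ {u} nz = DepE-resp ∼E-refl (∼E-sym (σ∼φ u nz))
    (∼E-sym (∼E-trans (σ∼φ (σ u) (σ-nonzero nz)) (resp (σ u) (φ′ u) (σ-nonzero nz) (σ∼φ u nz))))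

  dependent-φ : ∀ {u} → NonZero u → DepE u (σ u) (σ (σ u)) → DepE u (φ′ u) (φ′ (φ′ u))
  dependent-φ {u} nz = DepE-resp ∼E-refl (σ∼φ u nz)
    (∼E-trans (σ∼φ (σ u) (σ-nonzero nz)) (resp (σ u) (φ′ u) (σ-nonzero nz) (σ∼φ u nz)))

  -- In frame coordinates the orbit of x consists of x, c θ(x) and c θ(c) θ²(x), so its determinant
  -- is the Moore determinant up to the nonzero product of these row factors.
  det-orbit : ∀ x → ∃ λ d → ¬ d ≡ E.0# × σ (B x) ≡ B (c E.⊡ θT x) × σ (σ (B x)) ≡ B ((c E.* θ c) E.⊡ θT (θT x))
    × E.det x (c E.⊡ θT x) ((c E.* θ c) E.⊡ θT (θT x)) ≡ d E.* moore x
  det-orbit x@(x₀ , x₁ , x₂) = E.1# E.* c E.* (c E.* θ c) , E.*-nonzero (E.*-nonzero (E.0≢1 ∘ sym) c≢0) (E.*-nonzero c≢0 (θ-nonzero c≢0))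
    , σ-θ x₀ x₁ x₂
    , trans (cong σ (σ-θ x₀ x₁ x₂)) (trans (σ-θ _ _ _) (cong B (E.tri-≡ (twice x₀) (twice x₁) (twice x₂))))
    , trans (cong (λ y → E.det y (c E.⊡ θT x) ((c E.* θ c) E.⊡ θT (θT x))) (sym (E.1⊡ x))) (det-scale _ _ _ _ _ _)
    where
    twice : ∀ x → c E.* θ (c E.* θ x) ≡ (c E.* θ c) E.* θ (θ x)
    twice x = trans (cong (c E.*_) (θ-* _ _)) (sym (E.*-assoc _ _ _))

  TypeIII⇒basis : ∀ x → TypeIII (B x) → BasisOverF x
  TypeIII⇒basis x (nz , ind) = moore≢0⇒basis x λ m → ind (dependent-φ nz
    (let d , d≢0 , h₁ , h₂ , e = det-orbit x in
     subst (λ v → DepE (B x) v (σ (σ (B x)))) (sym h₁) (subst (DepE (B x) (B (c E.⊡ θT x))) (sym h₂)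
       (DepE-lin (E.det≡0⇒dependent (E.vanish e m))))))

  basis⇒TypeIII : ∀ x → BasisOverF x → TypeIII (B x)
  basis⇒TypeIII x b@(x₀≢0 , _) = nz , λ dep →
    let d , d≢0 , h₁ , h₂ , e = det-orbit x
        dep′ = subst (DepE (B x) (B (c E.⊡ θT x))) h₂ (subst (λ v → DepE (B x) v (σ (σ (B x)))) h₁ (dependent-σ nz dep))
    in basis⇒moore≢0 x b (E.cancel d≢0 (trans (sym e) (E.dependent⇒det≡0 (DepE-lin⁻ dep′))))
    where
    nz = lin-nonzero {x} (λ h → x₀≢0 (cong proj₁ h))

  count-TypeIII : HasCount _≡_ TypeIII ((E.order ℕ.∸ 1) ℕ.* ((E.order ℕ.∸ F.order) ℕ.* (E.order ℕ.∸ F.order ℕ.* F.order)))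
  count-TypeIII = count-transfer (λ x _ → B x) basis⇒TypeIII (λ _ _ _ _ → lin-injective) onto count-bases
    where
    onto : ∀ u → TypeIII u → ∃ λ x → BasisOverF x × (∀ y → BasisOverF y → x ≡ y → u ≡ B y)
    onto u h = let x , e = lin-onto u in x , TypeIII⇒basis x (subst TypeIII e h) , λ { _ _ refl → e }

  -- Coordinates over F on the span of the σ-orbit of a III-point.

  module Orbit (u : V) (u-III : TypeIII u) where
    u≢0 : NonZero u
    u≢0 = proj₁ u-III

    independent : ¬ DepE u (σ u) (σ (σ u))
    independent = proj₂ u-III ∘ dependent-φ u≢0

    module I = Independent independent

    P : F.Tri → V
    P = linF u (σ u) (σ (σ u))

    P-0 : P F.0T ≡ 0V
    P-0 = linF-0 {u} {σ u} {σ (σ u)}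

    P-nonzero⁻ : ∀ {t} → NonZero (P t) → F.NonZeroT t
    P-nonzero⁻ nz refl = nz P-0

    -- σ is F-linear and σ³ u = u, so it permutes the three basis vectors exactly and neither c nor
    -- θ appears.
    σ-P : ∀ t → σ (P t) ≡ P (F.rotate t)
    σ-P t@(a , b , c) = trans (σ-linF t) (trans (cong (λ w → a ·ᶠ σ u ⊕ b ·ᶠ σ (σ u) ⊕ c ·ᶠ w) (σ-cube u))
      (cong fromT (E.tri-≡ (cycle _ _ _) (cycle _ _ _) (cycle _ _ _))))
      where
      cycle : ∀ x y z → x E.+ y E.+ z ≡ z E.+ x E.+ y
      cycle = E.solve 3 (λ x y z → x E.:+ y E.:+ z E.:= z E.:+ x E.:+ y) refl

    -- Because u, σ u, σ² u are independent over E, an E-proportionality is already one of the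
    -- coordinate triples and descends to F. Geometrically, the plane meets each Bose plane in at
    -- most one point.
    P-∼E : ∀ {s t} → F.NonZeroT s → F.NonZeroT t → P s ∼E P t → s F.~ t
    P-∼E s≢0 t≢0 (e , _ , h) = scalar-descends s≢0 t≢0 (I.lin-injective (trans h (sym (lin-⊡ e _))))

    P-∼F : ∀ {s t} → s F.~ t → P s ∼F P t
    P-∼F {s} (c , c≢0 , refl) = c , c≢0 , linF-⊡ c s

    rotate-nonzero : ∀ {t} → F.NonZeroT t → F.NonZeroT (F.rotate t)
    rotate-nonzero nz h = nz (cong (F.rotate ∘ F.rotate) h)

    σσ-P : ∀ t → σ (σ (P t)) ≡ P (F.rotate (F.rotate t))
    σσ-P t = trans (cong σ (σ-P t)) (σ-P (F.rotate t))

    P-DepF : ∀ {t} → F.Singular t → DepF (P t) (σ (P t)) (σ (σ (P t)))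
    P-DepF {t} s = subst (λ v → DepF (P t) v (σ (σ (P t)))) (sym (σ-P t))
      (subst (DepF (P t) (P (F.rotate t))) (sym (σσ-P t)) (DepF-lin (F.det≡0⇒dependent s)))

    -- Relative to an E-independent orbit, dependence over E becomes dependence of triples from F
    -- and so descends. Together with `P-DepF` this makes the two notions agree, and the type of P t
    -- is decided by the circulant.
    P-DepE⁻ : ∀ {t} → DepE (P t) (σ (P t)) (σ (σ (P t))) → F.Singular t
    P-DepE⁻ {t} d = F.dependent⇒det≡0 (dependent-descends (I.DepE-lin⁻
      (subst (DepE (P t) (P (F.rotate t))) (σσ-P t) (subst (λ v → DepE (P t) v (σ (σ (P t)))) (σ-P t) d))))

    P-III : ∀ {t} → F.Regular t → TypeIII (P t)
    P-III (t≢0 , regular) = I.linF-nonzero t≢0 , λ d → regular (P-DepE⁻ (dependent-σ (I.linF-nonzero t≢0) d))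

    P-III⁻ : ∀ {t} → TypeIII (P t) → F.Regular t
    P-III⁻ (nz , ind) = P-nonzero⁻ nz , λ s → ind (dependent-φ nz (DepF⇒DepE (P-DepF s)))

    P-fixed : ∀ {t} → F.NonZeroT t → F.Fixed t → FixedPoint (P t)
    P-fixed {t} t≢0 h = I.linF-nonzero t≢0 , subst (P t ∼F_) (sym (σ-P t)) (P-∼F h)

    P-∼σ⁻ : ∀ {t} → F.NonZeroT t → P t ∼E σ (P t) → F.Fixed t
    P-∼σ⁻ {t} t≢0 h = P-∼E t≢0 (rotate-nonzero t≢0) (subst (P t ∼E_) (σ-P t) h)

    P-fixed⁻ : ∀ {t} → FixedPoint (P t) → F.Fixed t
    P-fixed⁻ (nz , h) = P-∼σ⁻ (P-nonzero⁻ nz) (∼F⇒∼E h)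

    -- The rotation has order 3, so any coincidence among t, its rotation and its second rotation,
    -- up to scaling, makes t fixed; this gives the three inequalities of Type II.
    P-II : ∀ {t} → F.SingularMoved t → IIvdots (P t)
    P-II {t} (t≢0 , s , moved) = (nz , ¬uφ , ¬uφφ , ¬φφφ , dependent-φ nz (DepF⇒DepE (P-DepF s))) , P-DepF s
      where
      nz = I.linF-nonzero t≢0
      σ∼ = σ∼φ (P t) nz
      σσ∼ = ∼E-trans (σ∼φ (σ (P t)) (σ-nonzero nz)) (resp (σ (P t)) (φ′ (P t)) (σ-nonzero nz) σ∼)
      ¬uφ : ¬ P t ∼E φ′ (P t)
      ¬uφ h = moved (P-∼σ⁻ t≢0 (∼E-trans h (∼E-sym σ∼)))
      ¬uφφ : ¬ P t ∼E φ′ (φ′ (P t))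
      ¬uφφ h = moved (F.~-sym (F.rotate-~ (P-∼E t≢0 (rotate-nonzero (rotate-nonzero t≢0))
        (subst (P t ∼E_) (σσ-P t) (∼E-trans h (∼E-sym σσ∼))))))
      ¬φφφ : ¬ φ′ (P t) ∼E φ′ (φ′ (P t))
      ¬φφφ h = moved (F.rotate-~ (F.rotate-~ (P-∼E (rotate-nonzero t≢0) (rotate-nonzero (rotate-nonzero t≢0))
        (subst (_∼E P (F.rotate (F.rotate t))) (σ-P t) (subst (σ (P t) ∼E_) (σσ-P t) (∼E-trans σ∼ (∼E-trans h (∼E-sym σσ∼))))))))

    P-II⁻ : ∀ {t} → IIvdots (P t) → F.SingularMoved t
    P-II⁻ {t} ((nz , ¬uφ , _ , _ , dep) , _) = P-nonzero⁻ nz , P-DepE⁻ (dependent-σ nz dep) ,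
      λ h → ¬uφ (∼E-trans (∼F⇒∼E (proj₂ (P-fixed (P-nonzero⁻ nz) h))) (σ∼φ (P t) nz))

    orbitPlane : Plane
    orbitPlane = plane u (σ u) (σ (σ u)) (independent ∘ DepF⇒DepE)

    orbit-on : OnPlane orbitPlane u × OnPlane orbitPlane (σ u) × OnPlane orbitPlane (σ (σ u))
    orbit-on = (u≢0 , _ , _ , _ , sym linF-e₀) , (σ-nonzero u≢0 , _ , _ , _ , sym linF-e₁)
      , (σ-nonzero (σ-nonzero u≢0) , _ , _ , _ , sym linF-e₂)

    orbit-fixed : FixedPlane orbitPlane
    orbit-fixed = proj₁ (proj₂ orbit-on) , proj₂ (proj₂ orbit-on) , subst (OnPlane orbitPlane) (sym (σ-cube u)) (proj₁ orbit-on)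

  plane-σ : ∀ π → FixedPlane π → ∀ {w} → OnPlane π w → OnPlane π (σ w)
  plane-σ (plane a b c _) ((_ , α₀ , α₁ , α₂ , ha) , (_ , β₀ , β₁ , β₂ , hb) , (_ , γ₀ , γ₁ , γ₂ , hc)) (nz , x , y , z , refl) =
    σ-nonzero nz , _ , _ , _ , (begin
      σ (linF a b c (x , y , z))                                        ≡⟨ σ-linF (x , y , z) ⟩
      linF (σ a) (σ b) (σ c) (x , y , z)                                ≡⟨ cong (λ v → linF v (σ b) (σ c) (x , y , z)) ha ⟩
      linF (linF a b c α) (σ b) (σ c) (x , y , z)                       ≡⟨ cong₂ (λ v w → linF (linF a b c α) v w (x , y , z)) hb hc ⟩
      linF (linF a b c α) (linF a b c β) (linF a b c γ) (x , y , z)     ≡⟨ sym (linF-combination (x , y , z) α β γ) ⟩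
      linF a b c (F.combination (x , y , z) α β γ)                      ∎)
    where
    open ≡-Reasoning
    α = α₀ , α₁ , α₂
    β = β₀ , β₁ , β₂
    γ = γ₀ , γ₁ , γ₂

  -- The contents of one fixed-III-plane.

  module PlaneThrough (π : Plane) (π-fixed : FixedPlane π) (u : V) (u-on : OnPlane π u) (u-III : TypeIII u) where
    open Orbit u u-III
    open Plane π using (p₀; p₁; p₂)

    private
      Q : F.Tri → V
      Q = linF p₀ p₁ p₂

      coordinates-of : ∀ {w} → OnPlane π w → ∃ λ s → w ≡ Q s
      coordinates-of (_ , x , y , z , e) = (x , y , z) , e

      σu-on : OnPlane π (σ u)
      σu-on = plane-σ π π-fixed u-on

      s₀ s₁ s₂ : F.Tri
      s₀ = proj₁ (coordinates-of u-on)
      s₁ = proj₁ (coordinates-of σu-on)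
      s₂ = proj₁ (coordinates-of (plane-σ π π-fixed σu-on))

      P≡Q : ∀ t → P t ≡ Q (F.combination t s₀ s₁ s₂)
      P≡Q t = trans (cong₃ (λ a b c → linF a b c t) (proj₂ (coordinates-of u-on)) (proj₂ (coordinates-of σu-on)) (proj₂ (coordinates-of (plane-σ π π-fixed σu-on))))
        (sym (linF-combination {p₀} {p₁} {p₂} t s₀ s₁ s₂))

      -- A singular matrix would give a nonzero t with P t = 0, against the independence of the
      -- orbit. Hence the orbit of u spans all of π, whatever generators π was given with.
      change-of-basis : ¬ F.det s₀ s₁ s₂ ≡ F.0#
      change-of-basis d = let t , t≢0 , h = F.det≡0⇒dependent d in
        I.linF-nonzero t≢0 (trans (P≡Q t) (trans (cong Q h) (linF-0 {p₀} {p₁} {p₂})))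

    P-on : ∀ {t} → F.NonZeroT t → OnPlane π (P t)
    P-on {t} t≢0 = I.linF-nonzero {t} t≢0 , _ , _ , _ , P≡Q t

    onPlane⇒P : ∀ {w} → OnPlane π w → ∃ λ t → F.NonZeroT t × w ≡ P t
    onPlane⇒P {w} on = let s , e = coordinates-of on
                           t , h = F.spanning change-of-basis s
                           g = trans e (trans (cong Q (sym h)) (sym (P≡Q t)))
                       in t , P-nonzero⁻ (subst NonZero g (proj₁ on)) , g

    count-points : ∀ {R : F.Tri → Set} {S : V → Set} {k} → (∀ t → F.NonZeroT t → R t → S (P t)) → (∀ t → F.NonZeroT t → S (P t) → R t) →
      HasCount F._~_ (λ t → F.NonZeroT t × R t) k → HasCount _∼F_ (λ w → OnPlane π w × S w) k
    count-points {R} {S} to from = count-transfer (λ t _ → P t) (λ t (nz , r) → P-on nz , to t nz r)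
      (λ _ (nz , _) _ (nz′ , _) h → P-∼E nz nz′ (∼F⇒∼E h))
      λ w (on , s) → let t , nz , e = onPlane⇒P on in t , (nz , from t nz (subst S e s)) , λ y _ h → subst (_∼F P y) (sym e) (P-∼F h)

    P-span : ∀ a b s t → P (a F.⊡ s F.⊞ b F.⊡ t) ≡ a ·ᶠ P s ⊕ b ·ᶠ P t
    P-span a b s t = trans (linF-⊞ _ _) (cong₂ _⊕_ (linF-⊡ a s) (linF-⊡ b t))

    lineThrough : F.Carrier → Line
    lineThrough l = line (P g₁) (P g₂) λ a b h → let z = I.linF-injective (trans (P-span a b g₁ g₂) (trans h (sym P-0))) in
        trans (sym (second a b)) (cong (proj₁ ∘ proj₂) z) , trans (sym (third a b)) (cong (proj₂ ∘ proj₂) z)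
      where
      g₁ = F.linePoint l F.1# F.0#
      g₂ = F.linePoint l F.0# F.1#
      second : ∀ a b → a F.* F.1# F.+ b F.* F.0# ≡ a
      second = F.solve 2 (λ a b → a F.:* F.:1 F.:+ b F.:* F.:0 F.:= a) refl
      third : ∀ a b → a F.* F.0# F.+ b F.* F.1# ≡ b
      third = F.solve 2 (λ a b → a F.:* F.:0 F.:+ b F.:* F.:1 F.:= b) refl

    linePoint-span : ∀ l b c → F.linePoint l b c ≡ b F.⊡ F.linePoint l F.1# F.0# F.⊞ c F.⊡ F.linePoint l F.0# F.1#
    linePoint-span l b c = F.tri-≡
      (F.solve 3 (λ l b c → F.:- (l F.:* b F.:+ l F.:* l F.:* c) F.:= b F.:* (F.:- (l F.:* F.:1 F.:+ l F.:* l F.:* F.:0)) F.:+ c F.:* (F.:- (l F.:* F.:0 F.:+ l F.:* l F.:* F.:1))) refl l b c)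
      (F.solve 2 (λ b c → b F.:= b F.:* F.:1 F.:+ c F.:* F.:0) refl b c)
      (F.solve 2 (λ b c → c F.:= b F.:* F.:0 F.:+ c F.:* F.:1) refl b c)

    onLineThrough : ∀ {l t} → F.NonZeroT t → F.OnLine l t → OnLine (lineThrough l) (P t)
    onLineThrough {l} {a , b , c} nz o = I.linF-nonzero nz , b , c ,
      trans (cong P (trans (F.line⇒linePoint o) (linePoint-span l b c))) (P-span b c _ _)

    onLineThrough⁻ : ∀ {l t} → OnLine (lineThrough l) (P t) → F.OnLine l t
    onLineThrough⁻ {l} {t} (_ , b , c , h) = subst (F.OnLine l)
      (sym (I.linF-injective {t} (trans h (sym (P-span b c _ _)))))
      (F.line-combination b c (F.linePoint-on l F.1# F.0#) (F.linePoint-on l F.0# F.1#))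

    generator₁≢0 : ∀ l → F.NonZeroT (F.linePoint l F.1# F.0#)
    generator₁≢0 l h = F.0≢1 (sym (cong (proj₁ ∘ proj₂) h))

    generator₂≢0 : ∀ l → F.NonZeroT (F.linePoint l F.0# F.1#)
    generator₂≢0 l h = F.0≢1 (sym (cong (proj₂ ∘ proj₂) h))

    lineThrough-valid : ∀ l → F.CubeRoot l → LineInPlane π (lineThrough l) × FixedIILine (lineThrough l)
    lineThrough-valid l h = (P-on (generator₁≢0 l) , P-on (generator₂≢0 l))
      , (σ-on (generator₁≢0 l) (F.linePoint-on l F.1# F.0#) , σ-on (generator₂≢0 l) (F.linePoint-on l F.0# F.1#))
      , II-on (F.moved-point-on-line h)
      where
      II-on : (∃ λ t → F.NonZeroT t × F.OnLine l t × ¬ F.Fixed t) → ∃ λ w → OnLine (lineThrough l) w × IIvdots w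
      II-on (t , nz , o , f) = P t , onLineThrough {l} {t} nz o , P-II {t} (nz , F.line⇒singular {l} {t} h o , f)
      σ-on : ∀ {t} → F.NonZeroT t → F.OnLine l t → OnLine (lineThrough l) (σ (P t))
      σ-on {t} nz o = subst (OnLine (lineThrough l)) (sym (σ-P t)) (onLineThrough {l} {F.rotate t} (rotate-nonzero nz) (F.line-rotate {l} {t} h o))

    -- The generator (-m, 1, 0) of the second line satisfies the equation of the first only if l - m
    -- = 0.
    lineThrough-injective : ∀ {l m} → SameLine (lineThrough l) (lineThrough m) → l ≡ m
    lineThrough-injective {l} {m} (on , _) = F.equal-of-difference (trans
      (F.solve 2 (λ l m → l F.:- m F.:= F.:- (m F.:* F.:1 F.:+ m F.:* m F.:* F.:0) F.:+ l F.:* F.:1 F.:+ l F.:* l F.:* F.:0) refl l m)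
      (onLineThrough⁻ {l} {F.linePoint m F.1# F.0#} on))

    InSpan₂-combination : ∀ {d e v w} a b → InSpan₂ d e v → InSpan₂ d e w → InSpan₂ d e (a ·ᶠ v ⊕ b ·ᶠ w)
    InSpan₂-combination {d} {e} a b (x , y , refl) (x′ , y′ , refl) = a F.* x F.+ b F.* x′ , a F.* y F.+ b F.* y′ ,
      cong fromT (E.tri-≡ (entry _ _) (entry _ _) (entry _ _))
      where
      entry : ∀ p q → ι a E.* (ι x E.* p E.+ ι y E.* q) E.+ ι b E.* (ι x′ E.* p E.+ ι y′ E.* q)
        ≡ ι (a F.* x F.+ b F.* x′) E.* p E.+ ι (a F.* y F.+ b F.* y′) E.* q
      entry p q = trans (E.solve 8 (λ a b x y x′ y′ p q → a E.:* (x E.:* p E.:+ y E.:* q) E.:+ b E.:* (x′ E.:* p E.:+ y′ E.:* q)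
          E.:= (a E.:* x E.:+ b E.:* x′) E.:* p E.:+ (a E.:* y E.:+ b E.:* y′) E.:* q) refl (ι a) (ι b) (ι x) (ι y) (ι x′) (ι y′) p q)
        (cong₂ (λ r s → r E.* p E.+ s E.* q) (sym (ι-bilinear a x b x′)) (sym (ι-bilinear a y b y′)))
        where
        ι-bilinear : ∀ a x b x′ → ι (a F.* x F.+ b F.* x′) ≡ ι a E.* ι x E.+ ι b E.* ι x′
        ι-bilinear a x b x′ = trans (ι-+ _ _) (cong₂ E._+_ (ι-* a x) (ι-* b x′))

    fixedLine-σ : ∀ {d e w} → InSpan₂ d e (σ d) → InSpan₂ d e (σ e) → InSpan₂ d e w → InSpan₂ d e (σ w)
    fixedLine-σ {d} {e} hd he (x , y , refl) = subst (InSpan₂ d e)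
      (sym (trans (σ-⊕ _ _) (cong₂ _⊕_ (σ-·ᶠ x d) (σ-·ᶠ y e)))) (InSpan₂-combination x y hd he)

    line-in-plane : ∀ {d e w} → OnPlane π d → OnPlane π e → InSpan₂ d e w → InSpan₃ p₀ p₁ p₂ w
    line-in-plane (_ , a , b , c , refl) (_ , a′ , b′ , c′ , refl) (x , y , refl) = _ , _ , _ ,
      sym (trans (linF-⊞ (x F.⊡ s) (y F.⊡ s′)) (cong₂ _⊕_ (linF-⊡ x s) (linF-⊡ y s′)))
      where
      s s′ : F.Tri
      s = a , b , c
      s′ = a′ , b′ , c′

    -- A σ-stable span containing P t contains the rotated point too, and these two already span the
    -- line with parameter l.
    moved-spans : ∀ {l d e t} → F.CubeRoot l → F.NonZeroT t → F.OnLine l t → ¬ F.Fixed t →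
      InSpan₂ d e (σ d) → InSpan₂ d e (σ e) → InSpan₂ d e (P t) → ∀ s → F.OnLine l s → InSpan₂ d e (P s)
    moved-spans {l} {d} {e} {t} hl t≢0 o moved hd he ht s os = combine (F.moved-spans-line {l} {t} {s} hl t≢0 o moved os)
      where
      combine : (∃ λ x → ∃ λ y → s ≡ x F.⊡ t F.⊞ y F.⊡ F.rotate t) → InSpan₂ d e (P s)
      combine (x , y , refl) = subst (InSpan₂ d e) (sym (P-span x y t (F.rotate t)))
        (InSpan₂-combination x y ht (subst (InSpan₂ d e) (σ-P t) (fixedLine-σ hd he ht)))

    -- A II-point on ℓ is singular and moved, so it lies on a line with some cube root l as
    -- parameter. Since ℓ is σ-fixed it contains the image of that point as well, which pins it down
    -- to this line.
    fixedIILine⇒lineThrough : ∀ ℓ → LineInPlane π ℓ × FixedIILine ℓ → ∃ λ l → F.CubeRoot l ×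
      (∀ m → F.CubeRoot m → l ≡ m → SameLine ℓ (lineThrough m))
    fixedIILine⇒lineThrough (line d e d∦e) ((d-on , e-on) , ((_ , hd) , (_ , he)) , w , (w≢0 , hw) , w-II) =
      from-point (onPlane⇒P (w≢0 , line-in-plane d-on e-on hw)) hw w-II
      where
      Result : Set
      Result = ∃ λ l → F.CubeRoot l × (∀ m → F.CubeRoot m → l ≡ m → SameLine (line d e d∦e) (lineThrough m))
      from-line : ∀ {t} → F.SingularMoved t → InSpan₂ d e (P t) → (∃ λ l → F.CubeRoot l × F.OnLine l t) → Result
      from-line (t≢0 , _ , moved) ht (l , hl , o) = l , hl , λ { _ _ refl →
          (I.linF-nonzero (generator₁≢0 l) , span (F.linePoint l F.1# F.0#) (F.linePoint-on l F.1# F.0#))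
        , (I.linF-nonzero (generator₂≢0 l) , span (F.linePoint l F.0# F.1#) (F.linePoint-on l F.0# F.1#)) }
        where
        span : ∀ s → F.OnLine l s → InSpan₂ d e (P s)
        span = moved-spans hl t≢0 o moved hd he ht
      from-point : ∀ {w} → (∃ λ t → F.NonZeroT t × w ≡ P t) → InSpan₂ d e w → IIvdots w → Result
      from-point (t , t≢0 , refl) hw w-II = let h@(_ , s , moved) = P-II⁻ {t} w-II in
        from-line {t} h hw (F.singular⇒line {t} s moved)

    count-lines : HasCount SameLine (λ ℓ → LineInPlane π ℓ × FixedIILine ℓ) (gq F.order)
    count-lines = count-transfer (λ l _ → lineThrough l) lineThrough-valid (λ _ _ _ _ → lineThrough-injective)
      fixedIILine⇒lineThrough (proj₁ (proj₂ (proj₂ F.cube-root-counts)))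

    count-fixed-points : HasCount _∼F_ (λ w → OnPlane π w × FixedPoint w) (gq F.order)
    count-fixed-points = count-points (λ _ → P-fixed) (λ _ _ → P-fixed⁻) F.count-fixed

    count-II : HasCount _∼F_ (λ w → OnPlane π w × IIvdots w) (gq F.order ℕ.* F.moved-per-line)
    count-II = count-points (λ _ nz r → P-II (nz , r)) (λ _ _ h → proj₂ (P-II⁻ h)) F.count-singular-moved

    count-III : HasCount _∼F_ (λ w → OnPlane π w × IIIdots w) (proj₁ F.count-regular)
    count-III = count-points (λ _ nz r → P-III (nz , r)) (λ _ _ h → proj₂ (P-III⁻ h)) (proj₁ (proj₂ (proj₂ F.count-regular)))

  -- The number of fixed-III-planes.

  private
    SamePlaneIII : V → V → Set
    SamePlaneIII u w = InSpan₃ u (σ u) (σ (σ u)) w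

    samePlane? : ∀ u w → Dec (SamePlaneIII u w)
    samePlane? u w = F.exists? λ a → F.exists? λ b → F.exists? λ c → w ≟V linF u (σ u) (σ (σ u)) (a , b , c)

    -- Symmetry and transitivity hold because any III-point w in the orbit plane of u spans that
    -- same plane with its own orbit, by `PlaneThrough` applied to w.
    samePlane-equiv : EquivOn TypeIII SamePlaneIII
    samePlane-equiv = record
      { reflexive = λ _ → _ , _ , _ , sym linF-e₀
      ; symmetric = λ {u} {w} hu hw s →
          let open Orbit u hu
              t , _ , e = PlaneThrough.onPlane⇒P orbitPlane orbit-fixed w (proj₁ hw , s) hw (proj₁ orbit-on)
          in _ , _ , _ , e
      ; transitive = λ { {u} {w} hu hw hz s (x , y , z , refl) →
          let open Orbit u hu
          in proj₂ (PlaneThrough.P-on orbitPlane orbit-fixed w (proj₁ hw , s) hw {x , y , z}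
               (Orbit.P-nonzero⁻ w hw (proj₁ hz))) }
      }

  abstract
    -- Sending a III-vector to its orbit plane identifies classes of III-vectors with
    -- fixed-III-planes. Each class has as many vectors as there are regular triples over F, so the
    -- number of planes is the quotient of two vector counts.
    count-planes : ∃ λ N → HasCount SamePlane FixedIIIPlane N × N ℕ.* proj₁ (proj₂ F.count-regular)
      ≡ (E.order ℕ.∸ 1) ℕ.* ((E.order ℕ.∸ F.order) ℕ.* (E.order ℕ.∸ F.order ℕ.* F.order))
    count-planes =
      let N , cN = count-quotient samePlane-equiv samePlane? (λ { _ _ refl → _ , _ , _ , sym linF-e₀ }) count-TypeIII
      in N
        , count-transfer (λ u h → Orbit.orbitPlane u h)
            (λ u h → Orbit.orbit-fixed u h , u , proj₁ (Orbit.orbit-on u h) , h)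
            (λ u hu w hw (on , _) → proj₂ on)
            (λ { π (π-fixed , u , u-on , u-III) → u , u-III , λ w w-III (x , y , z , e) →
                 let w-on = subst (OnPlane π) (sym e) (PlaneThrough.P-on π π-fixed u u-on u-III {x , y , z}
                              (Orbit.P-nonzero⁻ u u-III (subst NonZero e (proj₁ w-III))))
                 in w-on , plane-σ π π-fixed w-on , plane-σ π π-fixed (plane-σ π π-fixed w-on) })
            cN
        , count-unique ≡-equivOn
            (count-fibres cN (λ x y → SamePlaneIII y x) (λ x h → x , h , _ , _ , _ , sym linF-e₀)
              (λ hx hy hy′ g s → transitive hy′ hy hx (symmetric hy hy′ s) g)
              (λ { hx _ hy hy′ refl g g′ → transitive hy hx hy′ g (symmetric hy′ hx g′) })
              fibre)
            count-TypeIII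
      where
      open EquivOn samePlane-equiv
      fibre : ∀ u → TypeIII u → HasCount _≡_ (λ w → TypeIII w × SamePlaneIII u w) (proj₁ (proj₂ F.count-regular))
      fibre u h = count-transfer (λ t _ → P t) (λ t r → P-III r , _ , _ , _ , refl) (λ _ _ _ _ → I.linF-injective)
        (λ { _ (III , x , y , z , refl) → (x , y , z) , P-III⁻ III , λ { _ _ refl → refl } })
        (proj₁ (proj₂ (proj₂ (proj₂ F.count-regular))))
        where open Orbit u h

-- Arithmetic: from counts in ℕ to the stated formulas in ℤ.

open import Data.Nat using (_>_; _^_)
open import Data.Integer using (+_; _-_) renaming (_+_ to _+ℤ_; _*_ to _*ℤ_)

private
  ∸-of-sum : ∀ {m n} k → m ≡ k ℕ.+ n → m ℕ.∸ k ≡ n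
  ∸-of-sum {n = n} k refl = ℕₚ.m+n∸m≡n k n

-- In terms of p = q - 1, the factors q³ - 1, q³ - q and q³ - q² become (p² + 3p + 3) p, (1 + p) p
-- (2 + p) and (1 + p)² p. Cancelling one p passes from III-vectors to III-points of a plane.
planes-times-points : ∀ {q p e} N k → q ≡ suc p → ¬ p ≡ 0 → e ≡ q ^ 3 →
  N ℕ.* (k ℕ.* p) ≡ (e ℕ.∸ 1) ℕ.* ((e ℕ.∸ q) ℕ.* (e ℕ.∸ q ℕ.* q)) →
  N ℕ.* k ≡ (p ℕ.* p ℕ.+ 3 ℕ.* p ℕ.+ 3) ℕ.* (((1 ℕ.+ p) ℕ.* (p ℕ.* (2 ℕ.+ p))) ℕ.* ((1 ℕ.+ p) ℕ.* (1 ℕ.+ p) ℕ.* p))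
planes-times-points {p = p} {e} N k refl p≢0 h eq = ℕₚ.*-cancelʳ-≡ _ _ p ⦃ ℕ.≢-nonZero p≢0 ⦄ (begin
  N ℕ.* k ℕ.* p    ≡⟨ ℕₚ.*-assoc N k p ⟩
  N ℕ.* (k ℕ.* p)  ≡⟨ eq ⟩
  (e ℕ.∸ 1) ℕ.* ((e ℕ.∸ suc p) ℕ.* (e ℕ.∸ suc p ℕ.* suc p))
    ≡⟨ cong₂ ℕ._*_ (∸-of-sum 1 (trans h e₁)) (cong₂ ℕ._*_ (∸-of-sum (suc p) (trans h e₂)) (∸-of-sum (suc p ℕ.* suc p) (trans h e₃))) ⟩
  ((p ℕ.* p ℕ.+ 3 ℕ.* p ℕ.+ 3) ℕ.* p) ℕ.* (((1 ℕ.+ p) ℕ.* (p ℕ.* (2 ℕ.+ p))) ℕ.* ((1 ℕ.+ p) ℕ.* (1 ℕ.+ p) ℕ.* p))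
    ≡⟨ move (p ℕ.* p ℕ.+ 3 ℕ.* p ℕ.+ 3) p (((1 ℕ.+ p) ℕ.* (p ℕ.* (2 ℕ.+ p))) ℕ.* ((1 ℕ.+ p) ℕ.* (1 ℕ.+ p) ℕ.* p)) ⟩
  (p ℕ.* p ℕ.+ 3 ℕ.* p ℕ.+ 3) ℕ.* (((1 ℕ.+ p) ℕ.* (p ℕ.* (2 ℕ.+ p))) ℕ.* ((1 ℕ.+ p) ℕ.* (1 ℕ.+ p) ℕ.* p)) ℕ.* p ∎)
  where
  open ≡-Reasoning
  open +-*-Solver
  move : ∀ a b c → (a ℕ.* b) ℕ.* c ≡ a ℕ.* c ℕ.* b
  move = solve 3 (λ a b c → (a :* b) :* c := a :* c :* b) refl
  e₁ : suc p ^ 3 ≡ 1 ℕ.+ (p ℕ.* p ℕ.+ 3 ℕ.* p ℕ.+ 3) ℕ.* p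
  e₁ = solve 1 (λ p → (con 1 :+ p) :* ((con 1 :+ p) :* ((con 1 :+ p) :* con 1)) :=
    con 1 :+ (p :* p :+ con 3 :* p :+ con 3) :* p) refl p
  e₂ : suc p ^ 3 ≡ suc p ℕ.+ (1 ℕ.+ p) ℕ.* (p ℕ.* (2 ℕ.+ p))
  e₂ = solve 1 (λ p → (con 1 :+ p) :* ((con 1 :+ p) :* ((con 1 :+ p) :* con 1)) :=
    (con 1 :+ p) :+ (con 1 :+ p) :* (p :* (con 2 :+ p))) refl p
  e₃ : suc p ^ 3 ≡ suc p ℕ.* suc p ℕ.+ (1 ℕ.+ p) ℕ.* (1 ℕ.+ p) ℕ.* p
  e₃ = solve 1 (λ p → (con 1 :+ p) :* ((con 1 :+ p) :* ((con 1 :+ p) :* con 1)) :=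
    (con 1 :+ p) :* (con 1 :+ p) :+ (con 1 :+ p) :* (con 1 :+ p) :* p) refl p

-- The bound on r makes the truncated difference a true one, and r = n + 1 turns q + 1 - r into q -
-- n.
moved-per-line-ℤ : ∀ {q r n} → + r ≡ n +ℤ + 1 → r ℕ.≤ suc q → + (suc q ℕ.∸ r) ≡ + q - n
moved-per-line-ℤ {q} {r} {n} h r≤ = begin
  + (suc q ℕ.∸ r)         ≡⟨ sym (ℤₚ.⊖-≥ r≤) ⟩
  suc q ⊖ r               ≡⟨ sym (ℤₚ.m-n≡m⊖n (suc q) r) ⟩
  + suc q - + r           ≡⟨ cong (λ z → + suc q - z) h ⟩
  + 1 +ℤ + q - (n +ℤ + 1) ≡⟨ solve 2 (λ q n → con (+ 1) :+ q :- (n :+ con (+ 1)) := q :- n) refl (+ q) n ⟩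
  + q - n                 ∎
  where
  open ≡-Reasoning
  open ℤ-Solver.+-*-Solver

-- The g fixed points and the g l moved singular points together number g (l + 1), and l = q - n.
regular-ℤ : ∀ {p k g n} l → + l ≡ + suc p - n → k ℕ.+ (g ℕ.+ g ℕ.* l) ≡ p ℕ.* p ℕ.+ 3 ℕ.* p ℕ.+ 3 →
  let Q = + suc p in + k ≡ Q *ℤ Q +ℤ Q +ℤ + 1 - + g *ℤ (Q - n +ℤ + 1)
regular-ℤ {p} {k} {g} {n} l hl h = begin
  + k
    ≡⟨ solve 3 (λ k g l → k := (k :+ (g :+ g :* l)) :- g :* (l :+ con (+ 1))) refl (+ k) (+ g) (+ l) ⟩
  (+ k +ℤ (+ g +ℤ + g *ℤ + l)) - + g *ℤ (+ l +ℤ + 1)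
    ≡⟨ cong (λ z → (+ k +ℤ (+ g +ℤ z)) - + g *ℤ (+ l +ℤ + 1)) (sym (ℤₚ.pos-* g l)) ⟩
  + (k ℕ.+ (g ℕ.+ g ℕ.* l)) - + g *ℤ (+ l +ℤ + 1)
    ≡⟨ cong₂ (λ a b → + a - + g *ℤ (b +ℤ + 1)) h hl ⟩
  + (p ℕ.* p ℕ.+ 3 ℕ.* p ℕ.+ 3) - + g *ℤ (+ suc p - n +ℤ + 1)
    ≡⟨ cong (λ z → z - + g *ℤ (+ suc p - n +ℤ + 1)) (trans (cong₂ (λ a b → a +ℤ b +ℤ + 3) (ℤₚ.pos-* p p) (ℤₚ.pos-* 3 p))
         (solve 1 (λ p → p :* p :+ con (+ 3) :* p :+ con (+ 3) := (con (+ 1) :+ p) :* (con (+ 1) :+ p) :+ (con (+ 1) :+ p) :+ con (+ 1)) refl (+ p))) ⟩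
  + suc p *ℤ + suc p +ℤ + suc p +ℤ + 1 - + g *ℤ (+ suc p - n +ℤ + 1) ∎
  where
  open ≡-Reasoning
  open ℤ-Solver.+-*-Solver

planes-ℤ : ∀ {p} N k → N ℕ.* k ≡ (p ℕ.* p ℕ.+ 3 ℕ.* p ℕ.+ 3) ℕ.* (((1 ℕ.+ p) ℕ.* (p ℕ.* (2 ℕ.+ p))) ℕ.* ((1 ℕ.+ p) ℕ.* (1 ℕ.+ p) ℕ.* p)) →
  let Q = + suc p in + N *ℤ + k ≡ Q *ℤ Q *ℤ Q *ℤ (Q *ℤ Q - + 1) *ℤ (Q - + 1) *ℤ (Q *ℤ Q +ℤ Q +ℤ + 1)
planes-ℤ {p} N k h = begin
  + N *ℤ + k    ≡⟨ sym (ℤₚ.pos-* N k) ⟩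
  + (N ℕ.* k)   ≡⟨ cong +_ h ⟩
  + (A ℕ.* (B ℕ.* C))   ≡⟨ trans (ℤₚ.pos-* A (B ℕ.* C)) (cong (+ A *ℤ_) (ℤₚ.pos-* B C)) ⟩
  + A *ℤ (+ B *ℤ + C)   ≡⟨ cong₂ _*ℤ_ (cong₂ (λ a b → a +ℤ b +ℤ + 3) (ℤₚ.pos-* p p) (ℤₚ.pos-* 3 p))
      (cong₂ _*ℤ_ (trans (ℤₚ.pos-* (1 ℕ.+ p) (p ℕ.* (2 ℕ.+ p))) (cong (+ (1 ℕ.+ p) *ℤ_) (ℤₚ.pos-* p (2 ℕ.+ p))))
                  (trans (ℤₚ.pos-* ((1 ℕ.+ p) ℕ.* (1 ℕ.+ p)) p) (cong (_*ℤ + p) (ℤₚ.pos-* (1 ℕ.+ p) (1 ℕ.+ p))))) ⟩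
  (+ p *ℤ + p +ℤ + 3 *ℤ + p +ℤ + 3) *ℤ ((+ (1 ℕ.+ p) *ℤ (+ p *ℤ + (2 ℕ.+ p))) *ℤ (+ (1 ℕ.+ p) *ℤ + (1 ℕ.+ p) *ℤ + p))
    ≡⟨ solve 1 (λ p → let q = con (+ 1) :+ p in
         (p :* p :+ con (+ 3) :* p :+ con (+ 3)) :* ((q :* (p :* (con (+ 2) :+ p))) :* (q :* q :* p))
         := q :* q :* q :* (q :* q :- con (+ 1)) :* (q :- con (+ 1)) :* (q :* q :+ q :+ con (+ 1))) refl (+ p) ⟩
  _ ∎
  where
  open ≡-Reasoning
  open ℤ-Solver.+-*-Solver
  A = p ℕ.* p ℕ.+ 3 ℕ.* p ℕ.+ 3
  B = (1 ℕ.+ p) ℕ.* (p ℕ.* (2 ℕ.+ p))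
  C = (1 ℕ.+ p) ℕ.* (1 ℕ.+ p) ℕ.* p

module Numerics (F : FiniteField) where
  open FieldTheory F using (order; cube-root-counts)
  open Circulants F using (p; p≢0; order≡1+p; moved-per-line; count-regular)

  private
    Q = + order
    r≤1+q : proj₁ cube-root-counts ℕ.≤ suc order
    r≤1+q = ℕₚ.≤-trans (proj₂ (proj₂ (proj₂ (proj₂ cube-root-counts)))) (ℕ.s≤s (subst (1 ℕ.≤_) (sym order≡1+p) (ℕ.s≤s ℕ.z≤n)))

    k : ℕ
    k = proj₁ count-regular

    line-size : + moved-per-line ≡ Q - nq order
    line-size = moved-per-line-ℤ {order} {proj₁ cube-root-counts} {nq order} (proj₁ (proj₂ (proj₂ (proj₂ cube-root-counts)))) r≤1+q

  II-number : + (gq order ℕ.* moved-per-line) ≡ + gq order *ℤ (Q - nq order)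
  II-number = trans (ℤₚ.pos-* (gq order) moved-per-line) (cong (+ gq order *ℤ_) line-size)

  III-number : + k ≡ Q *ℤ Q +ℤ Q +ℤ + 1 - + gq order *ℤ (Q - nq order +ℤ + 1)
  III-number = subst (λ q → + k ≡ + q *ℤ + q +ℤ + q +ℤ + 1 - + gq order *ℤ (+ q - nq order +ℤ + 1)) (sym order≡1+p)
    (regular-ℤ {p} {k} {gq order} {nq order} moved-per-line (subst (λ q → + moved-per-line ≡ + q - nq order) order≡1+p line-size)
      (proj₂ (proj₂ (proj₂ (proj₂ (proj₂ count-regular))))))

  plane-number : ∀ {e} N → e ≡ order ^ 3 → N ℕ.* proj₁ (proj₂ count-regular) ≡ (e ℕ.∸ 1) ℕ.* ((e ℕ.∸ order) ℕ.* (e ℕ.∸ order ℕ.* order)) →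
    + N *ℤ (Q *ℤ Q +ℤ Q +ℤ + 1 - + gq order *ℤ (Q - nq order +ℤ + 1))
      ≡ Q *ℤ Q *ℤ Q *ℤ (Q *ℤ Q - + 1) *ℤ (Q - + 1) *ℤ (Q *ℤ Q +ℤ Q +ℤ + 1)
  plane-number N h eq = trans (cong (+ N *ℤ_) (sym III-number))
    (subst (λ q → + N *ℤ + k ≡ + q *ℤ + q *ℤ + q *ℤ (+ q *ℤ + q - + 1) *ℤ (+ q - + 1) *ℤ (+ q *ℤ + q +ℤ + q +ℤ + 1)) (sym order≡1+p)
      (planes-ℤ {p} N k (planes-times-points N k order≡1+p p≢0 h
        (trans (cong (N ℕ.*_) (proj₁ (proj₂ (proj₂ (proj₂ (proj₂ count-regular)))))) eq))))

theorem20 :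
  (F E : FiniteField) (X : Extension F E) →
  let q = FiniteField.order F
      open Geometry X
      Q = + q
      nn = nq q
      g = + gq q
  in
  q > 2 → FiniteField.order E ≡ q ^ 3 →
  -- φ : a collineation of PG(2,q^3) of order 3 ...
  (φ : Collineation) → Order3 φ →
  -- ... fixing pointwise the F_q-subplane with frame b₀ b₁ b₂
  (b₀ b₁ b₂ : V) → ¬ DepE b₀ b₁ b₂ →
  (∀ u → InSubplane b₀ b₁ b₂ u → u ∼E Collineation.map φ u) →
  -- σ : the projectivity of PG(8,q) induced by φ (F-linear, bijective,
  -- σ³ = 1, mapping each Bose plane [[P]] onto [[P^φ]])
  (σ : V → V) →
  (∀ u w → σ (u ⊕ w) ≡ σ u ⊕ σ w) →
  (∀ c u → σ (c ·ᶠ u) ≡ c ·ᶠ σ u) →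
  (Σ (V → V) λ τ → (∀ u → τ (σ u) ≡ u) × (∀ u → σ (τ u) ≡ u)) →
  (∀ u → σ (σ (σ u)) ≡ u) →
  (∀ u → NonZero u → σ u ∼E Collineation.map φ u) →
  (∀ u w → NonZero u → Collineation.map φ u ∼E w →
     ∃ λ u′ → (u ∼E u′) × (σ u′ ∼F w)) →
  let open Types φ b₀ b₁ b₂ σ in
  -- number of fixed-III-planes
  (∃ λ N → HasCount SamePlane FixedIIIPlane N ×
     ((+ N) *ℤ (Q *ℤ Q +ℤ Q +ℤ + 1 - g *ℤ (Q - nn +ℤ + 1))
       ≡ Q *ℤ Q *ℤ Q *ℤ (Q *ℤ Q - + 1) *ℤ (Q - + 1) *ℤ (Q *ℤ Q +ℤ Q +ℤ + 1)))
  ×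
  -- contents of each fixed-III-plane
  (∀ π → FixedIIIPlane π →
     HasCount _∼F_ (λ u → OnPlane π u × FixedPoint u) (gq q)
     × (∃ λ k → HasCount _∼F_ (λ u → OnPlane π u × IIvdots u) k
                × (+ k ≡ g *ℤ (Q - nn)))
     × (∃ λ k → HasCount _∼F_ (λ u → OnPlane π u × IIIdots u) k
                × (+ k ≡ Q *ℤ Q +ℤ Q +ℤ + 1 - g *ℤ (Q - nn +ℤ + 1)))
     × HasCount SameLine (λ ℓ → LineInPlane π ℓ × FixedIILine ℓ) (gq q))
theorem20 F E X _ degree φ order3 b₀ b₁ b₂ frame fixes σ σ-⊕ σ-·ᶠ _ σ-cube σ∼φ _ =
  planes , λ π π-III → fixed-points π π-III , II-points π π-III , III-points π π-III , II-lines π π-III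
  where
  open Geometry X
  open Types φ b₀ b₁ b₂ σ
  open Numerics F
  module S = Setting X degree φ order3 b₀ b₁ b₂ frame fixes σ σ-⊕ σ-·ᶠ σ-cube σ∼φ
  q = FiniteField.order F
  Q = + q
  n = nq q
  g = + gq q

  planes : ∃ λ N → HasCount SamePlane FixedIIIPlane N ×
    ((+ N) *ℤ (Q *ℤ Q +ℤ Q +ℤ + 1 - g *ℤ (Q - n +ℤ + 1))
      ≡ Q *ℤ Q *ℤ Q *ℤ (Q *ℤ Q - + 1) *ℤ (Q - + 1) *ℤ (Q *ℤ Q +ℤ Q +ℤ + 1))
  planes = let N , counted , incidences = S.count-planes in N , counted , plane-number N degree incidences

  fixed-points : ∀ π → FixedIIIPlane π → HasCount _∼F_ (λ u → OnPlane π u × FixedPoint u) (gq q)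
  fixed-points π (π-fixed , u , u-on , u-III) = S.PlaneThrough.count-fixed-points π π-fixed u u-on u-III

  II-points : ∀ π → FixedIIIPlane π → ∃ λ k → HasCount _∼F_ (λ u → OnPlane π u × IIvdots u) k × (+ k ≡ g *ℤ (Q - n))
  II-points π (π-fixed , u , u-on , u-III) = _ , S.PlaneThrough.count-II π π-fixed u u-on u-III , II-number

  III-points : ∀ π → FixedIIIPlane π → ∃ λ k → HasCount _∼F_ (λ u → OnPlane π u × IIIdots u) k
    × (+ k ≡ Q *ℤ Q +ℤ Q +ℤ + 1 - g *ℤ (Q - n +ℤ + 1))
  III-points π (π-fixed , u , u-on , u-III) = _ , S.PlaneThrough.count-III π π-fixed u u-on u-III , III-number

  II-lines : ∀ π → FixedIIIPlane π → HasCount SameLine (λ ℓ → LineInPlane π ℓ × FixedIILine ℓ) (gq q)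
  II-lines π (π-fixed , u , u-on , u-III) = S.PlaneThrough.count-lines π π-fixed u u-on u-III
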